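{- For every integer $k\geq 3$ there exist a real number $\beta>0$ and a positive integer $s_0$ such that the following holds. Let $n,s$ be integers with $s>s_0$ and $ks+k\leq n\leq (1+\beta)ks+k-2$. Suppose that $\mathcal{F}\subseteq \binom{[n]}{k}$ is non-trivial and $\nu(\mathcal{F})\leq s$. Then $$|\mathcal{F}|\leq \max\{|\mathcal{E}_0(n,k,s)|,|\mathcal{E}_1(n,k,s)|\}.$$
   Context: $[n]=\{1,\dots,n\}$ and $\binom{[n]}{k}$ is the set of all $k$-element subsets of $[n]$; a $k$-graph on $[n]$ is a family $\mathcal{F}\subseteq\binom{[n]}{k}$. $\nu(\mathcal{F})$ is the matching number of $\mathcal{F}$, i.e. the maximum number of pairwise disjoint members of $\mathcal{F}$. $\mathcal{F}$ is called non-trivial if it has no isolated vertex, i.e. every element of $[n]$ lies in some member of $\mathcal{F}$. For integers $a\le b$, $[a,b]=\{a,a+1,\dots,b\}$. Define $$\mathcal{E}_0(n,k,s)=\binom{[ks+k-2]}{k}\cup\left\{A\in \binom{[n]}{k}: A\setminus [ks+k-2]=\{ks+k-1\},\ A\cap [k-1]\neq \emptyset\right\}\cup\left\{[k-1]\cup \{x\}:ks+k\leq x\leq n\right\}$$ and $$\mathcal{E}_1(n,k,s)=\binom{[ks+k-2]}{k}\cup\bigcup_{x\in [ks+k-1,n]}\left\{A\in \binom{[n]}{k}: A\setminus [ks+k-2]=\{x\},\ 1\in A\right\}.$$ -}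

module Defs where

open import Data.Bool using (Bool; true; false; _∧_; _∨_; not)
open import Data.Nat using (ℕ; zero; suc; _+_; _*_; _∸_; _≤ᵇ_; _≡ᵇ_)
open import Data.List using (List; []; _∷_; length; filter; applyUpTo; map; _++_)
open import Data.Bool.ListAction using (all; any)
open import Data.Nat using (_<?_)
open import Relation.Nullary.Decidable.Core using (T?)
open import Data.Vec using (Vec; []; _∷_)
open import Data.Fin using (Fin)
open import Data.Fin.Subset using (Subset; _∩_; Empty; _∈_; ∣_∣)
open import Data.List.Relation.Unary.All using (All)
open import Data.List.Relation.Unary.Any using (Any)
open import Data.List.Relation.Unary.AllPairs using (AllPairs)
import Data.List.Membership.Propositional as LM
open import Relation.Binary.PropositionalEquality using (_≡_)

-- Vertex i : Fin n represents the integer toℕ i + 1, so Fin n ≅ [n] = {1,…,n}.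
-- A subset of [n] is a characteristic vector  Subset n = Vec Bool n.

-- A k-graph (family) on [n]: a duplicate-free list of k-element subsets.
-- |F| is then  length F.

Disjoint : ∀ {n} → Subset n → Subset n → Set
Disjoint A B = Empty (A ∩ B)

MatchingNumberAtMost : ∀ {n} → List (Subset n) → ℕ → Set
MatchingNumberAtMost {n} F s =
  (M : List (Subset n)) → All (λ A → A LM.∈ F) M → AllPairs Disjoint M → length M Data.Nat.≤ s

NonTrivial : ∀ {n} → List (Subset n) → Set
NonTrivial {n} F = (i : Fin n) → Any (λ A → i ∈ A) F

allSubsets : (n : ℕ) → List (Subset n)
allSubsets zero = [] ∷ []
allSubsets (suc n) = map (true ∷_) (allSubsets n) ++ map (false ∷_) (allSubsets n)

elemsFrom : ∀ {m} → ℕ → Vec Bool m → List ℕ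
elemsFrom o [] = []
elemsFrom o (true ∷ v) = suc o ∷ elemsFrom (suc o) v
elemsFrom o (false ∷ v) = elemsFrom (suc o) v

elems : ∀ {n} → Subset n → List ℕ
elems = elemsFrom 0

interval : ℕ → ℕ → List ℕ
interval a b = applyUpTo (a +_) (suc b ∸ a)

eqList : List ℕ → List ℕ → Bool
eqList [] [] = true
eqList (x ∷ xs) (y ∷ ys) = (x ≡ᵇ y) ∧ eqList xs ys
eqList _ _ = false

outside : ∀ {n} → ℕ → Subset n → List ℕ
outside m A = filter (λ v → m <? v) (elems A)

subsetOfb : ∀ {n} → ℕ → Subset n → Bool
subsetOfb m A = all (λ v → v ≤ᵇ m) (elems A)

meetsb : ∀ {n} → ℕ → Subset n → Bool
meetsb m A = any (λ v → v ≤ᵇ m) (elems A)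

sizeb : ∀ {n} → ℕ → Subset n → Bool
sizeb k A = ∣ A ∣ ≡ᵇ k

inE0 : (n k s : ℕ) → Subset n → Bool
inE0 n k s A =
  sizeb k A ∧
  ( subsetOfb m A
  ∨ (eqList (outside m A) (suc m ∷ []) ∧ meetsb (k ∸ 1) A)
  ∨ any (λ x → eqList (elems A) (interval 1 (k ∸ 1) ++ (x ∷ []))) (interval (k * s + k) n) )
  where m = k * s + k ∸ 2

inE1 : (n k s : ℕ) → Subset n → Bool
inE1 n k s A =
  sizeb k A ∧
  ( subsetOfb m A
  ∨ any (λ x → eqList (outside m A) (x ∷ []) ∧ any (λ v → v ≡ᵇ 1) (elems A)) (interval (suc m) n) )
  where m = k * s + k ∸ 2

E0size : (n k s : ℕ) → ℕ
E0size n k s = length (filter (λ A → T? (inE0 n k s A)) (allSubsets n))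

E1size : (n k s : ℕ) → ℕ
E1size n k s = length (filter (λ A → T? (inE1 n k s A)) (allSubsets n))

{-# OPTIONS --safe #-}
module Submission where

-- Put m = k(s + 1) − 2 and suppose |F| > C(m, k).  As n is at most (1 + β)ks, almost all k-sets are
-- in F.  Call a vertex low if few vertices meet all edges through it, let L be the set of low vertices
-- and H its complement; L is small.  A switching argument shows that F has an almost perfect matching
-- on H with any small set of vertices removed.  Since ν(F) ≤ s, this gives |H| + r ≤ m + 1 for every
-- matching of r edges meeting L, so |H| ≤ m by non-triviality.  If |H| < m, the edges meeting L have a
-- cover by O(m − |H|) vertices and there are too few of them.  If |H| = m, the edges meeting L have
-- exactly one vertex in L and intersect pairwise, so their traces on H form n − m ≥ 2 nonempty pairwise
-- cross-intersecting families of (k − 1)-sets.  Let K x be the set of common elements of all the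
-- families other than the x-th.  If two of these sets are nonempty, all families are stars and E₁ wins;
-- if |K x| = k − 1, all but the x-th family equal {K x} and E₀ wins; otherwise a union bound is enough,
-- as m is large.

open import Defs
open import Data.Bool using (true; false; if_then_else_; T)
open import Data.Bool.Properties using (T-∧; T-∨)
import Data.Bool.Properties as Bool
open import Data.Empty using (⊥-elim)
open import Data.Fin using (Fin; zero; suc; toℕ; fromℕ<)
import Data.Fin.Properties as Fin
open import Data.Fin.Subset hiding (⊥; inside; outside)
import Data.Fin.Subset as Sub
open import Data.Fin.Subset.Properties
open import Data.List using (List; []; _∷_; length; filter; map; _++_; replicate; applyUpTo)
open import Data.List.Properties using (length-++; length-map; length-replicate; filter-++; filter-accept; filter-reject; filter-none)
import Data.List.Membership.DecPropositional as DecMembership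
import Data.List.Membership.Propositional as LM
import Data.List.Membership.Propositional.Properties as LMP
open import Data.List.Relation.Binary.Permutation.Propositional using (_↭_; prep; swap) renaming (refl to ↭-refl; trans to ↭-trans)
open import Data.List.Relation.Binary.Permutation.Propositional.Properties using (All-resp-↭; ↭-length; ++⁺ˡ)
open import Data.List.Relation.Unary.All using (All; []; _∷_)
import Data.List.Relation.Unary.All as All
import Data.List.Relation.Unary.All.Properties as AllP
open import Data.List.Relation.Unary.AllPairs using (AllPairs; []; _∷_)
import Data.List.Relation.Unary.AllPairs.Properties as AllPairsP
open import Data.List.Relation.Unary.Any using (here; there)
import Data.List.Relation.Unary.Any as Any
import Data.List.Relation.Unary.Any.Properties as AnyP
open import Data.List.Relation.Unary.Unique.Propositional using (Unique)
open import Data.Nat using (ℕ; zero; suc; _+_; _*_; _^_; _∸_; _/_; _%_; _⊔_; _≤_; _<_; z≤n; s≤s; s≤s⁻¹; _≟_; _≤?_; _<?_; NonZero; >-nonZero)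
open import Data.Nat.Combinatorics using (_C_; nCk+nC[k+1]≡[n+1]C[k+1]; nCk≡nC[n∸k]; nCn≡1; nC1≡n; k>n⇒nCk≡0)
open import Data.Nat.DivMod using (m/n*n≤m; m≡m%n+[m/n]*n; m%n<n; /-monoˡ-≤; m*n/n≡m)
open import Data.Nat.Properties hiding (_≟_; _≤?_; _<?_)
open import Data.Nat.Tactic.RingSolver using (solve-∀)
open import Data.Product using (Σ; ∃; _×_; _,_; proj₁; proj₂)
open import Data.Sum using (_⊎_; inj₁; inj₂; [_,_]′)
open import Data.Unit using (tt)
open import Data.Vec using ([]; _∷_; here; there; tabulate)
open import Data.Vec.Properties using (≡-dec; lookup⇒[]=; []=⇒lookup; lookup∘tabulate)
open import Function using (_∘_; id)
open import Function.Bundles using (Equivalence)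
open import Relation.Binary.PropositionalEquality using (_≡_; _≢_; refl; sym; trans; cong; cong₂; subst; module ≡-Reasoning)
open import Relation.Nullary using (¬_; Dec; yes; no; does; ¬?)
open import Relation.Nullary.Decidable using (_×-dec_; _⊎-dec_; _→-dec_; T?; decidable-stable; dec-true)

-- Low vertices are defined by covers and not by degrees because this serves twice. A vertex that is
-- not low lies in an edge avoiding any prescribed set of at most `τ` other vertices, so the
-- exceptional vertices of H can be absorbed one by one. A low vertex lies in at most τ C(n - 2, k -
-- 2) edges, a small fraction of the C(|H|, k - 1) edges gained by one more vertex in H. The bound
-- |H| + r ≤ m + 1 counts vertices: s edges and fewer than k leftover vertices account for at most
-- k(s + 1) - 1 = m + 1 vertices, and each of the r edges meeting L spends at most k - 1 vertices of
-- H, hence saves one. There is no error term, so the matching on H must leave fewer than k vertices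
-- uncovered; an asymptotic packing would not do. Families are counted as sums of 0/1 indicators
-- over all subsets, which makes union bounds and double counting pointwise inequalities. Bounds
-- involving differences are stated additively, since subtraction on ℕ truncates.

private variable n : ℕ

-- Indicators, and sums over vertices and over subsets

ind : {P : Set} → Dec P → ℕ
ind d = if does d then 1 else 0

ind-≡1 : {P : Set} (d : Dec P) → P → ind d ≡ 1
ind-≡1 (yes _) _ = refl
ind-≡1 (no ¬p) p = ⊥-elim (¬p p)

ind-≡0 : {P : Set} (d : Dec P) → ¬ P → ind d ≡ 0
ind-≡0 (yes p) ¬p = ⊥-elim (¬p p)
ind-≡0 (no _) _ = refl

ind-elim : {P : Set} (d : Dec P) {x : ℕ} → (P → 1 ≤ x) → ind d ≤ x
ind-elim (yes p) f = f p
ind-elim (no _) f = z≤n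

ind-mono : {P Q : Set} (d : Dec P) (e : Dec Q) → (P → Q) → ind d ≤ ind e
ind-mono d e f = ind-elim d λ p → ≤-reflexive (sym (ind-≡1 e (f p)))

ind-cong : {P Q : Set} (d : Dec P) (e : Dec Q) → (P → Q) → (Q → P) → ind d ≡ ind e
ind-cong d e f g = ≤-antisym (ind-mono d e f) (ind-mono e d g)

ind-⊎ : {P Q R : Set} (d : Dec P) (e : Dec Q) (c : Dec R) → (P → Q ⊎ R) → ind d ≤ ind e + ind c
ind-⊎ d e c f = ind-elim d λ p → go (f p)
  where
  go : _ ⊎ _ → 1 ≤ ind e + ind c
  go (inj₁ q) = ≤-trans (≤-reflexive (sym (ind-≡1 e q))) (m≤m+n _ _)
  go (inj₂ r) = ≤-trans (≤-reflexive (sym (ind-≡1 c r))) (m≤n+m _ (ind e))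

ind-disjoint : {P Q R : Set} (d : Dec P) (e : Dec Q) (c : Dec R) → (P → R) → (Q → R) → (P → ¬ Q) →
  ind d + ind e ≤ ind c
ind-disjoint (yes p) (yes q) c f g h = ⊥-elim (h p q)
ind-disjoint (yes p) (no _) c f g h = ≤-reflexive (sym (ind-≡1 c (f p)))
ind-disjoint (no _) e c f g h = ind-mono e c g

ind-× : {P Q : Set} (d : Dec P) (e : Dec Q) → ind (d ×-dec e) ≡ ind d * ind e
ind-× (yes _) (yes _) = refl
ind-× (yes _) (no _) = refl
ind-× (no _) _ = refl

*-ind-mono : {P : Set} (d : Dec P) {a b : ℕ} → (P → a ≤ b) → a * ind d ≤ b * ind d
*-ind-mono (yes p) h = *-monoˡ-≤ 1 (h p)
*-ind-mono (no _) {a} _ = ≤-trans (≤-reflexive (*-zeroʳ a)) z≤n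

ind-*-mono : {P : Set} (d : Dec P) {a b : ℕ} → (P → a ≤ b) → ind d * a ≤ ind d * b
ind-*-mono (yes p) h = *-monoʳ-≤ 1 (h p)
ind-*-mono (no _) _ = z≤n

Σᵥ : ∀ {n} → (Fin n → ℕ) → ℕ
Σᵥ {zero} f = 0
Σᵥ {suc n} f = f zero + Σᵥ (f ∘ suc)

Σₛ : ∀ {n} → (Subset n → ℕ) → ℕ
Σₛ {zero} f = f []
Σₛ {suc n} f = Σₛ (f ∘ (true ∷_)) + Σₛ (f ∘ (false ∷_))

Σᵥ-mono : ∀ {n} {f g : Fin n → ℕ} → (∀ v → f v ≤ g v) → Σᵥ f ≤ Σᵥ g
Σᵥ-mono {zero} h = z≤n
Σᵥ-mono {suc n} h = +-mono-≤ (h zero) (Σᵥ-mono (h ∘ suc))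

Σᵥ-+ : ∀ {n} (f g : Fin n → ℕ) → Σᵥ (λ v → f v + g v) ≡ Σᵥ f + Σᵥ g
Σᵥ-+ {zero} f g = refl
Σᵥ-+ {suc n} f g rewrite Σᵥ-+ (f ∘ suc) (g ∘ suc) = +-interchange (f zero) (g zero) _ _
  where
  +-interchange : ∀ a b c d → (a + b) + (c + d) ≡ (a + c) + (b + d)
  +-interchange = solve-∀

Σᵥ-*ʳ : ∀ {n} (f : Fin n → ℕ) c → Σᵥ (λ v → f v * c) ≡ Σᵥ f * c
Σᵥ-*ʳ {zero} f c = refl
Σᵥ-*ʳ {suc n} f c rewrite Σᵥ-*ʳ (f ∘ suc) c = sym (*-distribʳ-+ c (f zero) _)

Σᵥ-point : ∀ {n} (f : Fin n → ℕ) v → f v ≤ Σᵥ f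
Σᵥ-point f zero = m≤m+n _ _
Σᵥ-point f (suc v) = ≤-trans (Σᵥ-point (f ∘ suc) v) (m≤n+m _ (f zero))

Σₛ-mono : ∀ {n} {f g : Subset n → ℕ} → (∀ A → f A ≤ g A) → Σₛ f ≤ Σₛ g
Σₛ-mono {zero} h = h []
Σₛ-mono {suc n} h = +-mono-≤ (Σₛ-mono (λ A → h (true ∷ A))) (Σₛ-mono (λ A → h (false ∷ A)))

Σₛ-cong : ∀ {n} {f g : Subset n → ℕ} → (∀ A → f A ≡ g A) → Σₛ f ≡ Σₛ g
Σₛ-cong h = ≤-antisym (Σₛ-mono (≤-reflexive ∘ h)) (Σₛ-mono (≤-reflexive ∘ sym ∘ h))

Σₛ-0 : ∀ {n} → Σₛ {n} (λ _ → 0) ≡ 0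
Σₛ-0 {zero} = refl
Σₛ-0 {suc n} rewrite Σₛ-0 {n} = refl

Σₛ-+ : ∀ {n} (f g : Subset n → ℕ) → Σₛ (λ A → f A + g A) ≡ Σₛ f + Σₛ g
Σₛ-+ {zero} f g = refl
Σₛ-+ {suc n} f g rewrite Σₛ-+ (f ∘ (true ∷_)) (g ∘ (true ∷_)) | Σₛ-+ (f ∘ (false ∷_)) (g ∘ (false ∷_)) =
  +-interchange (Σₛ (f ∘ (true ∷_))) (Σₛ (g ∘ (true ∷_))) _ _
  where
  +-interchange : ∀ a b c d → (a + b) + (c + d) ≡ (a + c) + (b + d)
  +-interchange = solve-∀

Σₛ-*ˡ : ∀ {n} c (f : Subset n → ℕ) → Σₛ (λ A → c * f A) ≡ c * Σₛ f
Σₛ-*ˡ {zero} c f = refl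
Σₛ-*ˡ {suc n} c f rewrite Σₛ-*ˡ c (f ∘ (true ∷_)) | Σₛ-*ˡ c (f ∘ (false ∷_)) = sym (*-distribˡ-+ c _ _)

Σₛ-point : ∀ {n} (f : Subset n → ℕ) A → f A ≤ Σₛ f
Σₛ-point f [] = ≤-refl
Σₛ-point f (true ∷ A) = ≤-trans (Σₛ-point (f ∘ (true ∷_)) A) (m≤m+n _ _)
Σₛ-point f (false ∷ A) = ≤-trans (Σₛ-point (f ∘ (false ∷_)) A) (m≤n+m _ _)

Σₛ-Σᵥ-swap : ∀ {n j} (f : Fin j → Subset n → ℕ) → Σₛ (λ A → Σᵥ (λ v → f v A)) ≡ Σᵥ (λ v → Σₛ (f v))
Σₛ-Σᵥ-swap {n} {zero} f = Σₛ-0 {n}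
Σₛ-Σᵥ-swap {n} {suc j} f = trans (Σₛ-+ (f zero) (λ A → Σᵥ (λ v → f (suc v) A)))
  (cong (Σₛ (f zero) +_) (Σₛ-Σᵥ-swap (f ∘ suc)))

-- Cardinalities of sets of vertices

card-Σᵥ : ∀ {n} (p : Subset n) → ∣ p ∣ ≡ Σᵥ (λ v → ind (v ∈? p))
card-Σᵥ [] = refl
card-Σᵥ (true ∷ p) = cong suc (card-Σᵥ p)
card-Σᵥ (false ∷ p) = card-Σᵥ p

card-cover : (p q r : Subset n) → (∀ {x} → x ∈ p → x ∈ q ⊎ x ∈ r) → ∣ p ∣ ≤ ∣ q ∣ + ∣ r ∣
card-cover p q r f rewrite card-Σᵥ p | card-Σᵥ q | card-Σᵥ r
  | sym (Σᵥ-+ (λ v → ind (v ∈? q)) (λ v → ind (v ∈? r))) =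
  Σᵥ-mono λ v → ind-⊎ (v ∈? p) (v ∈? q) (v ∈? r) f

card-disjoint-∪ : (p q r : Subset n) → p ⊆ r → q ⊆ r → (∀ {x} → x ∈ p → x ∉ q) → ∣ p ∣ + ∣ q ∣ ≤ ∣ r ∣
card-disjoint-∪ p q r p⊆r q⊆r dis rewrite card-Σᵥ p | card-Σᵥ q | card-Σᵥ r
  | sym (Σᵥ-+ (λ v → ind (v ∈? p)) (λ v → ind (v ∈? q))) =
  Σᵥ-mono λ v → ind-disjoint (v ∈? p) (v ∈? q) (v ∈? r) p⊆r q⊆r dis

∣∪∣≤ : (p q : Subset n) → ∣ p ∪ q ∣ ≤ ∣ p ∣ + ∣ q ∣
∣∪∣≤ p q = card-cover (p ∪ q) p q (x∈p∪q⁻ p q)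

∣∁∣ : (p : Subset n) → ∣ p ∣ + ∣ ∁ p ∣ ≡ n
∣∁∣ {n} p rewrite ∣∁p∣≡n∸∣p∣ p = m+[n∸m]≡n (∣p∣≤n p)

∪⁅⁆-size : (S : Subset n) {v : Fin n} → v ∉ S → ∣ S ∪ ⁅ v ⁆ ∣ ≡ suc ∣ S ∣
∪⁅⁆-size S {v} v∉S = ≤-antisym
  (≤-trans (∣∪∣≤ S ⁅ v ⁆) (≤-reflexive (trans (cong (∣ S ∣ +_) (∣⁅x⁆∣≡1 v)) (+-comm ∣ S ∣ 1))))
  (≤-trans (≤-reflexive (trans (+-comm 1 ∣ S ∣) (cong (∣ S ∣ +_) (sym (∣⁅x⁆∣≡1 v)))))
    (card-disjoint-∪ S ⁅ v ⁆ (S ∪ ⁅ v ⁆) (p⊆p∪q ⁅ v ⁆) (q⊆p∪q S ⁅ v ⁆)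
      λ { x∈S x∈v → v∉S (subst (_∈ S) (x∈⁅y⁆⇒x≡y v x∈v) x∈S) }))

∉─ : (p q : Subset n) {x : Fin n} → x ∈ p ─ q → x ∉ q
∉─ (true ∷ p) (false ∷ q) here ()
∉─ (_ ∷ p) (_ ∷ q) (there x∈) (there x∈q) = ∉─ p q x∈ x∈q

∃-∖ : (p q : Subset n) → ∣ q ∣ < ∣ p ∣ → ∃ λ x → x ∈ p × x ∉ q
∃-∖ p q q<p with nonempty? (p ─ q)
... | yes (x , x∈) = x , p─q⊆p p q x∈ , ∉─ p q x∈
... | no e = ⊥-elim (<⇒≱ q<p (p⊆q⇒∣p∣≤∣q∣ sub))
  where
  sub : p ⊆ q
  sub {x} x∈p with x ∈? q
  ... | yes x∈q = x∈q
  ... | no x∉q = ⊥-elim (e (x , x∈p∧x∉q⇒x∈p─q x∈p x∉q))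

∣p∣≤∣q∣+∣p─q∣ : (p q : Subset n) → ∣ p ∣ ≤ ∣ q ∣ + ∣ p ─ q ∣
∣p∣≤∣q∣+∣p─q∣ p q = card-cover p q (p ─ q) split
  where
  split : ∀ {x} → x ∈ p → x ∈ q ⊎ x ∈ p ─ q
  split {x} x∈ with x ∈? q
  ... | yes x∈q = inj₁ x∈q
  ... | no x∉q = inj₂ (x∈p∧x∉q⇒x∈p─q x∈ x∉q)

∣-∣ : (p : Subset n) (x : Fin n) → ∣ p ∣ ≤ suc ∣ p - x ∣
∣-∣ p x = ≤-trans (∣p∣≤∣q∣+∣p─q∣ p ⁅ x ⁆) (≤-reflexive (cong (_+ ∣ p - x ∣) (∣⁅x⁆∣≡1 x)))

-- Families as lists and as sums of indicators

_≟ₛ_ : (A B : Subset n) → Dec (A ≡ B)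
_≟ₛ_ = ≡-dec Bool._≟_

open module SubsetMembership {n} = DecMembership (_≟ₛ_ {n}) using () renaming (_∈?_ to _∈ₗ?_)

length≤Σₛ : {F : List (Subset n)} → Unique F → length F ≤ Σₛ (λ A → ind (A ∈ₗ? F))
length≤Σₛ {F = []} u = z≤n
length≤Σₛ {n} {F = A ∷ F} (A∉ ∷ u) = ≤-trans (+-mono-≤ one (length≤Σₛ u))
  (≤-trans (≤-reflexive (sym (Σₛ-+ (λ B → ind (B ≟ₛ A)) (λ B → ind (B ∈ₗ? F))))) (Σₛ-mono go))
  where
  one : 1 ≤ Σₛ (λ B → ind (B ≟ₛ A))
  one = ≤-trans (≤-reflexive (sym (ind-≡1 (A ≟ₛ A) refl))) (Σₛ-point (λ B → ind (B ≟ₛ A)) A)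
  go : ∀ B → ind (B ≟ₛ A) + ind (B ∈ₗ? F) ≤ ind (B ∈ₗ? (A ∷ F))
  go B with B ≟ₛ A | B ∈ₗ? F
  ... | yes refl | yes q = ⊥-elim (All.lookup A∉ q refl)
  ... | yes refl | no _ = ≤-refl
  ... | no _ | yes q = ≤-refl
  ... | no _ | no _ = z≤n

filter-allSubsets : ∀ {n} {P : Subset n → Set} (P? : ∀ A → Dec (P A)) →
  length (filter P? (allSubsets n)) ≡ Σₛ (λ A → ind (P? A))
filter-allSubsets {zero} P? with P? []
... | yes _ = refl
... | no _ = refl
filter-allSubsets {suc n} {P} P? = begin
  length (filter P? (map (true ∷_) (allSubsets n) ++ map (false ∷_) (allSubsets n)))
    ≡⟨ cong length (filter-++ P? (map (true ∷_) (allSubsets n)) _) ⟩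
  length (filter P? (map (true ∷_) (allSubsets n)) ++ filter P? (map (false ∷_) (allSubsets n)))
    ≡⟨ length-++ (filter P? (map (true ∷_) (allSubsets n))) ⟩
  length (filter P? (map (true ∷_) (allSubsets n))) + length (filter P? (map (false ∷_) (allSubsets n)))
    ≡⟨ cong₂ _+_ (push true (allSubsets n)) (push false (allSubsets n)) ⟩
  length (filter (P? ∘ (true ∷_)) (allSubsets n)) + length (filter (P? ∘ (false ∷_)) (allSubsets n))
    ≡⟨ cong₂ _+_ (filter-allSubsets (P? ∘ (true ∷_))) (filter-allSubsets (P? ∘ (false ∷_))) ⟩
  Σₛ (λ A → ind (P? A)) ∎
  where
  open ≡-Reasoning
  push : ∀ b (As : List (Subset n)) → length (filter P? (map (b ∷_) As)) ≡ length (filter (P? ∘ (b ∷_)) As)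
  push b [] = refl
  push b (A ∷ As) with P? (b ∷ A)
  ... | yes _ = cong suc (push b As)
  ... | no _ = push b As

-- Counting the sets between two given sets; union bounds

nC0 : ∀ n → n C 0 ≡ 1
nC0 n = trans (nCk≡nC[n∸k] {0} {n} z≤n) (nCn≡1 n)

pascal : ∀ n k → suc n C suc k ≡ n C k + n C suc k
pascal n k = sym (nCk+nC[k+1]≡[n+1]C[k+1] n k)

Between : Subset n → Subset n → ℕ → Subset n → Set
Between K U j A = K ⊆ A × A ⊆ U × ∣ A ∣ ≡ j

between? : (K U : Subset n) (j : ℕ) (A : Subset n) → Dec (Between K U j A)
between? K U j A = (K ⊆? A) ×-dec ((A ⊆? U) ×-dec (∣ A ∣ ≟ j))

-- Coordinates in `K` are forced in and coordinates outside `U` are forced out. Only a coordinate of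
-- `U` outside `K` leaves a choice, and its two cases are the two terms of Pascal's rule.
count-between : (K U : Subset n) (u t : ℕ) → K ⊆ U → ∣ U ∣ ≡ ∣ K ∣ + u →
  Σₛ (λ A → ind (between? K U (∣ K ∣ + t) A)) ≡ u C t
count-between [] [] .0 zero K⊆U refl = refl
count-between [] [] .0 (suc t) K⊆U refl = sym (k>n⇒nCk≡0 {0} {suc t} (s≤s z≤n))
count-between (true ∷ K) (false ∷ U) u t K⊆U eq with K⊆U here
... | ()
count-between {suc n} (true ∷ K) (true ∷ U) u t K⊆U eq = trans (cong₂ _+_
    (trans (Σₛ-cong λ A → ind-cong (between? (true ∷ K) (true ∷ U) (suc (∣ K ∣ + t)) (true ∷ A))
        (between? K U (∣ K ∣ + t) A)
         (λ (a , b , c) → drop-∷-⊆ a , drop-∷-⊆ b , suc-injective c)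
         (λ (a , b , c) → in⊆in a , in⊆in b , cong suc c))
       (count-between K U u t (drop-∷-⊆ K⊆U) (suc-injective eq)))
    (trans (Σₛ-cong λ A → ind-≡0 (between? (true ∷ K) (true ∷ U) (suc (∣ K ∣ + t)) (false ∷ A))
         λ (a , _) → absurd (a here)) (Σₛ-0 {n})))
    (+-identityʳ _)
  where
  absurd : ∀ {A : Subset n} {X : Set} → zero ∈ false ∷ A → X
  absurd ()
count-between {suc n} (false ∷ K) (false ∷ U) u t K⊆U eq = cong₂ _+_
    (trans (Σₛ-cong λ A → ind-≡0 (between? (false ∷ K) (false ∷ U) (∣ K ∣ + t) (true ∷ A))
         λ (_ , b , _) → absurd (b here)) (Σₛ-0 {n}))
    (trans (Σₛ-cong λ A → ind-cong (between? (false ∷ K) (false ∷ U) (∣ K ∣ + t) (false ∷ A))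
        (between? K U (∣ K ∣ + t) A)
         (λ (a , b , c) → drop-∷-⊆ a , drop-∷-⊆ b , c)
         (λ (a , b , c) → out⊆ a , out⊆ b , c))
       (count-between K U u t (drop-∷-⊆ K⊆U) eq))
  where
  absurd : ∀ {A : Subset n} {X : Set} → zero ∈ false ∷ A → X
  absurd ()
count-between (false ∷ K) (true ∷ U) zero t K⊆U eq =
  ⊥-elim (<⇒≱ (≤-reflexive (trans eq (+-identityʳ _))) (p⊆q⇒∣p∣≤∣q∣ (drop-∷-⊆ K⊆U)))
count-between {suc n} (false ∷ K) (true ∷ U) (suc u) t K⊆U eq =
  trans (cong₂ _+_ (top t) bot) (sum t)
  where
  K⊆U′ : K ⊆ U
  K⊆U′ = drop-∷-⊆ K⊆U
  eq′ : ∣ U ∣ ≡ ∣ K ∣ + u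
  eq′ = suc-injective (trans eq (+-suc _ _))
  bot : Σₛ (λ A → ind (between? (false ∷ K) (true ∷ U) (∣ K ∣ + t) (false ∷ A))) ≡ u C t
  bot = trans (Σₛ-cong λ A → ind-cong (between? (false ∷ K) (true ∷ U) (∣ K ∣ + t) (false ∷ A))
      (between? K U (∣ K ∣ + t) A)
         (λ (a , b , c) → drop-∷-⊆ a , drop-∷-⊆ b , c)
         (λ (a , b , c) → out⊆ a , out⊆ b , c))
       (count-between K U u t K⊆U′ eq′)
  -- This is C(u, t - 1), with value 0 at t = 0, where truncated subtraction would give 1.
  tops : ℕ → ℕ
  tops zero = 0
  tops (suc t) = u C t
  top : ∀ t → Σₛ (λ A → ind (between? (false ∷ K) (true ∷ U) (∣ K ∣ + t) (true ∷ A))) ≡ tops t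
  top zero = trans (Σₛ-cong λ A → ind-≡0 (between? (false ∷ K) (true ∷ U) (∣ K ∣ + 0) (true ∷ A))
    λ (a , b , c) → <⇒≱ (≤-reflexive (trans c (+-identityʳ _))) (p⊆q⇒∣p∣≤∣q∣ (drop-∷-⊆ a))) (Σₛ-0 {n})
  top (suc t) = trans (Σₛ-cong λ A → ind-cong (between? (false ∷ K) (true ∷ U) (∣ K ∣ + suc t) (true ∷ A))
      (between? K U (∣ K ∣ + t) A)
         (λ (a , b , c) → drop-∷-⊆ a , drop-∷-⊆ b , suc-injective (trans c (+-suc _ _)))
         (λ (a , b , c) → out⊆ a , in⊆in b , trans (cong suc c) (sym (+-suc _ _))))
       (count-between K U u t K⊆U′ eq′)
  sum : ∀ t → tops t + u C t ≡ suc u C t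
  sum zero = trans (nC0 u) (sym (nC0 (suc u)))
  sum (suc t) = sym (pascal u t)

-- Union bound over a vertex cover `T`. The degrees stay inside the sum, so that different vertices
-- of `T` can later receive different bounds.
cover-bound : {P : Subset n → Set} (P? : ∀ A → Dec (P A)) (T : Subset n) →
  (∀ {A} → P A → ∃ λ v → v ∈ T × v ∈ A) →
  Σₛ (λ A → ind (P? A)) ≤ Σᵥ (λ v → ind (v ∈? T) * Σₛ (λ A → ind (P? A ×-dec (v ∈? A))))
cover-bound P? T meets = begin
  Σₛ (λ A → ind (P? A))
    ≤⟨ Σₛ-mono (λ A → ind-elim (P? A) (λ p → go A p (meets p))) ⟩
  Σₛ (λ A → Σᵥ (λ v → ind (v ∈? T) * ind (P? A ×-dec (v ∈? A))))
    ≡⟨ Σₛ-Σᵥ-swap (λ v A → ind (v ∈? T) * ind (P? A ×-dec (v ∈? A))) ⟩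
  Σᵥ (λ v → Σₛ (λ A → ind (v ∈? T) * ind (P? A ×-dec (v ∈? A))))
    ≤⟨ Σᵥ-mono (λ v → ≤-reflexive (Σₛ-*ˡ (ind (v ∈? T)) (λ A → ind (P? A ×-dec (v ∈? A))))) ⟩
  Σᵥ (λ v → ind (v ∈? T) * Σₛ (λ A → ind (P? A ×-dec (v ∈? A)))) ∎
  where
  open ≤-Reasoning
  go : ∀ A → _ → ∃ (λ v → v ∈ T × v ∈ A) → 1 ≤ Σᵥ (λ v → ind (v ∈? T) * ind (P? A ×-dec (v ∈? A)))
  go A p (v , v∈T , v∈A) = ≤-trans
    (≤-reflexive (sym (cong₂ _*_ (ind-≡1 (v ∈? T) v∈T) (ind-≡1 (P? A ×-dec (v ∈? A)) (p , v∈A)))))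
    (Σᵥ-point (λ v → ind (v ∈? T) * ind (P? A ×-dec (v ∈? A))) v)

weighted-≤ : (T : Subset n) (f : Fin n → ℕ) (c : ℕ) → (∀ v → v ∈ T → f v ≤ c) →
  Σᵥ (λ v → ind (v ∈? T) * f v) ≤ ∣ T ∣ * c
weighted-≤ T f c h rewrite card-Σᵥ T | sym (Σᵥ-*ʳ (λ v → ind (v ∈? T)) c) =
  Σᵥ-mono λ v → ind-*-mono (v ∈? T) (h v)

cover-bound-uniform : {P : Subset n → Set} (P? : ∀ A → Dec (P A)) (T : Subset n) (c : ℕ) →
  (∀ {A} → P A → ∃ λ v → v ∈ T × v ∈ A) →
  (∀ v → v ∈ T → Σₛ (λ A → ind (P? A ×-dec (v ∈? A))) ≤ c) →
  Σₛ (λ A → ind (P? A)) ≤ ∣ T ∣ * c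
cover-bound-uniform P? T c meets b = ≤-trans (cover-bound P? T meets) (weighted-≤ T _ c b)

-- Inequalities for binomial coefficients

0C : ∀ k → 0 C suc k ≡ 0
0C k = k>n⇒nCk≡0 {0} {suc k} (s≤s z≤n)

C-mono : ∀ {a b} k → a ≤ b → a C k ≤ b C k
C-mono {zero} {b} zero _ rewrite nC0 b = ≤-refl
C-mono {zero} {b} (suc k) _ rewrite 0C k = z≤n
C-mono {suc a} {suc b} zero _ rewrite nC0 (suc a) | nC0 (suc b) = ≤-refl
C-mono {suc a} {suc b} (suc k) (s≤s a≤b) rewrite pascal a k | pascal b k =
  +-mono-≤ (C-mono k a≤b) (C-mono (suc k) a≤b)

C≤^ : ∀ n k → n C k ≤ n ^ k
C≤^ n zero rewrite nC0 n = ≤-refl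
C≤^ zero (suc k) rewrite 0C k = z≤n
C≤^ (suc n) (suc k) rewrite pascal n k = begin
  n C k + n C suc k ≤⟨ +-mono-≤ (C≤^ n k) (C≤^ n (suc k)) ⟩
  suc n * n ^ k ≤⟨ *-monoʳ-≤ (suc n) (^-monoˡ-≤ k (n≤1+n n)) ⟩
  suc n * suc n ^ k ∎
  where open ≤-Reasoning

-- Pascal's rule telescoped over `b` steps: the upper entries of the added terms stay below a + b,
-- hence are at most `N`. In `C-lower` they are at least `a`.
C-upper : ∀ a b k {N} → a + b ≤ suc N → (a + b) C suc k ≤ a C suc k + b * (N C k)
C-upper a zero k h rewrite +-identityʳ a = m≤m+n _ _
C-upper a (suc b) k {N} h rewrite +-suc a b | pascal (a + b) k = begin
  (a + b) C k + (a + b) C suc k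
    ≤⟨ +-mono-≤ (C-mono k (s≤s⁻¹ h)) (C-upper a b k (≤-trans (n≤1+n _) h)) ⟩
  N C k + (a C suc k + b * (N C k)) ≡⟨ shuffle (N C k) (a C suc k) (b * (N C k)) ⟩
  a C suc k + (N C k + b * (N C k)) ∎
  where
  open ≤-Reasoning
  shuffle : ∀ x y z → x + (y + z) ≡ y + (x + z)
  shuffle = solve-∀

C-lower : ∀ a b k → a C suc k + b * (a C k) ≤ (a + b) C suc k
C-lower a zero k rewrite +-identityʳ a = ≤-reflexive (+-identityʳ _)
C-lower a (suc b) k rewrite +-suc a b | pascal (a + b) k = begin
  a C suc k + (a C k + b * (a C k)) ≡⟨ shuffle (a C suc k) (a C k) (b * (a C k)) ⟩
  a C k + (a C suc k + b * (a C k)) ≤⟨ +-mono-≤ (C-mono k (m≤m+n a b)) (C-lower a b k) ⟩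
  (a + b) C k + (a + b) C suc k ∎
  where
  open ≤-Reasoning
  shuffle : ∀ x y z → x + (y + z) ≡ y + (x + z)
  shuffle = solve-∀

-- Choosing one element from each of `b` blocks of size `x` gives x^b distinct sets; the induction
-- adds one block at a time.
^≤C : ∀ x b → x ^ b ≤ (b * x) C b
^≤C x zero = ≤-refl
^≤C x (suc b) = begin
  x * x ^ b ≤⟨ *-monoʳ-≤ x (^≤C x b) ⟩
  x * ((b * x) C b) ≤⟨ m≤n+m _ ((b * x) C suc b) ⟩
  (b * x) C suc b + x * ((b * x) C b) ≤⟨ C-lower (b * x) x b ⟩
  (b * x + x) C suc b ≡⟨ cong (_C suc b) (+-comm (b * x) x) ⟩
  (x + b * x) C suc b ∎
  where open ≤-Reasoning

absorption : ∀ n k → suc k * (suc n C suc k) ≡ suc n * (n C k)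
absorption zero zero = refl
absorption zero (suc k) rewrite 0C k | pascal 0 (suc k) | 0C k | 0C (suc k) = *-zeroʳ (suc (suc k))
absorption (suc n) zero rewrite pascal (suc n) 0 | nC0 (suc n) =
  trans (cong (λ z → suc z + 0) (trans (sym (*-identityˡ _)) (trans (absorption n 0) (cong (suc n *_) (nC0 n)))))
    (+-identityʳ _)
absorption (suc n) (suc k) = begin
  suc (suc k) * (suc (suc n) C suc (suc k)) ≡⟨ cong (suc (suc k) *_) (pascal (suc n) (suc k)) ⟩
  suc (suc k) * (suc n C suc k + suc n C suc (suc k))
    ≡⟨ expand (suc k) (suc n C suc k) (suc n C suc (suc k)) ⟩
  suc n C suc k + (suc k * (suc n C suc k) + suc (suc k) * (suc n C suc (suc k)))
    ≡⟨ cong (suc n C suc k +_) (cong₂ _+_ (absorption n k) (absorption n (suc k))) ⟩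
  suc n C suc k + (suc n * (n C k) + suc n * (n C suc k))
    ≡⟨ cong (suc n C suc k +_) (sym (*-distribˡ-+ (suc n) (n C k) _)) ⟩
  suc n C suc k + suc n * (n C k + n C suc k)
    ≡⟨ cong (λ z → suc n C suc k + suc n * z) (sym (pascal n k)) ⟩
  suc (suc n) * (suc n C suc k) ∎
  where
  open ≡-Reasoning
  expand : ∀ j a b → suc j * (a + b) ≡ a + (j * a + suc j * b)
  expand = solve-∀

^-distribʳ-* : ∀ k a b → (a * b) ^ k ≡ a ^ k * b ^ k
^-distribʳ-* zero a b = refl
^-distribʳ-* (suc k) a b = trans (cong (a * b *_) (^-distribʳ-* k a b)) (interchange a b (a ^ k) (b ^ k))
  where
  interchange : ∀ a b c d → a * b * (c * d) ≡ a * c * (b * d)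
  interchange = solve-∀

-- Sets given by decidable properties; disjointness and matchings

sep : {P : Fin n → Set} → (∀ v → Dec (P v)) → Subset n
sep P? = tabulate (λ v → does (P? v))

∈sep⁺ : {P : Fin n → Set} (P? : ∀ v → Dec (P v)) {v : Fin n} → P v → v ∈ sep P?
∈sep⁺ P? {v} p = lookup⇒[]= v (sep P?) (trans (lookup∘tabulate (λ v → does (P? v)) v) (dec-true (P? v) p))

∈sep⁻ : {P : Fin n → Set} (P? : ∀ v → Dec (P v)) {v : Fin n} → v ∈ sep P? → P v
∈sep⁻ P? {v} v∈ with P? v | trans (sym ([]=⇒lookup v∈)) (lookup∘tabulate (λ v → does (P? v)) v)
... | yes p | _ = p
... | no _ | ()

disjoint⁺ : {A B : Subset n} → (∀ {x} → x ∈ A → x ∉ B) → Disjoint A B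
disjoint⁺ {A = A} {B} f (x , x∈) with x∈p∩q⁻ A B x∈
... | a , b = f a b

disjoint⁻ : {A B : Subset n} → Disjoint A B → ∀ {x} → x ∈ A → x ∉ B
disjoint⁻ d a b = d (_ , x∈p∩q⁺ (a , b))

disjoint-sym : {A B : Subset n} → Disjoint A B → Disjoint B A
disjoint-sym d = disjoint⁺ λ a b → disjoint⁻ d b a

disjoint-⊆ : {A B B′ : Subset n} → B′ ⊆ B → Disjoint A B → Disjoint A B′
disjoint-⊆ sub d = disjoint⁺ λ a b → disjoint⁻ d a (sub b)

disjoint? : (A B : Subset n) → Dec (Disjoint A B)
disjoint? A B = ¬? (nonempty? (A ∩ B))

meet : {A B : Subset n} → ¬ Disjoint A B → ∃ λ x → x ∈ A × x ∈ B
meet {A = A} {B} ¬d with nonempty? (A ∩ B)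
... | yes (x , x∈) = x , x∈p∩q⁻ A B x∈
... | no e = ⊥-elim (¬d e)

AllPairs-↭ : {M N : List (Subset n)} → M ↭ N → AllPairs Disjoint M → AllPairs Disjoint N
AllPairs-↭ ↭-refl a = a
AllPairs-↭ (prep x p) (a ∷ as) = All-resp-↭ p a ∷ AllPairs-↭ p as
AllPairs-↭ (swap x y p) ((xy ∷ ax) ∷ ay ∷ as) =
  (disjoint-sym xy ∷ All-resp-↭ p ay) ∷ All-resp-↭ p ax ∷ AllPairs-↭ p as
AllPairs-↭ (↭-trans p q) a = AllPairs-↭ q (AllPairs-↭ p a)

∈⋃⁺ : {M : List (Subset n)} {e : Subset n} {x : Fin n} → e LM.∈ M → x ∈ e → x ∈ ⋃ M
∈⋃⁺ (here refl) x∈ = x∈p∪q⁺ (inj₁ x∈)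
∈⋃⁺ {M = f ∷ M} (there e∈) x∈ = x∈p∪q⁺ {p = f} (inj₂ (∈⋃⁺ e∈ x∈))

∈⋃⁻ : (M : List (Subset n)) {x : Fin n} → x ∈ ⋃ M → ∃ λ e → e LM.∈ M × x ∈ e
∈⋃⁻ [] x∈ = ⊥-elim (∉⊥ x∈)
∈⋃⁻ (f ∷ M) x∈ with x∈p∪q⁻ f (⋃ M) x∈
... | inj₁ q = f , here refl , q
... | inj₂ q with ∈⋃⁻ M q
... | e , e∈ , x∈e = e , there e∈ , x∈e

∣⋃∣≤ : (M : List (Subset n)) (c : ℕ) → All (λ e → ∣ e ∣ ≤ c) M → ∣ ⋃ M ∣ ≤ c * length M
∣⋃∣≤ {n} [] c [] = ≤-trans (≤-reflexive (∣⊥∣≡0 n)) z≤n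
∣⋃∣≤ (e ∷ M) c (p ∷ ps) = ≤-trans (∣∪∣≤ e (⋃ M))
  (≤-trans (+-mono-≤ p (∣⋃∣≤ M c ps)) (≤-reflexive (sym (*-suc c (length M)))))

disjoint-⋃ : {M : List (Subset n)} {D : Subset n} → Disjoint D (⋃ M) → All (Disjoint D) M
disjoint-⋃ {M = M} d = All.tabulate λ e∈ → disjoint⁺ λ a b → disjoint⁻ d a (∈⋃⁺ e∈ b)

-- Disjoint edges meeting `X` use up different vertices of `X`. In the recursion the vertex `x` is
-- removed from `X`; the edge found later cannot contain it, as `e` does. The permutation allows the
-- edge found to be moved to the front.
∃-avoiding : (R : List (Subset n)) (X : Subset n) → AllPairs Disjoint R → ∣ X ∣ < length R →
  ∃ λ e → ∃ λ R′ → R ↭ e ∷ R′ × Disjoint e X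
∃-avoiding (e ∷ R) X (a ∷ as) X<R with disjoint? e X
... | yes d = e , R , ↭-refl , d
... | no ¬d with meet ¬d
... | x , x∈e , x∈X with ∃-avoiding R (X - x) as (s≤s⁻¹ (≤-trans (s≤s (x∈p⇒∣p-x∣<∣p∣ x∈X)) X<R))
... | f , R′ , perm , d = f , e ∷ R′ , ↭-trans (prep e perm) (swap e f ↭-refl) , disjoint⁺ dis
  where
  dis : ∀ {z} → z ∈ f → z ∉ X
  dis {z} z∈f z∈X = disjoint⁻ d z∈f (x∈p∧x≢y⇒x∈p-y z∈X λ { refl →
    disjoint⁻ (All.head (All-resp-↭ perm a)) x∈e z∈f })

length≤∣hit∣ : (M : List (Subset n)) (X : Subset n) → AllPairs Disjoint M →
  All (λ e → ¬ Disjoint e X) M → length M ≤ ∣ X ∣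
length≤∣hit∣ M X dis hit = ≮⇒≥ λ X<M → let (e , R , perm , d) = ∃-avoiding M X dis X<M in
  All.head (All-resp-↭ perm hit) d

-- Almost perfect matchings by switching

module Matchings {n : ℕ} (k₁ y : ℕ) (F : List (Subset n))
  (uniform : ∀ {A} → A LM.∈ F → ∣ A ∣ ≡ suc k₁) where

  k : ℕ
  k = suc k₁

  -- Good i S: by adding i vertices to S, each outside an exceptional set of fewer than k * y
  -- vertices (depending on the previous choices), one always arrives at a member of F.
  Good : ℕ → Subset n → Set
  bad? : ∀ i S v → Dec (v ∉ S × ¬ Good i (S ∪ ⁅ v ⁆))
  good? : ∀ i S → Dec (Good i S)

  Good zero S = S LM.∈ F
  Good (suc i) S = ∣ sep (bad? i S) ∣ < k * y

  bad? i S v = ¬? (v ∈? S) ×-dec ¬? (good? i (S ∪ ⁅ v ⁆))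

  good? zero S = S ∈ₗ? F
  good? (suc i) S = ∣ sep (bad? i S) ∣ <? k * y

  bad : ℕ → Subset n → Subset n
  bad i S = sep (bad? i S)

  extend : ∀ {i S v} → v ∉ S → v ∉ bad i S → Good i (S ∪ ⁅ v ⁆)
  extend {i} {S} v∉S v∉bad = decidable-stable (good? i _) λ ¬g → v∉bad (∈sep⁺ (bad? i S) (v∉S , ¬g))

  Missing : Subset n → Subset n → Set
  Missing S A = ∣ A ∣ ≡ k × (¬ A LM.∈ F) × S ⊆ A

  missing? : ∀ S A → Dec (Missing S A)
  missing? S A = (∣ A ∣ ≟ k) ×-dec (¬? (A ∈ₗ? F) ×-dec (S ⊆? A))

  #missing : Subset n → ℕ
  #missing S = Σₛ (λ A → ind (missing? S A))

  -- Double counting: each of at least k y bad vertices `v` yields y^i missing supersets of S ∪ {v},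
  -- and a missing set A is counted at most |A| = k times. The threshold `k * y` in `Good` is chosen
  -- so that this factor k cancels.
  not-good⇒missing : ∀ i S → ∣ S ∣ + i ≡ k → ¬ Good i S → y ^ i ≤ #missing S
  not-good⇒missing zero S eq ¬g = ≤-trans
    (≤-reflexive (sym (ind-≡1 (missing? S S) (trans (sym (+-identityʳ _)) eq , ¬g , id))))
    (Σₛ-point (λ A → ind (missing? S A)) S)
  not-good⇒missing (suc i) S eq ¬g = *-cancelˡ-≤ k (begin
    k * (y * y ^ i) ≡⟨ sym (*-assoc k y (y ^ i)) ⟩
    k * y * y ^ i ≤⟨ *-monoˡ-≤ (y ^ i) (≮⇒≥ ¬g) ⟩
    ∣ B ∣ * y ^ i ≡⟨ cong (_* y ^ i) (card-Σᵥ B) ⟩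
    Σᵥ (λ v → ind (v ∈? B)) * y ^ i ≡⟨ sym (Σᵥ-*ʳ (λ v → ind (v ∈? B)) (y ^ i)) ⟩
    Σᵥ (λ v → ind (v ∈? B) * y ^ i) ≤⟨ Σᵥ-mono step ⟩
    Σᵥ (λ v → Σₛ (λ A → ind (v ∈? B) * ind (missing? (S ∪ ⁅ v ⁆) A)))
      ≡⟨ sym (Σₛ-Σᵥ-swap (λ v A → ind (v ∈? B) * ind (missing? (S ∪ ⁅ v ⁆) A))) ⟩
    Σₛ (λ A → Σᵥ (λ v → ind (v ∈? B) * ind (missing? (S ∪ ⁅ v ⁆) A))) ≤⟨ Σₛ-mono count ⟩
    Σₛ (λ A → k * ind (missing? S A)) ≡⟨ Σₛ-*ˡ k (λ A → ind (missing? S A)) ⟩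
    k * #missing S ∎)
    where
    open ≤-Reasoning
    B = bad i S
    step : ∀ v → ind (v ∈? B) * y ^ i ≤ Σₛ (λ A → ind (v ∈? B) * ind (missing? (S ∪ ⁅ v ⁆) A))
    step v = ≤-trans (ind-*-mono (v ∈? B) λ v∈B → let (v∉S , ¬g′) = ∈sep⁻ (bad? i S) v∈B in
        not-good⇒missing i (S ∪ ⁅ v ⁆)
          (trans (cong (_+ i) (∪⁅⁆-size S v∉S)) (trans (sym (+-suc ∣ S ∣ i)) eq)) ¬g′)
      (≤-reflexive (sym (Σₛ-*ˡ (ind (v ∈? B)) (λ A → ind (missing? (S ∪ ⁅ v ⁆) A)))))
    term : ∀ A v → ind (v ∈? B) * ind (missing? (S ∪ ⁅ v ⁆) A) ≤ ind (v ∈? A) * ind (missing? S A)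
    term A v = begin
      ind (v ∈? B) * ind (missing? (S ∪ ⁅ v ⁆) A)
        ≡⟨ sym (ind-× (v ∈? B) (missing? (S ∪ ⁅ v ⁆) A)) ⟩
      ind ((v ∈? B) ×-dec missing? (S ∪ ⁅ v ⁆) A)
        ≤⟨ ind-mono ((v ∈? B) ×-dec missing? (S ∪ ⁅ v ⁆) A) ((v ∈? A) ×-dec missing? S A)
             (λ (_ , a , b , c) → c (x∈p∪q⁺ {p = S} (inj₂ (x∈⁅x⁆ v))) , a , b , c ∘ p⊆p∪q ⁅ v ⁆) ⟩
      ind ((v ∈? A) ×-dec missing? S A) ≡⟨ ind-× (v ∈? A) (missing? S A) ⟩
      ind (v ∈? A) * ind (missing? S A) ∎
    count : ∀ A → Σᵥ (λ v → ind (v ∈? B) * ind (missing? (S ∪ ⁅ v ⁆) A)) ≤ k * ind (missing? S A)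
    count A = begin
      Σᵥ (λ v → ind (v ∈? B) * ind (missing? (S ∪ ⁅ v ⁆) A)) ≤⟨ Σᵥ-mono (term A) ⟩
      Σᵥ (λ v → ind (v ∈? A) * ind (missing? S A)) ≡⟨ Σᵥ-*ʳ (λ v → ind (v ∈? A)) (ind (missing? S A)) ⟩
      Σᵥ (λ v → ind (v ∈? A)) * ind (missing? S A) ≡⟨ cong (_* ind (missing? S A)) (sym (card-Σᵥ A)) ⟩
      ∣ A ∣ * ind (missing? S A) ≤⟨ *-ind-mono (missing? S A) (λ (a , _) → ≤-reflexive a) ⟩
      k * ind (missing? S A) ∎

  -- The vertices to shun in one step are those of `X`, of `S` and of the bad set, in all fewer than
  -- |X| + k y + k. The starting set `S` itself may meet `X`, hence the alternative in the
  -- conclusion.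
  greedy : ∀ i S X → Good i S → ∣ S ∣ + i ≡ k → ∣ X ∣ + k * y + k ≤ n →
    ∃ λ A → A LM.∈ F × S ⊆ A × (∀ {x} → x ∈ A → x ∈ S ⊎ x ∉ X)
  greedy zero S X g eq le = S , g , id , inj₁
  greedy (suc i) S X g eq le with ∃-∖ ⊤ (X ∪ (S ∪ bad i S)) small
    where
    open ≤-Reasoning
    small : ∣ X ∪ (S ∪ bad i S) ∣ < ∣ ⊤ {n} ∣
    small = begin
      suc ∣ X ∪ (S ∪ bad i S) ∣ ≤⟨ s≤s (≤-trans (∣∪∣≤ X _) (+-monoʳ-≤ ∣ X ∣ (∣∪∣≤ S _))) ⟩
      suc (∣ X ∣ + (∣ S ∣ + ∣ bad i S ∣)) ≡⟨ lemma (∣ X ∣) (∣ S ∣) (∣ bad i S ∣) ⟩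
      ∣ X ∣ + suc ∣ bad i S ∣ + ∣ S ∣ ≤⟨ +-mono-≤ (+-monoʳ-≤ ∣ X ∣ g) (m+n≤o⇒m≤o ∣ S ∣ (≤-reflexive eq)) ⟩
      ∣ X ∣ + k * y + k ≤⟨ le ⟩
      n ≡⟨ sym (∣⊤∣≡n n) ⟩
      ∣ ⊤ {n} ∣ ∎
      where
      lemma : ∀ a b c → suc (a + (b + c)) ≡ a + suc c + b
      lemma = solve-∀
  ... | v , _ , v∉ with greedy i (S ∪ ⁅ v ⁆) X
          (extend (v∉ ∘ λ p → x∈p∪q⁺ {p = X} (inj₂ (x∈p∪q⁺ (inj₁ p))))
              (v∉ ∘ λ p → x∈p∪q⁺ {p = X} (inj₂ (x∈p∪q⁺ {p = S} (inj₂ p)))))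
          (trans (cong (_+ i) (∪⁅⁆-size S (v∉ ∘ λ p → x∈p∪q⁺ {p = X} (inj₂ (x∈p∪q⁺ (inj₁ p))))))
              (trans (sym (+-suc ∣ S ∣ i)) eq)) le
  ... | A , A∈ , S⊆A , out = A , A∈ , S⊆A ∘ p⊆p∪q ⁅ v ⁆ , out′
    where
    out′ : ∀ {x} → x ∈ A → x ∈ S ⊎ x ∉ X
    out′ x∈A with out x∈A
    ... | inj₂ q = inj₂ q
    ... | inj₁ q with x∈p∪q⁻ S ⁅ v ⁆ q
    ... | inj₁ q′ = inj₁ q′
    ... | inj₂ q′ = inj₂ λ x∈X → v∉ (x∈p∪q⁺ (inj₁ (subst (_∈ X) (x∈⁅y⁆⇒x≡y v q′) x∈X)))

  private
    shrink-All : ∀ {D e e′} (P Q : List (Subset n)) → e′ ⊆ e →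
      All (Disjoint D) (P ++ e ∷ Q) → All (Disjoint D) (P ++ e′ ∷ Q)
    shrink-All [] Q sub (d ∷ ds) = disjoint-⊆ sub d ∷ ds
    shrink-All (c ∷ P) Q sub (d ∷ ds) = d ∷ shrink-All P Q sub ds

    shrink : ∀ {e e′} (P Q : List (Subset n)) → e′ ⊆ e →
      AllPairs Disjoint (P ++ e ∷ Q) → AllPairs Disjoint (P ++ e′ ∷ Q)
    shrink [] Q sub (d ∷ ds) = All.map (λ q → disjoint-sym (disjoint-⊆ sub (disjoint-sym q))) d ∷ ds
    shrink (c ∷ P) Q sub (d ∷ ds) = shrink-All P Q sub d ∷ shrink P Q sub ds

  -- One column of the array: `e` hands a vertex of its own to every row of `P`, and since `e`
  -- avoids the bad sets, each row comes one step closer to an edge. The last clause lets any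
  -- disjointness survive the exchange; it is needed for the recursion itself and for staying inside
  -- a given set.
  distribute : ∀ i (P : List (Subset n)) (e : Subset n) (R : List (Subset n)) → length P ≤ ∣ e ∣ →
    All (Good (suc i)) P → All (λ c → Disjoint e (bad i c)) P → AllPairs Disjoint (P ++ e ∷ R) →
    ∃ λ P′ → length P′ ≡ length P × All (Good i) P′ × AllPairs Disjoint (P′ ++ R) ×
      (∀ {D} → All (Disjoint D) (P ++ e ∷ R) → All (Disjoint D) (P′ ++ R))
  distribute i [] e R le [] [] (d ∷ ds) = [] , refl , [] , ds , λ { (_ ∷ q) → q }
  distribute i (c ∷ P) e R le (g ∷ gs) (b ∷ bs) (d ∷ ds)
    with ∃-∖ e Sub.⊥ (≤-trans (s≤s (≤-trans (≤-reflexive (∣⊥∣≡0 n)) z≤n)) le)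
  ... | v , v∈e , _ with distribute i P (e - v) R (s≤s⁻¹ (≤-trans le (∣-∣ e v))) gs
            (All.map (λ q → disjoint-sym (disjoint-⊆ (p─q⊆p e ⁅ v ⁆) (disjoint-sym q))) bs)
            (shrink P R (p─q⊆p e ⁅ v ⁆) ds)
  ... | P′ , len , good , pairs , away =
    c ∪ ⁅ v ⁆ ∷ P′ , cong suc len , extend v∉c (disjoint⁻ b v∈e) ∷ good ,
    away (All.zipWith (λ (p , q) → both p q) (shrink-All P R (p─q⊆p e ⁅ v ⁆) d , v-away)) ∷ pairs , away′
    where
    v∉c : v ∉ c
    v∉c v∈c = disjoint⁻ (All.head (AllP.++⁻ʳ P d)) v∈c v∈e
    both : ∀ {B} → Disjoint c B → v ∉ B → Disjoint (c ∪ ⁅ v ⁆) B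
    both {B} p q = disjoint⁺ λ a b → [ (λ a′ → disjoint⁻ p a′ b) , (λ a′ → q (subst (_∈ B) (x∈⁅y⁆⇒x≡y v a′) b))
        ]′ (x∈p∪q⁻ c ⁅ v ⁆ a)
    v-away : All (v ∉_) (P ++ (e - v) ∷ R)
    v-away = AllP.++⁺ (left P ds) ((λ q → ∉─ e ⁅ v ⁆ q (x∈⁅x⁆ v)) ∷ right P ds)
      where
      left : ∀ Q → AllPairs Disjoint (Q ++ e ∷ R) → All (v ∉_) Q
      left [] _ = []
      left (f ∷ Q) (d ∷ ds) = (λ q → disjoint⁻ (All.head (AllP.++⁻ʳ Q d)) q v∈e) ∷ left Q ds
      right : ∀ Q → AllPairs Disjoint (Q ++ e ∷ R) → All (v ∉_) R
      right [] (d ∷ ds) = All.map (λ q → disjoint⁻ q v∈e) d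
      right (f ∷ Q) (_ ∷ ds) = right Q ds
    away′ : ∀ {D} → All (Disjoint D) (c ∷ P ++ e ∷ R) → All (Disjoint D) (c ∪ ⁅ v ⁆ ∷ P′ ++ R)
    away′ {D} (q ∷ qs) = disjoint-sym (both (disjoint-sym q) (λ v∈D → disjoint⁻ (All.head (AllP.++⁻ʳ P qs)) v∈D v∈e))
      ∷ away (shrink-All P R (p─q⊆p e ⁅ v ⁆) qs)

  -- The bad sets of the k rows have at most k · k y vertices together, so among the remaining edges
  -- of `R` there is one that avoids them all and can serve as the next column. After i rounds, i
  -- edges of `R` are spent and k rows have become edges; for i = k - 1 the net gain is one edge.
  complete : ∀ i (P R : List (Subset n)) → length P ≡ k → All (Good i) P → All (LM._∈ F) R →
    AllPairs Disjoint (P ++ R) → k * (k * y) + i ≤ length R →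
    ∃ λ N → length N + i ≡ k + length R × All (LM._∈ F) N × AllPairs Disjoint N ×
      (∀ {D} → All (Disjoint D) (P ++ R) → All (Disjoint D) N)
  complete zero P R len good R∈ pairs le =
    P ++ R , trans (+-identityʳ _) (trans (length-++ P) (cong (_+ length R) len)) , AllP.++⁺ good R∈ , pairs , id
  complete (suc i) P R len good R∈ pairs le
    with ∃-avoiding R (⋃ (map (bad i) P)) (tail P pairs) small
    where
    tail : ∀ Q → AllPairs Disjoint (Q ++ R) → AllPairs Disjoint R
    tail [] q = q
    tail (_ ∷ Q) (_ ∷ q) = tail Q q
    open ≤-Reasoning
    small : ∣ ⋃ (map (bad i) P) ∣ < length R
    small = begin
      suc ∣ ⋃ (map (bad i) P) ∣ ≤⟨ s≤s (∣⋃∣≤ (map (bad i) P) (k * y) (AllP.map⁺ (All.map <⇒≤ good))) ⟩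
      suc (k * y * length (map (bad i) P)) ≡⟨ cong (λ z → suc (k * y * z)) (trans (length-map (bad i) P) len) ⟩
      suc (k * y * k) ≡⟨ cong suc (*-comm (k * y) k) ⟩
      suc (k * (k * y)) ≤⟨ s≤s (m≤m+n _ i) ⟩
      suc (k * (k * y) + i) ≡⟨ sym (+-suc _ i) ⟩
      k * (k * y) + suc i ≤⟨ le ⟩
      length R ∎
  ... | e , R′ , perm , dis with All-resp-↭ perm R∈
  ... | e∈F ∷ R′∈F with distribute i P e R′ (≤-reflexive (trans len (sym (uniform e∈F)))) good
          (All.tabulate λ c∈ → disjoint⁺ λ a b → disjoint⁻ dis a (∈⋃⁺ (LMP.∈-map⁺ (bad i) c∈) b))
          (AllPairs-↭ (++⁺ˡ P perm) pairs)
  ... | P′ , len′ , good′ , pairs′ , away with complete i P′ R′ (trans len′ len) good′ R′∈F pairs′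
          (s≤s⁻¹ (≤-trans (≤-reflexive (sym (+-suc _ i))) (≤-trans le (≤-reflexive (↭-length perm)))))
  ... | N , lenN , N∈ , pairsN , awayN = N ,
    trans (+-suc _ i) (trans (cong suc lenN) (trans (sym (+-suc k _)) (cong (k +_) (sym (↭-length perm))))) ,
    N∈ , pairsN , awayN ∘ away ∘ All-resp-↭ (++⁺ˡ P perm)

  -- Containment in `W` is expressed as disjointness from its complement, so that the last clauses
  -- of `distribute` and `complete` transport it as well.
  record Packing (W : Subset n) : Set where
    constructor packing
    field
      edges : List (Subset n)
      edges∈F : All (LM._∈ F) edges
      pairwise : AllPairs Disjoint edges
      inside-W : All (Disjoint (∁ W)) edges
    size : ℕ
    size = length edges
    ∣⋃edges∣≤ : ∣ ⋃ edges ∣ ≤ k * size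
    ∣⋃edges∣≤ = ∣⋃∣≤ edges k (All.map (≤-reflexive ∘ uniform) edges∈F)
  open Packing

  ⊆-of-∁ : ∀ {W e : Subset n} → Disjoint (∁ W) e → e ⊆ W
  ⊆-of-∁ d x∈e = x∉∁p⇒x∈p λ q → disjoint⁻ d q x∈e

  -- The k uncovered vertices and k₁ edges of the matching are the rows of a k × k array;
  -- its columns replace these edges.
  augment : Good k Sub.⊥ → ∀ {W} → Disjoint W (bad k₁ Sub.⊥) → k * (k * (k * y) + k) + (k * y + k) ≤ ∣ W ∣ →
    (N : Packing W) → k * (size N) + k ≤ ∣ W ∣ → ∃ λ (N′ : Packing W) → (size N′) ≡ suc (size N)
  augment g {W} W-good big N room = go (k * (k * y) + k₁ ≤? (size N))
    where
    open ≤-Reasoning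
    U = W ─ ⋃ (edges N)
    W≤ : ∣ W ∣ ≤ k * (size N) + ∣ U ∣
    W≤ = ≤-trans (∣p∣≤∣q∣+∣p─q∣ W (⋃ (edges N))) (+-monoˡ-≤ ∣ U ∣ (∣⋃edges∣≤ N))
    U-free : All (Disjoint U) (edges N)
    U-free = disjoint-⋃ (disjoint⁺ (∉─ W (⋃ (edges N))))
    -- The rows start as k copies of the empty set and the uncovered set `U` is the first column,
    -- which makes the first round an instance of `distribute` too.
    rep : ∀ j → AllPairs Disjoint (replicate j Sub.⊥ ++ U ∷ edges N)
    rep zero = U-free ∷ pairwise N
    rep (suc j) = All.tabulate (λ _ → disjoint⁺ λ a _ → ∉⊥ a) ∷ rep j
    repD : ∀ j {D} → All (Disjoint D) (U ∷ edges N) → All (Disjoint D) (replicate j Sub.⊥ ++ U ∷ edges N)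
    repD j q = AllP.++⁺ (AllP.replicate⁺ j (disjoint⁺ λ _ b → ∉⊥ b)) q
    k≤U : k ≤ ∣ U ∣
    k≤U = +-cancelˡ-≤ (k * (size N)) k ∣ U ∣ (≤-trans room W≤)
    Result : Set
    Result = ∃ λ (N′ : Packing W) → size N′ ≡ suc (size N)
    transpose : k * (k * y) + k₁ ≤ size N → Result
    transpose many =
      let (P , len , good , pairs , away) = distribute k₁ (replicate k Sub.⊥) U (edges N)
            (≤-trans (≤-reflexive (length-replicate k)) k≤U) (AllP.replicate⁺ k g)
            (AllP.replicate⁺ k (disjoint⁺ λ a b → disjoint⁻ W-good (p─q⊆p W _ a) b)) (rep k)
          (N′ , len′ , N′∈ , pairs′ , away′) =
            complete k₁ P (edges N) (trans len (length-replicate k)) good (edges∈F N) pairs many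
      in packing N′ N′∈ pairs′
           (away′ (away (repD k (disjoint⁺ (λ a b → x∈∁p⇒x∉p a (p─q⊆p W _ b)) ∷ inside-W N)))) ,
         +-cancelʳ-≡ k₁ _ _ (trans len′ (cong suc (+-comm k₁ _)))
    -- A matching too short for a transposition covers little of `W`, so that a whole edge can be
    -- chosen greedily inside `U`.
    U≥ : size N < k * (k * y) + k₁ → k * y + k ≤ ∣ U ∣
    U≥ few = +-cancelˡ-≤ (k * (k * (k * y) + k)) _ _ (begin
      k * (k * (k * y) + k) + (k * y + k) ≤⟨ big ⟩
      ∣ W ∣ ≤⟨ W≤ ⟩
      k * (size N) + ∣ U ∣
        ≤⟨ +-monoˡ-≤ ∣ U ∣ (*-monoʳ-≤ k (≤-trans (<⇒≤ few) (+-monoʳ-≤ (k * (k * y)) (n≤1+n k₁)))) ⟩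
      k * (k * (k * y) + k) + ∣ U ∣ ∎)
    small : size N < k * (k * y) + k₁ → ∣ ∁ U ∣ + k * y + k ≤ n
    small few = begin
      ∣ ∁ U ∣ + k * y + k ≡⟨ +-assoc ∣ ∁ U ∣ (k * y) k ⟩
      ∣ ∁ U ∣ + (k * y + k) ≤⟨ +-monoʳ-≤ ∣ ∁ U ∣ (U≥ few) ⟩
      ∣ ∁ U ∣ + ∣ U ∣ ≡⟨ trans (+-comm ∣ ∁ U ∣ ∣ U ∣) (∣∁∣ U) ⟩
      n ∎
    add : ∀ {A} → A LM.∈ F → A ⊆ U → Result
    add {A} A∈ A⊆U = packing (A ∷ edges N) (A∈ ∷ edges∈F N)
      (All.map (λ q → disjoint⁺ λ a b → disjoint⁻ q (A⊆U a) b) U-free ∷ pairwise N)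
      (disjoint⁺ (λ a b → x∈∁p⇒x∉p a (p─q⊆p W _ (A⊆U b))) ∷ inside-W N) , refl
    go : Dec (k * (k * y) + k₁ ≤ size N) → Result
    go (yes many) = transpose many
    go (no few) =
      let (A , A∈ , _ , out) = greedy k Sub.⊥ (∁ U) g (cong (_+ k) (∣⊥∣≡0 n)) (small (≰⇒> few))
      in add A∈ λ x∈A → [ (λ q → ⊥-elim (∉⊥ q)) , x∉∁p⇒x∈p ]′ (out x∈A)

  pack-good : Good k Sub.⊥ → ∀ {W} → Disjoint W (bad k₁ Sub.⊥) → k * (k * (k * y) + k) + (k * y + k) ≤ ∣ W ∣ →
    ∀ fuel (N : Packing W) → ∣ W ∣ ≤ fuel + k * (size N) → ∃ λ (N′ : Packing W) → ∣ W ∣ < k * (size N′) + k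
  pack-good g {W} W-good big fuel N le with ∣ W ∣ <? k * (size N) + k
  ... | yes p = N , p
  pack-good g {W} W-good big zero N le | no p = ⊥-elim (p (≤-<-trans le (m<m+n _ {k} (s≤s z≤n))))
  pack-good g {W} W-good big (suc fuel) N le | no p with augment g W-good big N (≮⇒≥ p)
  ... | N′ , eq = pack-good g W-good big fuel N′ (begin
    ∣ W ∣ ≤⟨ le ⟩
    suc fuel + k * (size N) ≤⟨ +-monoʳ-≤ (suc fuel) (m≤n+m _ k₁) ⟩
    suc fuel + (k₁ + k * (size N)) ≡⟨ sym (+-suc fuel _) ⟩
    fuel + (k + k * (size N)) ≡⟨ cong (fuel +_) (sym (*-suc k (size N))) ⟩
    fuel + k * suc (size N) ≡⟨ cong (λ z → fuel + k * z) (sym eq) ⟩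
    fuel + k * (size N′) ∎)
    where open ≤-Reasoning

  -- Low vertices, and packing sets of vertices that are not low

  module Pack (τ : ℕ) where

    -- The condition `v ∉ X` excludes the trivial cover of the edges through `v` by `v` itself.
    Low : Fin n → Set
    Low v = ∃ λ X → ∣ X ∣ ≤ τ × v ∉ X × All (λ e → v ∈ e → ¬ Disjoint e X) F

    low? : ∀ v → Dec (Low v)
    low? v = anySubset? λ X → (∣ X ∣ ≤? τ) ×-dec (¬? (v ∈? X) ×-dec
      All.all? (λ e → (v ∈? e) →-dec ¬? (disjoint? e X)) F)

    high : ∀ {v} → ¬ Low v → ∀ X → ∣ X ∣ ≤ τ → v ∉ X → ∃ λ e → e LM.∈ F × v ∈ e × Disjoint e X
    high {v} ¬low X X≤ v∉X with Any.any? (λ e → (v ∈? e) ×-dec disjoint? e X) F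
    ... | yes a = let (e , e∈ , p) = LM.find a in e , e∈ , p
    ... | no ¬a = ⊥-elim (¬low (X , X≤ , v∉X , All.tabulate λ e∈ v∈e d → ¬a (LM.lose e∈ (v∈e , d))))

    -- Greedy completion of {v} gives an edge through `v` that avoids any prescribed `X`. Hence all
    -- low vertices lie in a single bad set, that of the empty set, which bounds their number by k
    -- y.
    good⇒¬low : ∀ {v} → Good k₁ (Sub.⊥ ∪ ⁅ v ⁆) → τ + k * y + k ≤ n → ¬ Low v
    good⇒¬low {v} g le (X , X≤ , v∉X , hits) with greedy k₁ (Sub.⊥ ∪ ⁅ v ⁆) X g
       (cong (_+ k₁) (trans (∪⁅⁆-size (Sub.⊥ {n}) {v} ∉⊥) (cong suc (∣⊥∣≡0 n))))
       (≤-trans (+-monoˡ-≤ k (+-monoˡ-≤ (k * y) X≤)) le)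
    ... | A , A∈ , S⊆A , out = All.lookup hits A∈ (S⊆A (x∈p∪q⁺ {p = Sub.⊥} (inj₂ (x∈⁅x⁆ v)))) (disjoint⁺ λ a x∈X →
      [ (λ q → [ ∉⊥ , (λ q′ → v∉X (subst (_∈ X) (x∈⁅y⁆⇒x≡y v q′) x∈X)) ]′ (x∈p∪q⁻ Sub.⊥ ⁅ v ⁆ q)) ,
          (λ q → q x∈X) ]′ (out a))

    L : Subset n
    L = sep low?

    L⊆bad : τ + k * y + k ≤ n → L ⊆ bad k₁ Sub.⊥
    L⊆bad le {v} v∈L with v ∈? bad k₁ Sub.⊥
    ... | yes p = p
    ... | no p = ⊥-elim (good⇒¬low (extend ∉⊥ p) le (∈sep⁻ low? v∈L))

    -- The augmentation cannot start from vertices in the bad set of the empty set. Those of them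
    -- that lie in `W` are not low, so each can be absorbed beforehand by an edge inside `W`
    -- disjoint from the edges already chosen; at most `τ` vertices have to be avoided each time.
    cover-vertices : ∀ {W} → Disjoint W L → ∀ j (Y : Subset n) → ∣ Y ∣ ≤ j → ∣ ∁ W ∣ + k * j ≤ τ →
      ∃ λ (N : Packing W) → (size N) ≤ j × (∀ {x} → x ∈ Y → x ∈ W → x ∈ ⋃ (edges N))
    cover-vertices {W} W-high zero Y Y≤ le =
      packing [] [] [] [] , z≤n , λ {x} x∈Y _ → ⊥-elim (<⇒≱ (≤-trans (≤-reflexive (sym (∣⁅x⁆∣≡1 x)))
        (p⊆q⇒∣p∣≤∣q∣ (λ z∈ → subst (_∈ Y) (sym (x∈⁅y⁆⇒x≡y x z∈)) x∈Y))) Y≤)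
    cover-vertices {W} W-high (suc j) Y Y≤ le with nonempty? Y
    ... | no e = packing [] [] [] [] , z≤n , λ x∈Y _ → ⊥-elim (e (_ , x∈Y))
    ... | yes (v , v∈Y) with cover-vertices W-high j (Y - v) (s≤s⁻¹ (≤-trans (x∈p⇒∣p-x∣<∣p∣ v∈Y) Y≤))
             (≤-trans (+-monoʳ-≤ ∣ ∁ W ∣ (*-monoʳ-≤ k (n≤1+n j))) le)
    ... | N , N≤ , cov with v ∈? ⋃ (edges N) | v ∈? W
    ... | yes p | _ = N , m≤n⇒m≤1+n N≤ , cov′
      where
      cov′ : ∀ {x} → x ∈ Y → x ∈ W → x ∈ ⋃ (edges N)
      cov′ {x} x∈Y x∈W with x ∈? ⁅ v ⁆
      ... | yes q = subst (_∈ ⋃ (edges N)) (sym (x∈⁅y⁆⇒x≡y v q)) p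
      ... | no q = cov (x∈p∧x∉q⇒x∈p─q x∈Y q) x∈W
    ... | no _ | no v∉W = N , m≤n⇒m≤1+n N≤ , cov′
      where
      cov′ : ∀ {x} → x ∈ Y → x ∈ W → x ∈ ⋃ (edges N)
      cov′ {x} x∈Y x∈W = cov (x∈p∧x∉q⇒x∈p─q x∈Y λ q → v∉W (subst (_∈ W) (x∈⁅y⁆⇒x≡y v q) x∈W)) x∈W
    ... | no p | yes v∈W with high (λ lo → disjoint⁻ W-high v∈W (∈sep⁺ low? lo)) (∁ W ∪ ⋃ (edges N))
            (≤-trans (∣∪∣≤ (∁ W) _) (≤-trans (+-monoʳ-≤ ∣ ∁ W ∣ (≤-trans (∣⋃edges∣≤ N)
                (*-monoʳ-≤ k (m≤n⇒m≤1+n N≤)))) le))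
            (λ q → [ (λ a → x∈∁p⇒x∉p a v∈W) , p ]′ (x∈p∪q⁻ (∁ W) _ q))
    ... | e , e∈ , v∈e , dis = packing (e ∷ edges N) (e∈ ∷ edges∈F N)
          (disjoint-⋃ (disjoint-⊆ (q⊆p∪q (∁ W) _) dis) ∷ pairwise N)
          (disjoint-sym (disjoint-⊆ (p⊆p∪q _) dis) ∷ inside-W N) , s≤s N≤ , cov′
      where
      cov′ : ∀ {x} → x ∈ Y → x ∈ W → x ∈ e ∪ ⋃ (edges N)
      cov′ {x} x∈Y x∈W with x ∈? ⁅ v ⁆
      ... | yes q = x∈p∪q⁺ (inj₁ (subst (_∈ e) (sym (x∈⁅y⁆⇒x≡y v q)) v∈e))
      ... | no q = x∈p∪q⁺ {p = e} (inj₂ (cov (x∈p∧x∉q⇒x∈p─q x∈Y q) x∈W))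

    pack : Good k Sub.⊥ → ∀ {W} → Disjoint W L → ∣ ∁ W ∣ + k * (k * y) ≤ τ →
      k * (k * y) + (k * (k * (k * y) + k) + (k * y + k)) ≤ ∣ W ∣ →
      ∃ λ (N : Packing W) → ∣ W ∣ < k * size N + k
    pack g {W} W-high le big with cover-vertices W-high (k * y) (bad k₁ Sub.⊥) (<⇒≤ g) le
    ... | N , N≤ , cov = result (pack-good g W′-good big′ ∣ W′ ∣ (packing [] [] [] []) (m≤m+n _ _))
      where
      open ≤-Reasoning
      W′ = W ─ ⋃ (edges N)
      W′-good : Disjoint W′ (bad k₁ Sub.⊥)
      W′-good = disjoint⁺ λ a b → ∉─ W _ a (cov b (p─q⊆p W _ a))
      W≤ : ∣ W ∣ ≤ k * size N + ∣ W′ ∣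
      W≤ = ≤-trans (∣p∣≤∣q∣+∣p─q∣ W (⋃ (edges N))) (+-monoˡ-≤ ∣ W′ ∣ (∣⋃edges∣≤ N))
      big′ : k * (k * (k * y) + k) + (k * y + k) ≤ ∣ W′ ∣
      big′ = +-cancelˡ-≤ (k * (k * y)) _ _ (≤-trans big (≤-trans W≤ (+-monoˡ-≤ ∣ W′ ∣ (*-monoʳ-≤ k N≤))))
      result : (∃ λ (N′ : Packing W′) → ∣ W′ ∣ < k * size N′ + k) → ∃ λ (N : Packing W) → ∣ W ∣ < k * size N + k
      result (N′ , lt) = packing (edges N ++ edges N′) (AllP.++⁺ (edges∈F N) (edges∈F N′))
        (AllPairsP.++⁺ (pairwise N) (pairwise N′) (All.tabulate λ e∈ → All.map (λ d → disjoint⁺ λ a b →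
          ∉─ W _ (⊆-of-∁ d b) (∈⋃⁺ e∈ a)) (inside-W N′)))
        (AllP.++⁺ (inside-W N) (All.map (λ d → disjoint⁺ λ a b → x∈∁p⇒x∉p a (p─q⊆p W _ (⊆-of-∁ d b)))
            (inside-W N′))) ,
        (begin
          suc ∣ W ∣ ≤⟨ s≤s W≤ ⟩
          suc (k * size N + ∣ W′ ∣) ≡⟨ sym (+-suc (k * size N) ∣ W′ ∣) ⟩
          k * size N + suc ∣ W′ ∣ ≤⟨ +-monoʳ-≤ (k * size N) lt ⟩
          k * size N + (k * size N′ + k) ≡⟨ sym (+-assoc (k * size N) (k * size N′) k) ⟩
          k * size N + k * size N′ + k ≡⟨ cong (_+ k) (sym (*-distribˡ-+ k (size N) (size N′))) ⟩
          k * (size N + size N′) + k ≡⟨ cong (λ z → k * z + k) (sym (length-++ (edges N))) ⟩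
          k * length (edges N ++ edges N′) + k ∎)

-- Separating the edges that meet L

bounded-by-between : {Q : Subset n → Set} (Q? : ∀ A → Dec (Q A)) (K U : Subset n) (u t : ℕ) → K ⊆ U →
  ∣ U ∣ ≡ ∣ K ∣ + u → (∀ {A} → Q A → Between K U (∣ K ∣ + t) A) → Σₛ (λ A → ind (Q? A)) ≤ u C t
bounded-by-between Q? K U u t K⊆U eq f = ≤-trans
  (Σₛ-mono λ A → ind-mono (Q? A) (between? K U (∣ K ∣ + t) A) f)
  (≤-reflexive (count-between K U u t K⊆U eq))

hitting? : (F : List (Subset n)) (L A : Subset n) → Dec (A LM.∈ F × ¬ Disjoint A L)
hitting? F L A = (A ∈ₗ? F) ×-dec ¬? (disjoint? A L)

split-by-hitting : {F : List (Subset n)} {k : ℕ} → Unique F → (∀ {A} → A LM.∈ F → ∣ A ∣ ≡ k) → (L : Subset n) →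
  length F ≤ ∣ ∁ L ∣ C k + Σₛ (λ A → ind (hitting? F L A))
split-by-hitting {n} {F} {k} uniq uniform L = begin
  length F ≤⟨ length≤Σₛ uniq ⟩
  Σₛ (λ A → ind (A ∈ₗ? F)) ≤⟨ Σₛ-mono (λ A → ind-⊎ (A ∈ₗ? F) (avoiding? A) (hitting? F L A) (dichotomy A)) ⟩
  Σₛ (λ A → ind (avoiding? A) + ind (hitting? F L A))
    ≡⟨ Σₛ-+ (λ A → ind (avoiding? A)) (λ A → ind (hitting? F L A)) ⟩
  Σₛ (λ A → ind (avoiding? A)) + Σₛ (λ A → ind (hitting? F L A))
    ≡⟨ cong (_+ Σₛ (λ A → ind (hitting? F L A)))
         (count-between Sub.⊥ (∁ L) ∣ ∁ L ∣ k (⊥-elim ∘ ∉⊥) (cong (_+ ∣ ∁ L ∣) (sym (∣⊥∣≡0 n)))) ⟩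
  ∣ ∁ L ∣ C k + Σₛ (λ A → ind (hitting? F L A)) ∎
  where
  open ≤-Reasoning
  avoiding? : ∀ A → Dec (Between Sub.⊥ (∁ L) (∣ Sub.⊥ {n} ∣ + k) A)
  avoiding? = between? Sub.⊥ (∁ L) (∣ Sub.⊥ {n} ∣ + k)
  dichotomy : ∀ A → A LM.∈ F → Between Sub.⊥ (∁ L) (∣ Sub.⊥ {n} ∣ + k) A ⊎ (A LM.∈ F × ¬ Disjoint A L)
  dichotomy A A∈ with disjoint? A L
  ... | yes d = inj₁ ((⊥-elim ∘ ∉⊥) , (λ z∈A → x∉p⇒x∈∁p (disjoint⁻ d z∈A)) ,
          trans (uniform A∈) (cong (_+ k) (sym (∣⊥∣≡0 n))))
  ... | no ¬d = inj₂ (A∈ , ¬d)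

-- Pairwise cross-intersecting families

∪⁅⁆-⊆ : {S U : Subset n} {v : Fin n} → S ⊆ U → v ∈ U → S ∪ ⁅ v ⁆ ⊆ U
∪⁅⁆-⊆ {S = S} {U} {v} S⊆U v∈U x∈ with x∈p∪q⁻ S ⁅ v ⁆ x∈
... | inj₁ x∈S = S⊆U x∈S
... | inj₂ x∈v = subst (_∈ U) (sym (x∈⁅y⁆⇒x≡y v x∈v)) v∈U

⁅⁆-⊆ : {U : Subset n} {v : Fin n} → v ∈ U → ⁅ v ⁆ ⊆ U
⁅⁆-⊆ {U = U} {v} v∈U x∈ = subst (_∈ U) (sym (x∈⁅y⁆⇒x≡y v x∈)) v∈U

∈∪⁅⁆ : (S : Subset n) (v : Fin n) → v ∈ S ∪ ⁅ v ⁆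
∈∪⁅⁆ S v = q⊆p∪q S ⁅ v ⁆ (x∈⁅x⁆ v)

-- κ = k − 3, H is the complement of L, and u is the size of H without one of its (k − 1)-subsets.
module CrossIntersecting {n : ℕ} (κ μ u ℓ : ℕ) (F : List (Subset n)) (L : Subset n)
  (uniform : ∀ {A} → A LM.∈ F → ∣ A ∣ ≡ 3 + κ)
  (H-size : ∣ ∁ L ∣ ≡ 2 + μ) (H-split : 2 + μ ≡ 2 + κ + u) (L-size : ∣ L ∣ ≡ suc ℓ) (1≤ℓ : 1 ≤ ℓ)
  (nontrivial : NonTrivial F)
  (one-in-L : ∀ {A x y} → A LM.∈ F → x ∈ A → y ∈ A → x ∈ L → y ∈ L → x ≡ y)
  (intersecting : ∀ {A B} → A LM.∈ F → B LM.∈ F → ¬ Disjoint A L → ¬ Disjoint B L → ¬ Disjoint A B) where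

  H : Subset n
  H = ∁ L

  -- C(m - 1, k - 2) and C(m - 2, k - 3): the numbers of k-sets in H ∪ {x} through `x` and one,
  -- respectively two, given vertices of H.
  M₁ M₂ : ℕ
  M₁ = suc μ C suc κ
  M₂ = μ C κ

  star? : ∀ x A → Dec (A LM.∈ F × x ∈ A)
  star? x A = (A ∈ₗ? F) ×-dec (x ∈? A)

  #star : Fin n → ℕ
  #star x = Σₛ (λ A → ind (star? x A))

  -- As an edge has at most one vertex in `L`, this says of an edge that it belongs to the family of
  -- a vertex of `L` other than `x`.
  Other : Fin n → Subset n → Set
  Other x f = ¬ Disjoint f (L - x)

  kernel? : ∀ x b → Dec (b ∈ H × All (λ f → Other x f → b ∈ f) F)
  kernel? x b = (b ∈? H) ×-dec All.all? (λ f → ¬? (disjoint? f (L - x)) →-dec (b ∈? f)) F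

  kernel : Fin n → Subset n
  kernel x = sep (kernel? x)

  meets-L : ∀ {A x} → x ∈ L → x ∈ A → ¬ Disjoint A L
  meets-L x∈L x∈A d = disjoint⁻ d x∈A x∈L

  other⁺ : ∀ {f x y} → y ∈ L → y ≢ x → y ∈ f → Other x f
  other⁺ y∈L y≢x y∈f d = disjoint⁻ d y∈f (x∈p∧x≢y⇒x∈p-y y∈L y≢x)

  other⁻ : ∀ {f x} → Other x f → ∃ λ y → y ∈ L × y ≢ x × y ∈ f
  other⁻ {f} {x} o = let (y , y∈f , y∈) = meet o in
    y , p─q⊆p L ⁅ x ⁆ y∈ , (λ eq → ∉─ L ⁅ x ⁆ y∈ (subst (_∈ ⁅ x ⁆) (sym eq) (x∈⁅x⁆ x))) , y∈f

  ∃-other : ∀ x → ∃ λ f → f LM.∈ F × Other x f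
  ∃-other x = let (y , y∈L , y∉) = ∃-∖ L ⁅ x ⁆ (≤-trans (≤-reflexive (cong suc (∣⁅x⁆∣≡1 x)))
                    (≤-trans (s≤s 1≤ℓ) (≤-reflexive (sym L-size))))
                  (f , f∈ , y∈f) = LM.find (nontrivial y)
              in f , f∈ , other⁺ y∈L (x∉⁅y⁆⇒x≢y y∉) y∈f

  -- `A` meets `L` only in `x` and `f` meets `L` only elsewhere, so their common vertex lies in H.
  cross : ∀ {x A f} → x ∈ L → A LM.∈ F → x ∈ A → f LM.∈ F → Other x f → ∃ λ z → z ∈ f ∩ H × z ∈ A
  cross {x} {A} {f} x∈L A∈ x∈A f∈ o =
    let (y , y∈L , y≢x , y∈f) = other⁻ o
        (z , z∈A , z∈f) = meet (intersecting A∈ f∈ (meets-L x∈L x∈A) (meets-L y∈L y∈f))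
    in z , x∈p∩q⁺ (z∈f , x∉p⇒x∈∁p λ z∈L →
         y≢x (trans (one-in-L f∈ y∈f z∈f y∈L z∈L) (one-in-L A∈ z∈A x∈A z∈L x∈L))) , z∈A

  in-H∪ : ∀ {x A} → x ∈ L → A LM.∈ F → x ∈ A → A ⊆ H ∪ ⁅ x ⁆
  in-H∪ {x} {A} x∈L A∈ x∈A {z} z∈A with z ∈? L
  ... | yes z∈L = subst (_∈ H ∪ ⁅ x ⁆) (one-in-L A∈ x∈A z∈A x∈L z∈L) (∈∪⁅⁆ H x)
  ... | no z∉L = x∈p∪q⁺ (inj₁ (x∉p⇒x∈∁p z∉L))

  ∣H∪⁅⁆∣ : ∀ {x} → x ∈ L → ∣ H ∪ ⁅ x ⁆ ∣ ≡ 3 + μ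
  ∣H∪⁅⁆∣ x∈L = trans (∪⁅⁆-size H (x∈p⇒x∉∁p x∈L)) (cong suc H-size)

  H-≢ : ∀ {b x} → b ∈ H → x ∈ L → b ∉ ⁅ x ⁆
  H-≢ {b} {x} b∈H x∈L b∈ = x∈∁p⇒x∉p b∈H (subst (_∈ L) (sym (x∈⁅y⁆⇒x≡y x b∈)) x∈L)

  ∣pair∣ : ∀ {b x} → b ∈ H → x ∈ L → ∣ ⁅ x ⁆ ∪ ⁅ b ⁆ ∣ ≡ 2
  ∣pair∣ {b} {x} b∈H x∈L = trans (∪⁅⁆-size ⁅ x ⁆ (H-≢ b∈H x∈L)) (cong suc (∣⁅x⁆∣≡1 x))

  star-≤M₁ : ∀ {x b} {Q : Subset n → Set} (Q? : ∀ A → Dec (Q A)) → x ∈ L → b ∈ H →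
    (∀ {A} → Q A → A LM.∈ F × x ∈ A × b ∈ A) → Σₛ (λ A → ind (Q? A)) ≤ M₁
  star-≤M₁ {x} {b} Q? x∈L b∈H f = bounded-by-between Q? (⁅ x ⁆ ∪ ⁅ b ⁆) (H ∪ ⁅ x ⁆) (suc μ) (suc κ)
    (∪⁅⁆-⊆ (⁅⁆-⊆ (∈∪⁅⁆ H x)) (x∈p∪q⁺ (inj₁ b∈H)))
    (trans (∣H∪⁅⁆∣ x∈L) (cong (_+ suc μ) (sym (∣pair∣ b∈H x∈L))))
    λ q → let (A∈ , x∈A , b∈A) = f q in
      ∪⁅⁆-⊆ (⁅⁆-⊆ x∈A) b∈A , in-H∪ x∈L A∈ x∈A , trans (uniform A∈) (cong (_+ suc κ) (sym (∣pair∣ b∈H x∈L)))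

  star-≤M₂ : ∀ {x b c} {Q : Subset n → Set} (Q? : ∀ A → Dec (Q A)) → x ∈ L → b ∈ H → c ∈ H → c ≢ b →
    (∀ {A} → Q A → A LM.∈ F × x ∈ A × b ∈ A × c ∈ A) → Σₛ (λ A → ind (Q? A)) ≤ M₂
  star-≤M₂ {x} {b} {c} Q? x∈L b∈H c∈H c≢b f = bounded-by-between Q? Y (H ∪ ⁅ x ⁆) μ κ
    (∪⁅⁆-⊆ (∪⁅⁆-⊆ (⁅⁆-⊆ (∈∪⁅⁆ H x)) (x∈p∪q⁺ (inj₁ b∈H))) (x∈p∪q⁺ (inj₁ c∈H)))
    (trans (∣H∪⁅⁆∣ x∈L) (cong (_+ μ) (sym ∣Y∣)))
    λ q → let (A∈ , x∈A , b∈A , c∈A) = f q in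
      ∪⁅⁆-⊆ (∪⁅⁆-⊆ (⁅⁆-⊆ x∈A) b∈A) c∈A , in-H∪ x∈L A∈ x∈A , trans (uniform A∈) (cong (_+ κ) (sym ∣Y∣))
    where
    Y = (⁅ x ⁆ ∪ ⁅ b ⁆) ∪ ⁅ c ⁆
    ∣Y∣ : ∣ Y ∣ ≡ 3
    ∣Y∣ = trans (∪⁅⁆-size (⁅ x ⁆ ∪ ⁅ b ⁆) λ c∈ → [ H-≢ c∈H x∈L , (λ q → c≢b (x∈⁅y⁆⇒x≡y b q)) ]′
        (x∈p∪q⁻ ⁅ x ⁆ ⁅ b ⁆ c∈))
      (cong suc (∣pair∣ b∈H x∈L))

  kernel-H : ∀ x → kernel x ⊆ H
  kernel-H x b∈ = proj₁ (∈sep⁻ (kernel? x) b∈)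

  kernel-in : ∀ {x f} → f LM.∈ F → Other x f → kernel x ⊆ f
  kernel-in {x} f∈ o b∈ = All.lookup (proj₂ (∈sep⁻ (kernel? x) b∈)) f∈ o

  star-kernel : ∀ {x y b} → y ∈ L → y ≢ x → b ∈ kernel x → #star y ≤ M₁
  star-kernel {x} {y} y∈L y≢x b∈ = star-≤M₁ (star? y) y∈L (kernel-H x b∈)
    λ (A∈ , y∈A) → A∈ , y∈A , kernel-in A∈ (other⁺ y∈L y≢x y∈A) b∈

  total : ℕ
  total = Σᵥ (λ x → ind (x ∈? L) * #star x)

  -- Every y in `L` differs from `x` or from `x′`, so all edges through y contain `b` or all contain
  -- `b′`.
  two-kernels : ∀ {x x′ b b′} → x ≢ x′ → b ∈ kernel x → b′ ∈ kernel x′ → total ≤ suc ℓ * M₁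
  two-kernels {x} {x′} x≢x′ b∈ b′∈ = ≤-trans (weighted-≤ L #star M₁ bound) (≤-reflexive (cong (_* M₁) L-size))
    where
    bound : ∀ y → y ∈ L → #star y ≤ M₁
    bound y y∈L with y Fin.≟ x
    ... | yes refl = star-kernel y∈L x≢x′ b′∈
    ... | no y≢x = star-kernel y∈L y≢x b∈

  -- For another vertex y of `L` the only possible edge is K ∪ {y}, which gives the term `ℓ`. An
  -- edge through `x` has to meet K, so the C(u, k - 1) sets formed by `x` and k - 1 vertices of H
  -- outside K are lost; they are added on the left.
  full-kernel : ∀ {x} → x ∈ L → 2 + κ ≤ ∣ kernel x ∣ → total + u C (2 + κ) ≤ (2 + μ) C (2 + κ) + ℓ
  full-kernel {x} x∈L K≥ = begin
    total + u C (2 + κ) ≤⟨ +-monoˡ-≤ (u C (2 + κ)) (Σᵥ-mono split) ⟩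
    Σᵥ (λ y → ind (y ∈? ⁅ x ⁆) * #star x + ind (y ∈? (L - x)) * 1) + u C (2 + κ)
      ≡⟨ cong (_+ u C (2 + κ)) (Σᵥ-+ (λ y → ind (y ∈? ⁅ x ⁆) * #star x) (λ y → ind (y ∈? (L - x)) * 1)) ⟩
    Σᵥ (λ y → ind (y ∈? ⁅ x ⁆) * #star x) + Σᵥ (λ y → ind (y ∈? (L - x)) * 1) + u C (2 + κ)
      ≤⟨ +-monoˡ-≤ (u C (2 + κ)) (+-mono-≤ (weighted-≤ ⁅ x ⁆ (λ _ → #star x) (#star x) (λ _ _ → ≤-refl))
            (weighted-≤ (L - x) (λ _ → 1) 1 (λ _ _ → ≤-refl))) ⟩
    ∣ ⁅ x ⁆ ∣ * #star x + ∣ L - x ∣ * 1 + u C (2 + κ)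
      ≤⟨ +-monoˡ-≤ (u C (2 + κ)) (+-mono-≤ (≤-reflexive (trans (cong (_* #star x) (∣⁅x⁆∣≡1 x)) (*-identityˡ _)))
           (≤-trans (≤-reflexive (*-identityʳ _)) (s≤s⁻¹ (≤-trans (x∈p⇒∣p-x∣<∣p∣ x∈L) (≤-reflexive L-size))))) ⟩
    #star x + ℓ + u C (2 + κ) ≡⟨ rearrange (#star x) ℓ (u C (2 + κ)) ⟩
    #star x + u C (2 + κ) + ℓ ≤⟨ +-monoˡ-≤ ℓ main ⟩
    (2 + μ) C (2 + κ) + ℓ ∎
    where
    open ≤-Reasoning
    rearrange : ∀ a b c → a + b + c ≡ a + c + b
    rearrange = solve-∀
    K = kernel x
    K-∪ : ∀ {y} → y ∈ L → ∣ K ∪ ⁅ y ⁆ ∣ ≡ suc ∣ K ∣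
    K-∪ y∈L = ∪⁅⁆-size K λ y∈K → x∈∁p⇒x∉p (kernel-H x y∈K) y∈L
    ∣K∣ : ∣ K ∣ ≡ 2 + κ
    ∣K∣ = let (f , f∈ , o) = ∃-other x
              (y , y∈L , y≢x , y∈f) = other⁻ o
          in ≤-antisym (s≤s⁻¹ (≤-trans (≤-reflexive (sym (K-∪ y∈L)))
               (≤-trans (p⊆q⇒∣p∣≤∣q∣ (∪⁅⁆-⊆ (kernel-in f∈ o) y∈f)) (≤-reflexive (uniform f∈))))) K≥
    star-≤1 : ∀ {y} → y ∈ L → y ≢ x → #star y ≤ 1
    star-≤1 {y} y∈L y≢x = ≤-trans (bounded-by-between (star? y) (K ∪ ⁅ y ⁆) (H ∪ ⁅ y ⁆) u 0
      (∪⁅⁆-⊆ (λ q → x∈p∪q⁺ (inj₁ (kernel-H x q))) (∈∪⁅⁆ H y))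
      (trans (∣H∪⁅⁆∣ y∈L) (trans (cong suc H-split) (cong (_+ u) (sym (trans (K-∪ y∈L) (cong suc ∣K∣))))))
      λ (A∈ , y∈A) → ∪⁅⁆-⊆ (kernel-in A∈ (other⁺ y∈L y≢x y∈A)) y∈A , in-H∪ y∈L A∈ y∈A ,
        trans (uniform A∈) (sym (trans (+-identityʳ _) (trans (K-∪ y∈L) (cong suc ∣K∣)))))
      (≤-reflexive (nC0 u))
    split : ∀ y → ind (y ∈? L) * #star y ≤ ind (y ∈? ⁅ x ⁆) * #star x + ind (y ∈? (L - x)) * 1
    split y with y ∈? L
    ... | no _ = z≤n
    ... | yes y∈L with y Fin.≟ x
    ... | yes refl = ≤-trans (*-monoˡ-≤ (#star y) (≤-reflexive (sym (ind-≡1 (y ∈? ⁅ y ⁆) (x∈⁅x⁆ y))))) (m≤m+n _ _)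
    ... | no y≢x = ≤-trans (≤-trans (≤-reflexive (*-identityˡ _)) (star-≤1 y∈L y≢x))
            (≤-trans (≤-reflexive (sym (cong (_* 1) (ind-≡1 (y ∈? (L - x)) (x∈p∧x≢y⇒x∈p-y y∈L y≢x)))))
                (m≤n+m _ (ind (y ∈? ⁅ x ⁆) * #star x)))
    Z = (H ─ K) ∪ ⁅ x ⁆
    x∉Z : x ∉ H ─ K
    x∉Z q = x∈∁p⇒x∉p (p─q⊆p H K q) x∈L
    ∣H─K∣ : ∣ H ─ K ∣ ≡ u
    ∣H─K∣ = +-cancelˡ-≡ ∣ K ∣ _ _ (trans (≤-antisym
        (card-disjoint-∪ K (H ─ K) H (kernel-H x) (p─q⊆p H K) (λ a b → ∉─ H K b a)) (∣p∣≤∣q∣+∣p─q∣ H K))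
      (trans H-size (trans H-split (cong (_+ u) (sym ∣K∣)))))
    1+ : ∀ {t} → ∣ ⁅ x ⁆ ∣ + t ≡ suc t
    1+ {t} = cong (_+ t) (∣⁅x⁆∣≡1 x)
    main : #star x + u C (2 + κ) ≤ (2 + μ) C (2 + κ)
    main = begin
      #star x + u C (2 + κ) ≡⟨ cong (#star x +_) (sym (count-between ⁅ x ⁆ Z u (2 + κ) (⁅⁆-⊆ (∈∪⁅⁆ (H ─ K) x))
          (trans (∪⁅⁆-size (H ─ K) x∉Z) (trans (cong suc ∣H─K∣) (sym 1+))))) ⟩
      #star x + Σₛ (λ A → ind (between? ⁅ x ⁆ Z (∣ ⁅ x ⁆ ∣ + (2 + κ)) A))
        ≡⟨ sym (Σₛ-+ (λ A → ind (star? x A)) (λ A → ind (between? ⁅ x ⁆ Z (∣ ⁅ x ⁆ ∣ + (2 + κ)) A))) ⟩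
      Σₛ (λ A → ind (star? x A) + ind (between? ⁅ x ⁆ Z (∣ ⁅ x ⁆ ∣ + (2 + κ)) A))
        ≤⟨ Σₛ-mono (λ A → ind-disjoint (star? x A) (between? ⁅ x ⁆ Z (∣ ⁅ x ⁆ ∣ + (2 + κ)) A)
             (between? ⁅ x ⁆ (H ∪ ⁅ x ⁆) (∣ ⁅ x ⁆ ∣ + (2 + κ)) A)
             (λ (A∈ , x∈A) → ⁅⁆-⊆ x∈A , in-H∪ x∈L A∈ x∈A , trans (uniform A∈) (sym 1+))
             (λ (a , b , c) → a , (λ q → [ (λ z → x∈p∪q⁺ (inj₁ (p─q⊆p H K z))) , (λ z → x∈p∪q⁺ {p = H} (inj₂ z))
                 ]′ (x∈p∪q⁻ (H ─ K) ⁅ x ⁆ (b q))) , c)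
             (λ (A∈ , x∈A) (_ , b , _) → clash A∈ x∈A b)) ⟩
      Σₛ (λ A → ind (between? ⁅ x ⁆ (H ∪ ⁅ x ⁆) (∣ ⁅ x ⁆ ∣ + (2 + κ)) A))
        ≡⟨ count-between ⁅ x ⁆ (H ∪ ⁅ x ⁆) (2 + μ) (2 + κ) (⁅⁆-⊆ (∈∪⁅⁆ H x)) (trans (∣H∪⁅⁆∣ x∈L) (sym 1+)) ⟩
      (2 + μ) C (2 + κ) ∎
      where
      clash : ∀ {A} {X : Set} → A LM.∈ F → x ∈ A → A ⊆ Z → X
      clash {A} A∈ x∈A A⊆Z = ⊥-elim (absurd (∃-other x))
        where
        -- The kernel and one more vertex fill up f.
        absurd : (∃ λ f → f LM.∈ F × Other x f) → _
        absurd (f , f∈ , o) = let (y , y∈L , y≢x , y∈f) = other⁻ o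
                                  (z , z∈ , z∈A) = cross x∈L A∈ x∈A f∈ o
                                  (z∈f , z∈H) = x∈p∩q⁻ f H z∈
          in [ (λ q → 1+n≰n (too-big f∈ o y∈f y∈L z∈f z∈H (∉─ H K q))) , H-≢ z∈H x∈L ]′
              (x∈p∪q⁻ (H ─ K) ⁅ x ⁆ (A⊆Z z∈A))
          where
          too-big : ∀ {y z} → f LM.∈ F → Other x f → y ∈ f → y ∈ L → z ∈ f → z ∈ H → z ∉ K → 3 + κ ≤ 2 + κ
          too-big {y} {z} f∈ o y∈f y∈L z∈f z∈H z∉K = s≤s⁻¹ (≤-trans (≤-reflexive (sym (trans (∪⁅⁆-size (K ∪ ⁅ y ⁆)
              (λ q → [ z∉K , H-≢ z∈H y∈L ]′ (x∈p∪q⁻ K ⁅ y ⁆ q))) (cong suc (trans (K-∪ y∈L) (cong suc ∣K∣))))))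
            (≤-trans (p⊆q⇒∣p∣≤∣q∣ (∪⁅⁆-⊆ (∪⁅⁆-⊆ (kernel-in f∈ o) y∈f) z∈f)) (≤-reflexive (uniform f∈))))

  -- Every edge through `x` meets the trace on H of a fixed edge f of another family. A vertex b of
  -- this trace that lies in the kernel costs at most `M₁`. For any other b, some edge g of another
  -- family misses b, so an edge through `x` and b needs a second vertex in the trace of g, and b
  -- costs at most k `M₂`.
  star-bound : ∀ {x} → x ∈ L → #star x ≤ ∣ kernel x ∣ * M₁ + (3 + κ) * ((3 + κ) * M₂)
  star-bound {x} x∈L with ∃-other x
  ... | f , f∈ , o = begin
    #star x ≤⟨ cover-bound (star? x) Y (λ (A∈ , x∈A) → cross x∈L A∈ x∈A f∈ o) ⟩
    Σᵥ (λ b → ind (b ∈? Y) * Σₛ (λ A → ind (star? x A ×-dec (b ∈? A)))) ≤⟨ Σᵥ-mono term ⟩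
    Σᵥ (λ b → ind (b ∈? kernel x) * M₁ + ind (b ∈? Y) * ((3 + κ) * M₂))
      ≡⟨ Σᵥ-+ (λ b → ind (b ∈? kernel x) * M₁) (λ b → ind (b ∈? Y) * ((3 + κ) * M₂)) ⟩
    Σᵥ (λ b → ind (b ∈? kernel x) * M₁) + Σᵥ (λ b → ind (b ∈? Y) * ((3 + κ) * M₂))
      ≤⟨ +-mono-≤ (weighted-≤ (kernel x) (λ _ → M₁) M₁ (λ _ _ → ≤-refl))
          (weighted-≤ Y (λ _ → (3 + κ) * M₂) ((3 + κ) * M₂) (λ _ _ → ≤-refl)) ⟩
    ∣ kernel x ∣ * M₁ + ∣ Y ∣ * ((3 + κ) * M₂)
      ≤⟨ +-monoʳ-≤ (∣ kernel x ∣ * M₁) (*-monoˡ-≤ ((3 + κ) * M₂) (trace-size f∈)) ⟩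
    ∣ kernel x ∣ * M₁ + (3 + κ) * ((3 + κ) * M₂) ∎
    where
    open ≤-Reasoning
    Y = f ∩ H
    trace-size : ∀ {g} → g LM.∈ F → ∣ g ∩ H ∣ ≤ 3 + κ
    trace-size {g} g∈ = ≤-trans (∣p∩q∣≤∣p∣ g H) (≤-reflexive (uniform g∈))
    codegree : ∀ b → b ∈ Y → Σₛ (λ A → ind (star? x A ×-dec (b ∈? A))) ≤ ind (b ∈? kernel x) * M₁ + (3 + κ) * M₂
    codegree b b∈T with b ∈? kernel x
    ... | yes b∈K = ≤-trans (star-≤M₁ (λ A → star? x A ×-dec (b ∈? A)) x∈L (kernel-H x b∈K)
        (λ ((A∈ , x∈A) , b∈A) → A∈ , x∈A , b∈A))
            (≤-trans (≤-reflexive (sym (*-identityˡ M₁))) (m≤m+n _ _))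
    ... | no b∉K with All.all? (λ f → ¬? (disjoint? f (L - x)) →-dec (b ∈? f)) F
    ... | yes all = ⊥-elim (b∉K (∈sep⁺ (kernel? x) (proj₂ (x∈p∩q⁻ f H b∈T) , all)))
    ... | no ¬all = let (g , g∈ , ¬imp) = LM.find (AllP.¬All⇒Any¬ (λ f → ¬? (disjoint? f (L - x)) →-dec (b ∈? f)) F ¬all)
                        o′ : Other x g
                        o′ d = ¬imp (λ o″ → ⊥-elim (o″ d))
                        b∉g : b ∉ g
                        b∉g b∈g = ¬imp (λ _ → b∈g)
      in ≤-trans (cover-bound-uniform (λ A → star? x A ×-dec (b ∈? A)) (g ∩ H) M₂
           (λ ((A∈ , x∈A) , _) → cross x∈L A∈ x∈A g∈ o′)
           λ c c∈ → star-≤M₂ (λ A → (star? x A ×-dec (b ∈? A)) ×-dec (c ∈? A)) x∈L (proj₂ (x∈p∩q⁻ f H b∈T))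
               (proj₂ (x∈p∩q⁻ g H c∈))
             (λ { refl → b∉g (proj₁ (x∈p∩q⁻ g H c∈)) }) (λ (((A∈ , x∈A) , b∈A) , c∈A) → A∈ , x∈A , b∈A , c∈A))
         (*-monoˡ-≤ M₂ (trace-size g∈))
    term : ∀ b → ind (b ∈? Y) * Σₛ (λ A → ind (star? x A ×-dec (b ∈? A))) ≤
      ind (b ∈? kernel x) * M₁ + ind (b ∈? Y) * ((3 + κ) * M₂)
    term b = ≤-trans (ind-*-mono (b ∈? Y) (codegree b)) (drop (b ∈? Y))
      where
      drop : {P : Set} (d : Dec P) {p q : ℕ} → ind d * (p + q) ≤ p + ind d * q
      drop (yes _) {p} {q} = ≤-reflexive (trans (*-identityˡ _) (cong (p +_) (sym (*-identityˡ q))))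
      drop (no _) = z≤n

  few-kernels : ∀ {x₀} → x₀ ∈ L → (∀ {x} → x ∈ L → x ≢ x₀ → ∣ kernel x ∣ ≡ 0) → ∣ kernel x₀ ∣ ≤ suc κ →
    total ≤ suc κ * M₁ + suc ℓ * ((3 + κ) * ((3 + κ) * M₂))
  few-kernels {x₀} x₀∈L empty small = begin
    total ≤⟨ Σᵥ-mono term ⟩
    Σᵥ (λ x → ind (x ∈? ⁅ x₀ ⁆) * (suc κ * M₁) + ind (x ∈? L) * B)
      ≡⟨ Σᵥ-+ (λ x → ind (x ∈? ⁅ x₀ ⁆) * (suc κ * M₁)) (λ x → ind (x ∈? L) * B) ⟩
    Σᵥ (λ x → ind (x ∈? ⁅ x₀ ⁆) * (suc κ * M₁)) + Σᵥ (λ x → ind (x ∈? L) * B)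
      ≤⟨ +-mono-≤ (weighted-≤ ⁅ x₀ ⁆ (λ _ → suc κ * M₁) (suc κ * M₁) (λ _ _ → ≤-refl))
          (weighted-≤ L (λ _ → B) B (λ _ _ → ≤-refl)) ⟩
    ∣ ⁅ x₀ ⁆ ∣ * (suc κ * M₁) + ∣ L ∣ * B
      ≡⟨ cong₂ _+_ (trans (cong (_* (suc κ * M₁)) (∣⁅x⁆∣≡1 x₀)) (*-identityˡ _)) (cong (_* B) L-size) ⟩
    suc κ * M₁ + suc ℓ * B ∎
    where
    open ≤-Reasoning
    B = (3 + κ) * ((3 + κ) * M₂)
    term : ∀ x → ind (x ∈? L) * #star x ≤ ind (x ∈? ⁅ x₀ ⁆) * (suc κ * M₁) + ind (x ∈? L) * B
    term x with x ∈? L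
    ... | no _ = z≤n
    ... | yes x∈L with x Fin.≟ x₀
    ... | yes refl = ≤-trans (*-monoʳ-≤ 1 (star-bound x∈L))
        (≤-trans (≤-reflexive (*-distribˡ-+ 1 (∣ kernel x ∣ * M₁) B))
            (+-monoˡ-≤ (1 * B) (≤-trans (*-monoʳ-≤ 1 (*-monoˡ-≤ M₁ small))
                (*-monoˡ-≤ (suc κ * M₁) (≤-reflexive (sym (ind-≡1 (x ∈? ⁅ x ⁆) (x∈⁅x⁆ x))))))))
    ... | no x≢ = ≤-trans (*-monoʳ-≤ 1 (≤-trans (star-bound x∈L)
        (≤-reflexive (cong (λ z → z * M₁ + B) (empty x∈L x≢)))))
            (m≤n+m (1 * B) (ind (x ∈? ⁅ x₀ ⁆) * (suc κ * M₁)))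

  trichotomy : total ≤ suc ℓ * M₁ ⊎ total + u C (2 + κ) ≤ (2 + μ) C (2 + κ) + ℓ ⊎
    total ≤ suc κ * M₁ + suc ℓ * ((3 + κ) * ((3 + κ) * M₂))
  trichotomy with Fin.any? (λ x → (x ∈? L) ×-dec (2 + κ ≤? ∣ kernel x ∣))
  ... | yes (x , x∈L , K≥) = inj₂ (inj₁ (full-kernel x∈L K≥))
  ... | no ¬full with Fin.any? (λ x → (x ∈? L) ×-dec nonempty? (kernel x))
  ... | no ¬any = let (x₀ , x₀∈L , _) = ∃-∖ L Sub.⊥ (≤-trans (s≤s (≤-reflexive (∣⊥∣≡0 n))) (≤-trans (s≤s z≤n) (≤-reflexive (sym L-size)))) in
        inj₂ (inj₂ (few-kernels x₀∈L (λ {x} x∈L _ → empty x∈L) (≤-trans (≤-reflexive (empty x₀∈L)) z≤n)))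
    where
    empty : ∀ {x} → x ∈ L → ∣ kernel x ∣ ≡ 0
    empty {x} x∈L = trans (cong ∣_∣ (Empty-unique λ ne → ¬any (x , x∈L , ne))) (∣⊥∣≡0 n)
  ... | yes (x₀ , x₀∈L , b , b∈) with Fin.any? (λ x → (x ∈? L) ×-dec (¬? (x Fin.≟ x₀) ×-dec nonempty? (kernel x)))
  ... | yes (x , x∈L , x≢ , b′ , b′∈) = inj₁ (two-kernels x≢ b′∈ b∈)
  ... | no ¬two = inj₂ (inj₂ (few-kernels x₀∈L (λ {x} x∈L x≢ →
          trans (cong ∣_∣ (Empty-unique λ ne → ¬two (x , x∈L , x≢ , ne))) (∣⊥∣≡0 n))
          (s≤s⁻¹ (≰⇒> λ q → ¬full (x₀ , x₀∈L , q)))))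

  count-F : Unique F → length F ≤ (2 + μ) C (3 + κ) + total
  count-F uniq = begin
    length F ≤⟨ split-by-hitting uniq uniform L ⟩
    ∣ H ∣ C (3 + κ) + Σₛ (λ A → ind (hitting? F L A))
      ≤⟨ +-mono-≤ (≤-reflexive (cong (_C (3 + κ)) H-size))
          (cover-bound (hitting? F L) L (λ (_ , hit) → let (x , x∈A , x∈L) = meet hit in x , x∈L , x∈A)) ⟩
    (2 + μ) C (3 + κ) + Σᵥ (λ x → ind (x ∈? L) * Σₛ (λ A → ind (hitting? F L A ×-dec (x ∈? A))))
      ≤⟨ +-monoʳ-≤ ((2 + μ) C (3 + κ)) (Σᵥ-mono λ x → *-monoʳ-≤ (ind (x ∈? L)) (Σₛ-mono λ A →
           ind-mono (hitting? F L A ×-dec (x ∈? A)) (star? x A) λ ((A∈ , _) , x∈A) → A∈ , x∈A)) ⟩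
    (2 + μ) C (3 + κ) + total ∎
    where open ≤-Reasoning

-- The size of H and the edges meeting L

maximal-matching : ∀ {n} (G : List (Subset n)) → (∀ {e} → e LM.∈ G → Nonempty e) →
  ∃ λ M → All (LM._∈ G) M × AllPairs Disjoint M × (∀ {e} → e LM.∈ G → ¬ Disjoint e (⋃ M))
maximal-matching [] ne = [] , [] , [] , λ ()
maximal-matching (e ∷ G) ne with maximal-matching G (ne ∘ there)
... | M , M∈ , pairs , max with disjoint? e (⋃ M)
... | no ¬d = M , All.map there M∈ , pairs , λ { (here refl) → ¬d ; (there f∈) → max f∈ }
... | yes d = e ∷ M , here refl ∷ All.map there M∈ , disjoint-⋃ d ∷ pairs , λ
  -- Nonemptiness matters here: an empty edge would be disjoint from every set, even from a union
  -- that includes it.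
  { (here refl) d′ → let (x , x∈e) = ne (here refl) in disjoint⁻ d′ x∈e (x∈p∪q⁺ (inj₁ x∈e))
  ; (there f∈) d′ → max f∈ (disjoint-⊆ (q⊆p∪q e (⋃ M)) d′) }

module Structure {n : ℕ} (κ y τ s m : ℕ) (F : List (Subset n))
  (uniform : ∀ {A} → A LM.∈ F → ∣ A ∣ ≡ 3 + κ)
  (uniq : Unique F) (nontrivial : NonTrivial F) (ν≤s : MatchingNumberAtMost F s)
  (∅-good : Matchings.Good (2 + κ) y F uniform (3 + κ) Sub.⊥)
  (m-eq : 2 + m ≡ (3 + κ) * s + (3 + κ)) (m<n : 2 + m ≤ n)
  (τ-big : (3 + κ) * y + (3 + κ) * ((3 + κ) * y) + (3 + κ) * ((3 + κ) * y) ≤ τ)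
      (n-big : τ + (3 + κ) * y + (3 + κ) ≤ n)
  (n-huge : (3 + κ) * y + (3 + κ) * ((3 + κ) * y) +
      ((3 + κ) * ((3 + κ) * y) + ((3 + κ) * ((3 + κ) * ((3 + κ) * y) + (3 + κ)) + ((3 + κ) * y + (3 + κ)))) ≤ n) where

  open Matchings (2 + κ) y F uniform
  open Packing
  open Pack τ

  H : Subset n
  H = ∁ L

  ∣L∣< : ∣ L ∣ < k * y
  ∣L∣< = ≤-<-trans (p⊆q⇒∣p∣≤∣q∣ (L⊆bad n-big)) ∅-good

  -- The packing of H outside the edges of `M` leaves fewer than k vertices, and together with `M`
  -- it is a matching, of at most s edges.
  matching-bound : ∀ M → All (LM._∈ F) M → AllPairs Disjoint M → length M ≤ k * y →
    k * length M + ∣ H ─ ⋃ M ∣ < k * s + k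
  matching-bound M M∈ pairs M≤ = conclude (pack ∅-good W-high (≤-trans (+-monoˡ-≤ (k * (k * y)) ∣∁W∣) τ-big) W-big)
    where
    open ≤-Reasoning
    W = H ─ ⋃ M
    W-high : Disjoint W L
    W-high = disjoint⁺ λ x∈W → x∈∁p⇒x∉p (p─q⊆p H _ x∈W)
    cover : ∀ {x} → x ∈ ∁ W → x ∈ L ⊎ x ∈ ⋃ M
    cover {x} x∈ with x ∈? L | x ∈? ⋃ M
    ... | yes p | _ = inj₁ p
    ... | no _ | yes q = inj₂ q
    ... | no p | no q = ⊥-elim (x∈∁p⇒x∉p x∈ (x∈p∧x∉q⇒x∈p─q (x∉p⇒x∈∁p p) q))
    ∣∁W∣ : ∣ ∁ W ∣ ≤ k * y + k * (k * y)
    ∣∁W∣ = ≤-trans (card-cover (∁ W) L (⋃ M) cover) (+-mono-≤ (<⇒≤ ∣L∣<)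
      (≤-trans (∣⋃∣≤ M k (All.map (≤-reflexive ∘ uniform) M∈)) (*-monoʳ-≤ k M≤)))
    W-big : k * (k * y) + (k * (k * (k * y) + k) + (k * y + k)) ≤ ∣ W ∣
    W-big = +-cancelˡ-≤ (k * y + k * (k * y)) _ _ (begin
      k * y + k * (k * y) + (k * (k * y) + (k * (k * (k * y) + k) + (k * y + k))) ≤⟨ n-huge ⟩
      n ≡⟨ sym (trans (+-comm ∣ ∁ W ∣ ∣ W ∣) (∣∁∣ W)) ⟩
      ∣ ∁ W ∣ + ∣ W ∣ ≤⟨ +-monoˡ-≤ ∣ W ∣ ∣∁W∣ ⟩
      k * y + k * (k * y) + ∣ W ∣ ∎)
    conclude : (∃ λ (N : Packing W) → ∣ W ∣ < k * size N + k) → k * length M + ∣ W ∣ < k * s + k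
    conclude (N , lt) = begin
      suc (k * length M + ∣ W ∣) ≡⟨ sym (+-suc (k * length M) ∣ W ∣) ⟩
      k * length M + suc ∣ W ∣ ≤⟨ +-monoʳ-≤ (k * length M) lt ⟩
      k * length M + (k * size N + k) ≡⟨ sym (+-assoc (k * length M) (k * size N) k) ⟩
      k * length M + k * size N + k ≡⟨ cong (_+ k) (sym (*-distribˡ-+ k (length M) (size N))) ⟩
      k * (length M + size N) + k ≡⟨ cong (λ z → k * z + k) (sym (length-++ M)) ⟩
      k * length (M ++ edges N) + k ≤⟨ +-monoˡ-≤ k (*-monoʳ-≤ k (ν≤s (M ++ edges N) (AllP.++⁺ M∈ (edges∈F N))
        (AllPairsP.++⁺ pairs (pairwise N) (All.tabulate λ e∈ → All.map (λ d → disjoint⁺ λ a b →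
          ∉─ H _ (⊆-of-∁ d b) (∈⋃⁺ e∈ a)) (inside-W N))))) ⟩
      k * s + k ∎

  trace-bound : ∀ {e} → e LM.∈ F → ¬ Disjoint e L → ∣ e ∩ H ∣ ≤ 2 + κ
  trace-bound {e} e∈ hit = let (x , x∈e , x∈L) = meet hit in s≤s⁻¹ (begin
      suc ∣ e ∩ H ∣ ≡⟨ sym (∪⁅⁆-size (e ∩ H) λ q → x∈∁p⇒x∉p (p∩q⊆q e H q) x∈L) ⟩
      ∣ (e ∩ H) ∪ ⁅ x ⁆ ∣ ≤⟨ p⊆q⇒∣p∣≤∣q∣ (∪⁅⁆-⊆ (p∩q⊆p e H) x∈e) ⟩
      ∣ e ∣ ≡⟨ uniform e∈ ⟩
      3 + κ ∎)
    where
    open ≤-Reasoning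

  H-cover : ∀ M → ∣ H ∣ ≤ ∣ ⋃ (map (_∩ H) M) ∣ + ∣ H ─ ⋃ M ∣
  H-cover M = card-cover H (⋃ (map (_∩ H) M)) (H ─ ⋃ M) split
    where
    split : ∀ {x} → x ∈ H → x ∈ ⋃ (map (_∩ H) M) ⊎ x ∈ H ─ ⋃ M
    split {x} x∈H with x ∈? ⋃ M
    ... | no q = inj₂ (x∈p∧x∉q⇒x∈p─q x∈H q)
    ... | yes q = let (e , e∈ , x∈e) = ∈⋃⁻ M q in inj₁ (∈⋃⁺ (LMP.∈-map⁺ (_∩ H) e∈) (x∈p∩q⁺ (x∈e , x∈H)))

  -- An edge meeting `L` has at most k - 1 vertices in H, one fewer than `matching-bound` charges
  -- for it. The edges of `M` meet `L` in different vertices, so there are fewer than k y of them,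
  -- as that bound requires.
  H-bound : ∀ M → All (LM._∈ F) M → AllPairs Disjoint M → All (λ e → ¬ Disjoint e L) M →
    ∣ H ∣ + length M < 2 + m
  H-bound M M∈ pairs hit = begin
    suc (∣ H ∣ + length M) ≤⟨ s≤s (+-monoˡ-≤ (length M) (H-cover M)) ⟩
    suc (∣ ⋃ (map (_∩ H) M) ∣ + ∣ W ∣ + length M)
      ≤⟨ s≤s (+-monoˡ-≤ (length M) (+-monoˡ-≤ ∣ W ∣ (∣⋃∣≤ (map (_∩ H) M) (2 + κ)
          (AllP.map⁺ (All.zipWith (λ (a , b) → trace-bound a b) (M∈ , hit)))))) ⟩
    suc ((2 + κ) * length (map (_∩ H) M) + ∣ W ∣ + length M)
      ≡⟨ cong (λ z → suc ((2 + κ) * z + ∣ W ∣ + length M)) (length-map (_∩ H) M) ⟩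
    suc ((2 + κ) * length M + ∣ W ∣ + length M) ≡⟨ cong suc (collect (2 + κ) (length M) (∣ W ∣)) ⟩
    suc (k * length M + ∣ W ∣)
      ≤⟨ matching-bound M M∈ pairs (≤-trans (length≤∣hit∣ M L pairs hit) (<⇒≤ ∣L∣<)) ⟩
    k * s + k ≡⟨ sym m-eq ⟩
    2 + m ∎
    where
    open ≤-Reasoning
    W = H ─ ⋃ M
    collect : ∀ c l w → c * l + w + l ≡ l + c * l + w
    collect = solve-∀

  ∃-hitting : ∀ {x} → x ∈ L → ∃ λ e → e LM.∈ F × ¬ Disjoint e L
  ∃-hitting {x} x∈L = let (e , e∈ , x∈e) = LM.find (nontrivial x) in e , e∈ , λ d → disjoint⁻ d x∈e x∈L

  H≤m : ∣ H ∣ ≤ m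
  -- The empty matching gives |H| < m + 2 ≤ n, so `L` is not empty; then an edge through a vertex of
  -- `L` improves the bound by one.
  H≤m = let (x , _ , x∉H) = ∃-∖ ⊤ H (≤-trans (≤-trans (s≤s (≤-reflexive (sym (+-identityʳ ∣ H ∣)))) (H-bound [] [] [] []))
                (≤-trans m<n (≤-reflexive (sym (∣⊤∣≡n n)))))
            (e , e∈ , hit) = ∃-hitting (x∉∁p⇒x∈p x∉H)
        in s≤s⁻¹ (s≤s⁻¹ (≤-trans (s≤s (≤-reflexive (+-comm 1 ∣ H ∣)))
            (H-bound (e ∷ []) (e∈ ∷ []) ([] ∷ []) (hit ∷ []))))

  codegree : {Q : Subset n → Set} (Q? : ∀ A → Dec (Q A)) {v w : Fin n} → w ≢ v →
    (∀ {A} → Q A → A LM.∈ F × v ∈ A × w ∈ A) → Σₛ (λ A → ind (Q? A)) ≤ (n ∸ 2) C suc κ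
  codegree Q? {v} {w} w≢v f = bounded-by-between Q? (⁅ v ⁆ ∪ ⁅ w ⁆) ⊤ (n ∸ 2) (suc κ) (λ _ → ∈⊤)
    (trans (∣⊤∣≡n n) (trans (sym (m+[n∸m]≡n (≤-trans (s≤s (s≤s z≤n)) m<n))) (cong (_+ (n ∸ 2)) (sym two))))
    λ q → let (A∈ , v∈A , w∈A) = f q in ∪⁅⁆-⊆ (⁅⁆-⊆ v∈A) w∈A , (λ _ → ∈⊤) , trans (uniform A∈) (cong (_+ suc κ) (sym two))
    where
    two : ∣ ⁅ v ⁆ ∪ ⁅ w ⁆ ∣ ≡ 2
    two = trans (∪⁅⁆-size ⁅ v ⁆ λ q → w≢v (x∈⁅y⁆⇒x≡y v q)) (cong suc (∣⁅x⁆∣≡1 v))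

  -- A vertex of L has a small cover of its link by definition; for the other vertices take L itself.
  hitting-degree : ∀ v → Σₛ (λ A → ind (hitting? F L A ×-dec (v ∈? A))) ≤ τ * ((n ∸ 2) C suc κ)
  hitting-degree v = ≤-trans (cover-bound-uniform (λ A → hitting? F L A ×-dec (v ∈? A)) X ((n ∸ 2) C suc κ)
      (λ {A} ((A∈ , hit) , v∈A) → let (w , w∈A , w∈X) = meet (hits A∈ hit v∈A) in w , w∈X , w∈A)
      (λ w w∈X → codegree (λ A → (hitting? F L A ×-dec (v ∈? A)) ×-dec (w ∈? A)) (λ { refl → v∉X w∈X })
        λ (((A∈ , _) , v∈A) , w∈A) → A∈ , v∈A , w∈A))
    (*-monoˡ-≤ ((n ∸ 2) C suc κ) X≤τ)
    where
    pick : ∃ λ X → ∣ X ∣ ≤ τ × v ∉ X × (∀ {A} → A LM.∈ F → ¬ Disjoint A L → v ∈ A → ¬ Disjoint A X)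
    pick with v ∈? L
    ... | yes v∈L = let (X , X≤ , v∉X , hits) = ∈sep⁻ low? v∈L in X , X≤ , v∉X , λ A∈ _ v∈A → All.lookup hits A∈ v∈A
    ... | no v∉L = L , ≤-trans (<⇒≤ ∣L∣<) (≤-trans (≤-trans (m≤m+n _ _) (m≤m+n _ _)) τ-big) , v∉L , λ _ hit _ → hit
    X = proj₁ pick
    X≤τ = proj₁ (proj₂ pick)
    v∉X = proj₁ (proj₂ (proj₂ pick))
    hits = proj₂ (proj₂ (proj₂ pick))

  -- By maximality, the at most k r vertices of a maximal matching among the edges meeting `L` cover
  -- all these edges, while `H-bound` limits r.
  crude-bound : ∃ λ r → ∣ H ∣ + r < 2 + m × length F ≤ ∣ H ∣ C k + k * r * (τ * ((n ∸ 2) C suc κ))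
  crude-bound = conclude (maximal-matching (filter hits? F) nonempty)
    where
    hits? : ∀ e → Dec (¬ Disjoint e L)
    hits? e = ¬? (disjoint? e L)
    nonempty : ∀ {e} → e LM.∈ filter hits? F → Nonempty e
    nonempty e∈ = let (x , x∈e , _) = meet (proj₂ (LMP.∈-filter⁻ hits? {xs = F} e∈)) in x , x∈e
    conclude : (∃ λ M → All (LM._∈ filter hits? F) M × AllPairs Disjoint M ×
        (∀ {e} → e LM.∈ filter hits? F → ¬ Disjoint e (⋃ M))) →
      ∃ λ r → ∣ H ∣ + r < 2 + m × length F ≤ ∣ H ∣ C k + k * r * (τ * ((n ∸ 2) C suc κ))
    conclude (M , M∈ , pairs , max) = length M ,
        H-bound M M∈F pairs (All.map (λ q → proj₂ (LMP.∈-filter⁻ hits? {xs = F} q)) M∈) , (begin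
        length F ≤⟨ split-by-hitting uniq uniform L ⟩
        ∣ H ∣ C k + Σₛ (λ A → ind (hitting? F L A))
          ≤⟨ +-monoʳ-≤ (∣ H ∣ C k) (cover-bound-uniform (hitting? F L) (⋃ M) (τ * ((n ∸ 2) C suc κ))
                (λ (A∈ , hit) → let (v , v∈A , v∈T) = meet (max (LMP.∈-filter⁺ hits? A∈ hit)) in v , v∈T , v∈A)
                (λ v _ → hitting-degree v)) ⟩
        ∣ H ∣ C k + ∣ ⋃ M ∣ * (τ * ((n ∸ 2) C suc κ))
          ≤⟨ +-monoʳ-≤ (∣ H ∣ C k) (*-monoˡ-≤ (τ * ((n ∸ 2) C suc κ))
              (∣⋃∣≤ M k (All.map (≤-reflexive ∘ uniform) M∈F))) ⟩
        ∣ H ∣ C k + k * length M * (τ * ((n ∸ 2) C suc κ)) ∎)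
      where
      open ≤-Reasoning
      M∈F : All (LM._∈ F) M
      M∈F = All.map (λ q → proj₁ (LMP.∈-filter⁻ hits? {xs = F} q)) M∈

  module _ (∣H∣≡m : ∣ H ∣ ≡ m) where

    -- An edge with two vertices in `L` would spend only k - 2 vertices of H, saving two where |H| =
    -- m leaves room for one.
    one-in-L : ∀ {A x y} → A LM.∈ F → x ∈ A → y ∈ A → x ∈ L → y ∈ L → x ≡ y
    one-in-L {A} {x} {z} A∈ x∈A z∈A x∈L z∈L with x Fin.≟ z
    ... | yes eq = eq
    ... | no x≢z = ⊥-elim (<-irrefl refl (begin
      suc (2 + m) ≡⟨ cong (λ j → suc (2 + j)) (sym ∣H∣≡m) ⟩
      suc (2 + ∣ H ∣) ≤⟨ s≤s (+-monoʳ-≤ 2 (H-cover (A ∷ []))) ⟩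
      suc (2 + (∣ (A ∩ H) ∪ Sub.⊥ ∣ + ∣ H ─ ⋃ (A ∷ []) ∣)) ≤⟨ s≤s (+-monoˡ-≤ ∣ H ─ ⋃ (A ∷ []) ∣ size-A) ⟩
      suc (k + ∣ H ─ ⋃ (A ∷ []) ∣) ≡⟨ cong (λ j → suc (j + ∣ H ─ ⋃ (A ∷ []) ∣)) (sym (*-identityʳ k)) ⟩
      suc (k * 1 + ∣ H ─ ⋃ (A ∷ []) ∣) ≤⟨ matching-bound (A ∷ []) (A∈ ∷ []) ([] ∷ []) (≤-trans (s≤s z≤n) ∣L∣<) ⟩
      k * s + k ≡⟨ sym m-eq ⟩
      2 + m ∎))
      where
      open ≤-Reasoning
      size-A : 2 + ∣ (A ∩ H) ∪ Sub.⊥ ∣ ≤ k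
      size-A = begin
        2 + ∣ (A ∩ H) ∪ Sub.⊥ ∣ ≡⟨ cong (λ j → 2 + ∣ j ∣) (∪-identityʳ (A ∩ H)) ⟩
        2 + ∣ A ∩ H ∣ ≡⟨ cong suc (sym (∪⁅⁆-size (A ∩ H) λ q → x∈∁p⇒x∉p (p∩q⊆q A H q) x∈L)) ⟩
        suc ∣ (A ∩ H) ∪ ⁅ x ⁆ ∣ ≡⟨ sym (∪⁅⁆-size ((A ∩ H) ∪ ⁅ x ⁆) λ q → [ (λ q → x∈∁p⇒x∉p (p∩q⊆q A H q) z∈L) ,
              (λ q → x≢z (sym (x∈⁅y⁆⇒x≡y x q))) ]′ (x∈p∪q⁻ (A ∩ H) ⁅ x ⁆ q)) ⟩
        ∣ ((A ∩ H) ∪ ⁅ x ⁆) ∪ ⁅ z ⁆ ∣ ≤⟨ p⊆q⇒∣p∣≤∣q∣ (∪⁅⁆-⊆ (∪⁅⁆-⊆ (p∩q⊆p A H) x∈A) z∈A) ⟩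
        ∣ A ∣ ≡⟨ uniform A∈ ⟩
        k ∎

    intersecting : ∀ {A B} → A LM.∈ F → B LM.∈ F → ¬ Disjoint A L → ¬ Disjoint B L → ¬ Disjoint A B
    intersecting {A} {B} A∈ B∈ hitA hitB d = <-irrefl (trans (cong (_+ 2) ∣H∣≡m) (+-comm m 2))
      (H-bound (A ∷ B ∷ []) (A∈ ∷ B∈ ∷ []) ((d ∷ []) ∷ [] ∷ []) (hitA ∷ hitB ∷ []))

-- Lower bounds for the sizes of the extremal families

Σᵥ-unique : ∀ {n} {P : Fin n → Set} (P? : ∀ v → Dec (P v)) {E : Set} (e : Dec E) → (∀ {v} → P v → E) →
  (∀ {v w} → P v → P w → v ≡ w) → Σᵥ (λ v → ind (P? v)) ≤ ind e
Σᵥ-unique {zero} P? e f same = z≤n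
Σᵥ-unique {suc n} P? e f same with P? zero
... | no _ = Σᵥ-unique (P? ∘ suc) e f λ p q → Fin.suc-injective (same p q)
... | yes p = ≤-trans (s≤s (≤-trans (Σᵥ-mono none) (≤-reflexive (Σᵥ-0 n)))) (≤-reflexive (sym (ind-≡1 e (f p))))
  where
  Σᵥ-0 : ∀ j → Σᵥ {j} (λ _ → 0) ≡ 0
  Σᵥ-0 zero = refl
  Σᵥ-0 (suc j) = Σᵥ-0 j
  none : ∀ v → ind (P? (suc v)) ≤ 0
  none v = ind-elim (P? (suc v)) λ q → ⊥-elim (Fin.0≢1+n (same p q))

⊆∧∣∣≥⇒≡ : ∀ {n} {p q : Subset n} → p ⊆ q → ∣ q ∣ ≤ ∣ p ∣ → p ≡ q
⊆∧∣∣≥⇒≡ {p = p} {q} p⊆q le = ⊆-antisym p⊆q q⊆p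
  where
  q⊆p : q ⊆ p
  q⊆p {x} x∈q with x ∈? p
  ... | yes x∈p = x∈p
  ... | no x∉p = ⊥-elim (<⇒≱ (p⊂q⇒∣p∣<∣q∣ (p⊆q , x , x∈q , x∉p)) le)

initial : ∀ n → ℕ → Subset n
initial zero m = []
initial (suc n) zero = false ∷ initial n zero
initial (suc n) (suc m) = true ∷ initial n m

∈initial⁺ : ∀ {n m} {x : Fin n} → toℕ x < m → x ∈ initial n m
∈initial⁺ {suc n} {suc m} {zero} _ = here
∈initial⁺ {suc n} {suc m} {suc x} (s≤s lt) = there (∈initial⁺ lt)

∈initial⁻ : ∀ {n m} {x : Fin n} → x ∈ initial n m → toℕ x < m
∈initial⁻ {suc n} {suc m} {zero} _ = s≤s z≤n
∈initial⁻ {suc n} {suc m} {suc x} (there x∈) = s≤s (∈initial⁻ x∈)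
∈initial⁻ {suc n} {zero} {suc x} (there x∈) with ∈initial⁻ {n} {zero} x∈
... | ()

∣initial∣ : ∀ {n m} → m ≤ n → ∣ initial n m ∣ ≡ m
∣initial∣ {zero} {zero} _ = refl
∣initial∣ {suc n} {zero} _ = ∣initial∣ {n} {zero} z≤n
∣initial∣ {suc n} {suc m} (s≤s le) = cong suc (∣initial∣ le)

⟦_⟧ : ∀ {n} → Fin n → ℕ
⟦ x ⟧ = suc (toℕ x)

All-elemsFrom : ∀ {n} o (A : Subset n) {P : ℕ → Set} → (∀ {x} → x ∈ A → P (suc (o + toℕ x))) → All P (elemsFrom o A)
All-elemsFrom o [] f = []
All-elemsFrom o (true ∷ A) {P} f = subst (λ z → P (suc z)) (+-identityʳ o) (f here) ∷
  All-elemsFrom (suc o) A λ {x} x∈ → subst (λ z → P (suc z)) (+-suc o (toℕ x)) (f (there x∈))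
All-elemsFrom o (false ∷ A) {P} f =
  All-elemsFrom (suc o) A λ {x} x∈ → subst (λ z → P (suc z)) (+-suc o (toℕ x)) (f (there x∈))

∈-elemsFrom : ∀ {n} o (A : Subset n) {x : Fin n} → x ∈ A → suc (o + toℕ x) LM.∈ elemsFrom o A
∈-elemsFrom o (true ∷ A) {zero} here = here (cong suc (+-identityʳ o))
∈-elemsFrom o (true ∷ A) {suc x} (there x∈) = there
    (subst (λ z → suc z LM.∈ elemsFrom (suc o) A) (sym (+-suc o (toℕ x))) (∈-elemsFrom (suc o) A x∈))
∈-elemsFrom o (false ∷ A) {suc x} (there x∈) = subst (λ z → suc z LM.∈ elemsFrom (suc o) A)
    (sym (+-suc o (toℕ x))) (∈-elemsFrom (suc o) A x∈)

filter-elemsFrom : ∀ {n} m o (A : Subset n) {x : Fin n} → x ∈ A → m < suc (o + toℕ x) →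
  (∀ {z} → z ∈ A → z ≢ x → suc (o + toℕ z) ≤ m) → filter (m <?_) (elemsFrom o A) ≡ suc (o + toℕ x) ∷ []
filter-elemsFrom m o (true ∷ A) {zero} here lt rest = trans
  (filter-accept (m <?_) (subst (λ z → m < suc z) (+-identityʳ o) lt))
  (cong₂ _∷_ (cong suc (sym (+-identityʳ o)))
    (filter-none (m <?_) (All-elemsFrom (suc o) A λ {z} z∈ →
      ≤⇒≯ (subst (λ w → suc w ≤ m) (+-suc o (toℕ z)) (rest (there z∈) λ ())))))
filter-elemsFrom m o (true ∷ A) {suc x} (there x∈) lt rest = trans
  (filter-reject (m <?_) (≤⇒≯ (subst (λ z → suc z ≤ m) (+-identityʳ o) (rest here λ ()))))
  (trans (filter-elemsFrom m (suc o) A x∈ (subst (λ z → m < suc z) (+-suc o (toℕ x)) lt)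
    (λ {z} z∈ z≢x → subst (λ w → suc w ≤ m) (+-suc o (toℕ z)) (rest (there z∈) (z≢x ∘ Fin.suc-injective))))
    (cong (λ w → suc w ∷ []) (sym (+-suc o (toℕ x)))))
filter-elemsFrom m o (false ∷ A) {suc x} (there x∈) lt rest =
  trans (filter-elemsFrom m (suc o) A x∈ (subst (λ z → m < suc z) (+-suc o (toℕ x)) lt)
    (λ {z} z∈ z≢x → subst (λ w → suc w ≤ m) (+-suc o (toℕ z)) (rest (there z∈) (z≢x ∘ Fin.suc-injective))))
    (cong (λ w → suc w ∷ []) (sym (+-suc o (toℕ x))))

elemsFrom-⊥ : ∀ {n} o → elemsFrom o (initial n 0) ≡ []
elemsFrom-⊥ {zero} o = refl
elemsFrom-⊥ {suc n} o = elemsFrom-⊥ {n} (suc o)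

-- The function `f` is kept abstract, known only pointwise, because `applyUpTo` recurses to
-- `f ∘ suc`, which matches the shifted offset only up to `+-suc`.
elemsFrom-initial∪⁅⁆ : ∀ {n} r o (x : Fin n) (f : ℕ → ℕ) → (∀ i → f i ≡ suc (o + i)) → r ≤ toℕ x →
  elemsFrom o (initial n r ∪ ⁅ x ⁆) ≡ applyUpTo f r ++ f (toℕ x) ∷ []
elemsFrom-initial∪⁅⁆ {suc n} zero o zero f h le = cong₂ _∷_
  (trans (cong suc (sym (+-identityʳ o))) (sym (h 0)))
  (trans (cong (elemsFrom (suc o)) (∪-identityʳ (initial n 0))) (elemsFrom-⊥ {n} (suc o)))
elemsFrom-initial∪⁅⁆ {suc n} zero o (suc x) f h le =
  elemsFrom-initial∪⁅⁆ zero (suc o) x (f ∘ suc) (λ i → trans (h (suc i)) (cong suc (+-suc o i))) z≤n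
elemsFrom-initial∪⁅⁆ {suc n} (suc r) o (suc x) f h (s≤s le) = cong₂ _∷_
  (trans (cong suc (sym (+-identityʳ o))) (sym (h 0)))
  (elemsFrom-initial∪⁅⁆ r (suc o) x (f ∘ suc) (λ i → trans (h (suc i)) (cong suc (+-suc o i))) le)

eqList-refl : ∀ {xs ys} → xs ≡ ys → T (eqList xs ys)
eqList-refl {[]} refl = tt
eqList-refl {x ∷ xs} refl = Equivalence.from T-∧ (≡⇒≡ᵇ x x refl , eqList-refl {xs} refl)

∈-interval : ∀ {a b v} → a ≤ v → v ≤ b → v LM.∈ interval a b
∈-interval {a} {b} {v} a≤v v≤b = subst (LM._∈ interval a b) (m+[n∸m]≡n a≤v)
  (LMP.∈-applyUpTo⁺ (a +_) (∸-monoˡ-< (s≤s v≤b) a≤v))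

module Extremal (n k₁ s : ℕ) (1≤k₁ : 1 ≤ k₁) (le : suc k₁ * s + suc k₁ ≤ n) where

  k m : ℕ
  k = suc k₁
  m = k * s + k ∸ 2

  m-eq : 2 + m ≡ k * s + k
  m-eq = m+[n∸m]≡n (≤-trans (s≤s 1≤k₁) (m≤n+m k (k * s)))

  2+m≤n : 2 + m ≤ n
  2+m≤n = ≤-trans (≤-reflexive m-eq) le

  core : Subset n
  core = initial n m

  ∣core∣ : ∣ core ∣ ≡ m
  ∣core∣ = ∣initial∣ (≤-trans (m≤n+m m 2) 2+m≤n)

  core-family? : ∀ A → Dec (Between Sub.⊥ core (∣ Sub.⊥ {n} ∣ + k) A)
  core-family? = between? Sub.⊥ core (∣ Sub.⊥ {n} ∣ + k)

  #core-family : Σₛ (λ A → ind (core-family? A)) ≡ m C k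
  #core-family = count-between Sub.⊥ core m k (⊥-elim ∘ ∉⊥) (trans ∣core∣ (cong (_+ m) (sym (∣⊥∣≡0 n))))

  core-subset : ∀ {A} → A ⊆ core → T (subsetOfb m A)
  core-subset {A} A⊆ = AllP.all⁻ (λ v → v Data.Nat.≤ᵇ m) (All-elemsFrom 0 A λ x∈ → ≤⇒≤ᵇ (∈initial⁻ (A⊆ x∈)))

  core-∪⁅⁆-outside : ∀ {A x} → x ∈ A → A ⊆ core ∪ ⁅ x ⁆ → m ≤ toℕ x → T (eqList (outside m A) (⟦ x ⟧ ∷ []))
  core-∪⁅⁆-outside {A} {x} x∈A A⊆ m≤x = eqList-refl (filter-elemsFrom m 0 A x∈A (s≤s m≤x) λ z∈ z≢x →
    [ ∈initial⁻ , (λ q → ⊥-elim (z≢x (x∈⁅y⁆⇒x≡y x q))) ]′ (x∈p∪q⁻ core ⁅ x ⁆ (A⊆ z∈)))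

  size-ok : (A : Subset n) → ∣ A ∣ ≡ k → T (sizeb k A)
  size-ok A = ≡⇒≡ᵇ ∣ A ∣ k

  ∉core : ∀ {x} → m ≤ toℕ x → x ∉ core
  ∉core m≤x x∈ = <⇒≱ (∈initial⁻ x∈) m≤x

  module E₁ where

    one : Fin n
    one = fromℕ< {0} (≤-trans (s≤s z≤n) 2+m≤n)

    one-0 : toℕ one ≡ 0
    one-0 = Fin.toℕ-fromℕ< _

    Member : Fin n → Subset n → Set
    Member x A = (m ≤ toℕ x) × Between (⁅ one ⁆ ∪ ⁅ x ⁆) (core ∪ ⁅ x ⁆) k A

    member? : ∀ x A → Dec (Member x A)
    member? x A = (m ≤? toℕ x) ×-dec between? (⁅ one ⁆ ∪ ⁅ x ⁆) (core ∪ ⁅ x ⁆) k A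

    x∈ : ∀ {x A} → Member x A → x ∈ A
    x∈ {x} (_ , K⊆ , _) = K⊆ (∈∪⁅⁆ ⁅ one ⁆ x)

    inE₁-core : ∀ {A} → Between Sub.⊥ core (∣ Sub.⊥ {n} ∣ + k) A → T (inE1 n k s A)
    inE₁-core {A} (_ , A⊆ , eq) = Equivalence.from (T-∧ {sizeb k A})
      (size-ok A (trans eq (cong (_+ k) (∣⊥∣≡0 n))) , Equivalence.from (T-∨ {subsetOfb m A}) (inj₁ (core-subset A⊆)))

    inE₁-star : ∀ {x A} → Member x A → T (inE1 n k s A)
    inE₁-star {x} {A} mem@(m≤x , K⊆ , A⊆ , eq) = Equivalence.from (T-∧ {sizeb k A}) (size-ok A eq ,
      Equivalence.from (T-∨ {subsetOfb m A}) (inj₂ (AnyP.any⁺ _ (LM.lose (∈-interval (s≤s m≤x) (Fin.toℕ<n x))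
        (Equivalence.from (T-∧ {eqList (outside m A) (⟦ x ⟧ ∷ [])}) (core-∪⁅⁆-outside (x∈ mem) A⊆ m≤x ,
          AnyP.any⁺ _ (LM.lose (∈-elemsFrom 0 A (K⊆ (p⊆p∪q ⁅ x ⁆ (x∈⁅x⁆ one)))) (≡⇒≡ᵇ _ 1 (cong suc one-0)))))))))

    star-unique : ∀ {A x z} → Member x A → Member z A → x ≡ z
    star-unique {A} {x} {z} mem@(m≤x , _) (_ , _ , A⊆ , _) =
      [ (λ q → ⊥-elim (∉core m≤x q)) , x∈⁅y⁆⇒x≡y z ]′ (x∈p∪q⁻ core ⁅ z ⁆ (A⊆ (x∈ mem)))

    -- In this statement `κ` is k - 2 and `μ` is m - 1, so that `μ C κ` is C(m - 1, k - 2), the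
    -- number of members through a given one of the n - m vertices outside the core.
    lower : ∀ {κ μ} → k ≡ 2 + κ → m ≡ suc μ → m C k + (n ∸ m) * (μ C κ) ≤ E1size n k s
    lower {κ} {μ} k≡ m≡ = begin
      m C k + (n ∸ m) * (μ C κ) ≤⟨ +-mono-≤ (≤-reflexive (sym #core-family)) stars ⟩
      Σₛ (λ A → ind (core-family? A)) + Σₛ (λ A → Σᵥ (λ x → ind (member? x A)))
        ≡⟨ sym (Σₛ-+ (λ A → ind (core-family? A)) (λ A → Σᵥ (λ x → ind (member? x A)))) ⟩
      Σₛ (λ A → ind (core-family? A) + Σᵥ (λ x → ind (member? x A))) ≤⟨ Σₛ-mono pointwise ⟩
      Σₛ (λ A → ind (T? (inE1 n k s A))) ≡⟨ sym (filter-allSubsets (λ A → T? (inE1 n k s A))) ⟩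
      E1size n k s ∎
      where
      open ≤-Reasoning
      pointwise : ∀ A → ind (core-family? A) + Σᵥ (λ x → ind (member? x A)) ≤ ind (T? (inE1 n k s A))
      pointwise A = ≤-trans (+-monoʳ-≤ (ind (core-family? A))
          (Σᵥ-unique (λ x → member? x A) (Fin.any? λ x → member? x A) (λ p → _ , p) star-unique))
        (ind-disjoint (core-family? A) (Fin.any? λ x → member? x A) (T? (inE1 n k s A)) inE₁-core
            (λ (_ , p) → inE₁-star p)
          λ (_ , A⊆ , _) (_ , p) → ∉core (proj₁ p) (A⊆ (x∈ p)))
      top : Subset n
      top = ∁ core
      ∣top∣ : ∣ top ∣ ≡ n ∸ m
      ∣top∣ = trans (∣∁p∣≡n∸∣p∣ core) (cong (n ∸_) ∣core∣)
      one∈core : one ∈ core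
      one∈core = ∈initial⁺ (≤-trans (s≤s (≤-reflexive one-0)) (≤-trans (s≤s z≤n) (≤-reflexive (sym m≡))))
      stars : (n ∸ m) * (μ C κ) ≤ Σₛ (λ A → Σᵥ (λ x → ind (member? x A)))
      stars = begin
        (n ∸ m) * (μ C κ) ≡⟨ cong (_* (μ C κ)) (trans (sym ∣top∣) (card-Σᵥ top)) ⟩
        Σᵥ (λ x → ind (x ∈? top)) * (μ C κ) ≡⟨ sym (Σᵥ-*ʳ (λ x → ind (x ∈? top)) (μ C κ)) ⟩
        Σᵥ (λ x → ind (x ∈? top) * (μ C κ)) ≤⟨ Σᵥ-mono star ⟩
        Σᵥ (λ x → Σₛ (λ A → ind (member? x A))) ≡⟨ sym (Σₛ-Σᵥ-swap (λ x A → ind (member? x A))) ⟩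
        Σₛ (λ A → Σᵥ (λ x → ind (member? x A))) ∎
        where
        star : ∀ x → ind (x ∈? top) * (μ C κ) ≤ Σₛ (λ A → ind (member? x A))
        star x with x ∈? top
        ... | no _ = z≤n
        ... | yes x∈top = ≤-trans (≤-reflexive (trans (*-identityˡ _) (sym (count-between K (core ∪ ⁅ x ⁆) μ κ
                 (∪⁅⁆-⊆ (⁅⁆-⊆ (x∈p∪q⁺ (inj₁ one∈core))) (∈∪⁅⁆ core x))
                 (trans (∪⁅⁆-size core (x∈∁p⇒x∉p x∈top)) (trans (cong suc (trans ∣core∣ m≡))
                     (cong (_+ μ) (sym two))))))))
              (Σₛ-mono λ A → ind-mono (between? K (core ∪ ⁅ x ⁆) (∣ K ∣ + κ) A) (member? x A)
                 λ (a , b , c) → ≮⇒≥ (λ lt → x∈∁p⇒x∉p x∈top (∈initial⁺ lt)) , a , b , trans c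
                     (trans (cong (_+ κ) two) (sym k≡)))
          where
          K = ⁅ one ⁆ ∪ ⁅ x ⁆
          two : ∣ K ∣ ≡ 2
          two = trans (∪⁅⁆-size ⁅ one ⁆ λ q → x∈∁p⇒x∉p x∈top (subst (_∈ core) (sym (x∈⁅y⁆⇒x≡y one q)) one∈core))
              (cong suc (∣⁅x⁆∣≡1 one))

  module E₀ where

    -- As `toℕ` is one less than the integer represented, `next` is ks + k - 1, and `suc m ≤ toℕ x`
    -- in `tail?` describes the integers from ks + k on.
    next : Fin n
    next = fromℕ< {m} (≤-trans (n≤1+n (suc m)) 2+m≤n)

    next-m : toℕ next ≡ m
    next-m = Fin.toℕ-fromℕ< _

    next∉core : next ∉ core
    next∉core = ∉core (≤-reflexive (sym next-m))

    first : Subset n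
    first = initial n k₁

    tail? : ∀ (x : Fin n) → Dec (suc m ≤ toℕ x)
    tail? x = suc m ≤? toℕ x

    tail : Subset n
    tail = sep tail?

    full? : ∀ A → Dec (Between ⁅ next ⁆ (core ∪ ⁅ next ⁆) k A)
    full? = between? ⁅ next ⁆ (core ∪ ⁅ next ⁆) k

    avoid? : ∀ A → Dec (Between ⁅ next ⁆ ((core ─ first) ∪ ⁅ next ⁆) k A)
    avoid? = between? ⁅ next ⁆ ((core ─ first) ∪ ⁅ next ⁆) k

    spike? : ∀ A → Dec (Between first (first ∪ tail) k A)
    spike? = between? first (first ∪ tail) k

    inE₀-core : ∀ {A} → Between Sub.⊥ core (∣ Sub.⊥ {n} ∣ + k) A → T (inE0 n k s A)
    inE₀-core {A} (_ , A⊆ , eq) = Equivalence.from (T-∧ {sizeb k A})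
      (size-ok A (trans eq (cong (_+ k) (∣⊥∣≡0 n))) , Equivalence.from (T-∨ {subsetOfb m A}) (inj₁ (core-subset A⊆)))

    inE₀-full : ∀ {A} → Between ⁅ next ⁆ (core ∪ ⁅ next ⁆) k A →
      T (inE0 n k s A) ⊎ Between ⁅ next ⁆ ((core ─ first) ∪ ⁅ next ⁆) k A
    inE₀-full {A} (K⊆ , A⊆ , eq) with disjoint? A first
    ... | yes d = inj₂ (K⊆ , (λ z∈ → [ (λ q → x∈p∪q⁺ (inj₁ (x∈p∧x∉q⇒x∈p─q q (disjoint⁻ d z∈)))) ,
            (λ q → x∈p∪q⁺ {p = core ─ first} (inj₂ q)) ]′ (x∈p∪q⁻ core ⁅ next ⁆ (A⊆ z∈))) , eq)
    ... | no ¬d = let (z , z∈A , z∈first) = meet ¬d in inj₁ (Equivalence.from (T-∧ {sizeb k A}) (size-ok A eq ,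
          Equivalence.from (T-∨ {subsetOfb m A}) (inj₂ (Equivalence.from
              (T-∨ {eqList (outside m A) (suc m ∷ []) Data.Bool.∧ meetsb k₁ A}) (inj₁
            (Equivalence.from (T-∧ {eqList (outside m A) (suc m ∷ [])})
              (subst (λ j → T (eqList (outside m A) (suc j ∷ []))) next-m
                (core-∪⁅⁆-outside (K⊆ (x∈⁅x⁆ next)) A⊆ (≤-reflexive (sym next-m))) ,
              AnyP.any⁺ _ (LM.lose (∈-elemsFrom 0 A z∈A) (≤⇒≤ᵇ (∈initial⁻ z∈first))))))))))

    inE₀-spike : ∣ first ∣ ≡ k₁ → k₁ ≤ m → ∀ {A} → Between first (first ∪ tail) k A →
      (∃ λ x → x ∈ A × suc m ≤ toℕ x) × T (inE0 n k s A)
    inE₀-spike ∣first∣ k₁≤m {A} (K⊆ , A⊆ , eq) =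
      let (x , x∈A , x∉first) = ∃-∖ A first (≤-reflexive (trans (cong suc ∣first∣) (sym eq)))
          m<x : suc m ≤ toℕ x
          m<x = [ (λ q → ⊥-elim (x∉first q)) , ∈sep⁻ tail? ]′ (x∈p∪q⁻ first tail (A⊆ x∈A))
          A≡ : first ∪ ⁅ x ⁆ ≡ A
          A≡ = ⊆∧∣∣≥⇒≡ (∪⁅⁆-⊆ K⊆ x∈A) (≤-reflexive (trans eq
              (sym (trans (∪⁅⁆-size first x∉first) (cong suc ∣first∣)))))
      in (x , x∈A , m<x) , Equivalence.from (T-∧ {sizeb k A}) (size-ok A eq ,
          Equivalence.from (T-∨ {subsetOfb m A}) (inj₂ (Equivalence.from
              (T-∨ {eqList (outside m A) (suc m ∷ []) Data.Bool.∧ meetsb k₁ A}) (inj₂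
            (AnyP.any⁺ _ (LM.lose (∈-interval (≤-trans (≤-reflexive (sym m-eq)) (s≤s m<x)) (Fin.toℕ<n x))
              (eqList-refl (trans (cong elems (sym A≡)) (elemsFrom-initial∪⁅⁆ k₁ 0 x suc (λ _ → refl)
                  (≤-trans k₁≤m (≤-trans (n≤1+n m) m<x)))))))))))

    -- Among the k-sets formed by `next` and vertices of the core, only the C(u, k - 1) ones that
    -- miss [k - 1] fail to be members. They stay on the right, in the form in which `full-kernel`
    -- has them on the left.
    lower : ∀ {u} → m ≡ k₁ + u → m C k + m C k₁ + (n ∸ suc m) ≤ E0size n k s + u C k₁
    lower {u} m≡ = begin
      m C k + m C k₁ + (n ∸ suc m) ≡⟨ cong₂ _+_ (cong₂ _+_ (sym #core-family) (sym #full)) (sym #spike) ⟩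
      Σₛ (λ A → ind (core-family? A)) + Σₛ (λ A → ind (full? A)) + Σₛ (λ A → ind (spike? A))
        ≡⟨ cong (_+ Σₛ (λ A → ind (spike? A))) (sym (Σₛ-+ (λ A → ind (core-family? A)) (λ A → ind (full? A)))) ⟩
      Σₛ (λ A → ind (core-family? A) + ind (full? A)) + Σₛ (λ A → ind (spike? A))
        ≡⟨ sym (Σₛ-+ (λ A → ind (core-family? A) + ind (full? A)) (λ A → ind (spike? A))) ⟩
      Σₛ (λ A → ind (core-family? A) + ind (full? A) + ind (spike? A)) ≤⟨ Σₛ-mono pointwise ⟩
      Σₛ (λ A → ind (T? (inE0 n k s A)) + ind (avoid? A))
        ≡⟨ Σₛ-+ (λ A → ind (T? (inE0 n k s A))) (λ A → ind (avoid? A)) ⟩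
      Σₛ (λ A → ind (T? (inE0 n k s A))) + Σₛ (λ A → ind (avoid? A))
        ≡⟨ cong₂ _+_ (sym (filter-allSubsets (λ A → T? (inE0 n k s A)))) #avoid ⟩
      E0size n k s + u C k₁ ∎
      where
      open ≤-Reasoning
      k₁≤m : k₁ ≤ m
      k₁≤m = ≤-trans (m≤m+n k₁ u) (≤-reflexive (sym m≡))
      ∣first∣ : ∣ first ∣ ≡ k₁
      ∣first∣ = ∣initial∣ (≤-trans k₁≤m (≤-trans (m≤n+m m 2) 2+m≤n))
      first⊆core : first ⊆ core
      first⊆core x∈ = ∈initial⁺ (≤-trans (∈initial⁻ x∈) k₁≤m)
      1+ : ∀ {t} → ∣ ⁅ next ⁆ ∣ + t ≡ suc t
      1+ {t} = cong (_+ t) (∣⁅x⁆∣≡1 next)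
      #full : Σₛ (λ A → ind (full? A)) ≡ m C k₁
      #full = trans (cong (λ j → Σₛ (λ A → ind (between? ⁅ next ⁆ (core ∪ ⁅ next ⁆) j A))) (sym 1+))
        (count-between ⁅ next ⁆ (core ∪ ⁅ next ⁆) m k₁ (⁅⁆-⊆ (∈∪⁅⁆ core next))
          (trans (∪⁅⁆-size core next∉core) (trans (cong suc ∣core∣) (sym 1+))))
      ∣core─first∣ : ∣ core ─ first ∣ ≡ u
      ∣core─first∣ = +-cancelˡ-≡ ∣ first ∣ _ _ (trans (≤-antisym
        (card-disjoint-∪ first (core ─ first) core first⊆core (p─q⊆p core first) (λ a b → ∉─ core first b a))
            (∣p∣≤∣q∣+∣p─q∣ core first))
        (trans ∣core∣ (trans m≡ (cong (_+ u) (sym ∣first∣)))))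
      #avoid : Σₛ (λ A → ind (avoid? A)) ≡ u C k₁
      #avoid = trans (cong (λ j → Σₛ (λ A → ind (between? ⁅ next ⁆ ((core ─ first) ∪ ⁅ next ⁆) j A))) (sym 1+))
        (count-between ⁅ next ⁆ ((core ─ first) ∪ ⁅ next ⁆) u k₁ (⁅⁆-⊆ (∈∪⁅⁆ (core ─ first) next))
          (trans (∪⁅⁆-size (core ─ first) λ q → next∉core (p─q⊆p core first q))
              (trans (cong suc ∣core─first∣) (sym 1+))))
      ∣tail∣ : ∣ tail ∣ ≡ n ∸ suc m
      ∣tail∣ = trans (cong ∣_∣ (⊆-antisym {i = tail} {∁ (initial n (suc m))}
          (λ {x} q → x∉p⇒x∈∁p λ q′ → <⇒≱ (∈initial⁻ q′) (∈sep⁻ tail? q))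
          (λ {x} q → ∈sep⁺ tail? (≮⇒≥ λ lt → x∈∁p⇒x∉p q (∈initial⁺ lt)))))
        (trans (∣∁p∣≡n∸∣p∣ (initial n (suc m))) (cong (n ∸_) (∣initial∣ (≤-trans (n≤1+n (suc m)) 2+m≤n))))
      first-tail : ∀ {x} → x ∈ first → x ∉ tail
      first-tail a b = <⇒≱ (≤-trans (∈initial⁻ a) (≤-trans k₁≤m (n≤1+n m))) (∈sep⁻ tail? b)
      #spike : Σₛ (λ A → ind (spike? A)) ≡ n ∸ suc m
      #spike = trans (cong (λ j → Σₛ (λ A → ind (between? first (first ∪ tail) j A)))
          (trans (sym (+-comm k₁ 1)) (cong (_+ 1) (sym ∣first∣))))
        (trans (count-between first (first ∪ tail) (n ∸ suc m) 1 (p⊆p∪q tail)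
          (trans (≤-antisym (∣∪∣≤ first tail) (card-disjoint-∪ first tail (first ∪ tail) (p⊆p∪q tail)
              (q⊆p∪q first tail) first-tail))
            (cong (∣ first ∣ +_) ∣tail∣)))
          (nC1≡n (n ∸ suc m)))
      base? : ∀ A → Dec (Between Sub.⊥ core (∣ Sub.⊥ {n} ∣ + k) A ⊎ Between ⁅ next ⁆ (core ∪ ⁅ next ⁆) k A)
      base? A = core-family? A ⊎-dec full? A
      inE₀-or-avoid? : ∀ A → Dec (T (inE0 n k s A) ⊎ Between ⁅ next ⁆ ((core ─ first) ∪ ⁅ next ⁆) k A)
      inE₀-or-avoid? A = T? (inE0 n k s A) ⊎-dec avoid? A
      pointwise : ∀ A → ind (core-family? A) + ind (full? A) + ind (spike? A) ≤ ind (T? (inE0 n k s A)) + ind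
          (avoid? A)
      pointwise A = begin
        ind (core-family? A) + ind (full? A) + ind (spike? A)
          ≤⟨ +-monoˡ-≤ (ind (spike? A)) (ind-disjoint (core-family? A) (full? A) (base? A) inj₁ inj₂
               λ (_ , A⊆ , _) (K⊆ , _) → next∉core (A⊆ (K⊆ (x∈⁅x⁆ next)))) ⟩
        ind (base? A) + ind (spike? A)
          ≤⟨ ind-disjoint (base? A) (spike? A) (inE₀-or-avoid? A) [ inj₁ ∘ inE₀-core , inE₀-full ]′
              (inj₁ ∘ proj₂ ∘ inE₀-spike ∣first∣ k₁≤m) clash ⟩
        ind (inE₀-or-avoid? A) ≤⟨ ind-⊎ (inE₀-or-avoid? A) (T? (inE0 n k s A)) (avoid? A) id ⟩
        ind (T? (inE0 n k s A)) + ind (avoid? A) ∎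
        where
        clash : Between Sub.⊥ core (∣ Sub.⊥ {n} ∣ + k) A ⊎ Between ⁅ next ⁆ (core ∪ ⁅ next ⁆) k A → ¬ Between
            first (first ∪ tail) k A
        clash b sp with inE₀-spike ∣first∣ k₁≤m sp
        clash (inj₁ (_ , A⊆ , _)) sp | (x , x∈A , m<x) , _ = <⇒≱ (∈initial⁻ (A⊆ x∈A)) (<⇒≤ m<x)
        clash (inj₂ (_ , A⊆ , _)) sp | (x , x∈A , m<x) , _ = [ (λ q → <⇒≱ (∈initial⁻ q) (<⇒≤ m<x)) ,
          (λ q → <-irrefl (sym (trans (cong toℕ (x∈⁅y⁆⇒x≡y next q)) next-m)) m<x) ]′ (x∈p∪q⁻ core ⁅ next ⁆ (A⊆ x∈A))

-- The third alternative of the trichotomy is dominated by one of the other two, since M₁ exceeds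
-- any fixed multiple of M₂.
module Comparison (κ μ u ℓ : ℕ) (split : 2 + μ ≡ 2 + κ + u)
  (big : suc κ * (2 * ((3 + κ) * ((3 + κ) * (3 + κ)))) ≤ suc μ) where
  open ≤-Reasoning

  k M₁ M₂ : ℕ
  k = 3 + κ
  M₁ = suc μ C suc κ
  M₂ = μ C κ

  -- By absorption, `M₁` is (m - 1)/(k - 2) times `M₂`.
  M₂≪M₁ : 2 * (k * (k * k)) * M₂ ≤ M₁
  M₂≪M₁ = *-cancelˡ-≤ (suc κ) (begin
    suc κ * (2 * (k * (k * k)) * M₂) ≡⟨ sym (*-assoc (suc κ) (2 * (k * (k * k))) M₂) ⟩
    suc κ * (2 * (k * (k * k))) * M₂ ≤⟨ *-monoˡ-≤ M₂ big ⟩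
    suc μ * M₂ ≡⟨ sym (absorption μ κ) ⟩
    suc κ * M₁ ∎)

  cube : ∀ a b c → a * (b * (b * c)) ≡ a * (b * b) * c
  cube = solve-∀

  double : ∀ a c → a * c + a * c ≡ 2 * a * c
  double = solve-∀

  -- C(m, k - 1) exceeds C(u, k - 1) by at least (k - 1) C(u, k - 2), and C(u, k - 2) falls short of
  -- `M₁` by at most (k - 2) `M₂`. So k - 1 copies of `M₁` face k - 2, and the spare copy absorbs
  -- all multiples of `M₂`. The shortfall is added to both sides before cancelling.
  few-small-L : suc ℓ ≤ 2 + κ → suc κ * M₁ + suc ℓ * (k * (k * M₂)) + u C (2 + κ) ≤ (2 + μ) C (2 + κ)
  few-small-L ℓ≤ = +-cancelʳ-≤ ((2 + κ) * (suc κ * M₂)) _ _ (begin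
    suc κ * M₁ + suc ℓ * (k * (k * M₂)) + u C (2 + κ) + (2 + κ) * (suc κ * M₂)
      ≡⟨ regroup (suc κ * M₁) (suc ℓ * (k * (k * M₂))) (u C (2 + κ)) ((2 + κ) * (suc κ * M₂)) ⟩
    u C (2 + κ) + (suc ℓ * (k * (k * M₂)) + (2 + κ) * (suc κ * M₂) + suc κ * M₁)
      ≤⟨ +-monoʳ-≤ (u C (2 + κ)) (+-monoˡ-≤ (suc κ * M₁) (≤-trans (+-mono-≤ first second)
           (≤-trans (≤-reflexive (double (k * (k * k)) M₂)) M₂≪M₁))) ⟩
    u C (2 + κ) + (2 + κ) * M₁ ≤⟨ +-monoʳ-≤ (u C (2 + κ)) (*-monoʳ-≤ (2 + κ) M₁≤) ⟩
    u C (2 + κ) + (2 + κ) * (u C suc κ + suc κ * M₂)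
      ≡⟨ cong (u C (2 + κ) +_) (*-distribˡ-+ (2 + κ) (u C suc κ) (suc κ * M₂)) ⟩
    u C (2 + κ) + ((2 + κ) * (u C suc κ) + (2 + κ) * (suc κ * M₂)) ≡⟨ sym (+-assoc (u C (2 + κ)) _ _) ⟩
    u C (2 + κ) + (2 + κ) * (u C suc κ) + (2 + κ) * (suc κ * M₂)
      ≤⟨ +-monoˡ-≤ ((2 + κ) * (suc κ * M₂)) (C-lower u (2 + κ) (suc κ)) ⟩
    (u + (2 + κ)) C (2 + κ) + (2 + κ) * (suc κ * M₂)
      ≡⟨ cong (λ z → z C (2 + κ) + (2 + κ) * (suc κ * M₂)) (trans (+-comm u (2 + κ)) (sym split)) ⟩
    (2 + μ) C (2 + κ) + (2 + κ) * (suc κ * M₂) ∎)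
    where
    regroup : ∀ a b c d → a + b + c + d ≡ c + (b + d + a)
    regroup = solve-∀
    sum-eq : u + suc κ ≡ suc μ
    sum-eq = trans (+-comm u (suc κ)) (suc-injective (sym split))
    M₁≤ : M₁ ≤ u C suc κ + suc κ * M₂
    M₁≤ = subst (λ z → z C suc κ ≤ u C suc κ + suc κ * M₂) sum-eq (C-upper u (suc κ) κ (≤-reflexive sum-eq))
    κ≤k : suc κ ≤ k
    κ≤k = m≤n+m (suc κ) 2
    first : suc ℓ * (k * (k * M₂)) ≤ k * (k * k) * M₂
    first = ≤-trans (*-monoˡ-≤ (k * (k * M₂)) (≤-trans ℓ≤ (n≤1+n _))) (≤-reflexive (cube k k M₂))
    second : (2 + κ) * (suc κ * M₂) ≤ k * (k * k) * M₂
    second = ≤-trans (*-mono-≤ (n≤1+n (2 + κ)) (*-mono-≤ κ≤k (m≤n*m M₂ k))) (≤-reflexive (cube k k M₂))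

  -- With t = |L| - (k - 1) there are t + 1 spare copies of `M₁`, and |L| ≤ (t + 1)k, so each copy
  -- has to absorb only k³ `M₂`.
  few-large-L : 2 + κ ≤ suc ℓ → suc κ * M₁ + suc ℓ * (k * (k * M₂)) ≤ suc ℓ * M₁
  few-large-L ℓ≥ = subst (λ z → suc κ * M₁ + z * (k * (k * M₂)) ≤ z * M₁) (m+[n∸m]≡n ℓ≥) (begin
    suc κ * M₁ + (2 + κ + t) * (k * (k * M₂)) ≤⟨ +-monoʳ-≤ (suc κ * M₁) (*-monoˡ-≤ (k * (k * M₂)) weak) ⟩
    suc κ * M₁ + suc t * k * (k * (k * M₂)) ≡⟨ cong (suc κ * M₁ +_) (*-assoc (suc t) k (k * (k * M₂))) ⟩
    suc κ * M₁ + suc t * (k * (k * (k * M₂)))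
      ≤⟨ +-monoʳ-≤ (suc κ * M₁) (*-monoʳ-≤ (suc t) (≤-trans (≤-reflexive (cube k k M₂))
           (≤-trans (*-monoˡ-≤ M₂ (m≤n*m (k * (k * k)) 2)) M₂≪M₁))) ⟩
    suc κ * M₁ + suc t * M₁ ≡⟨ sym (*-distribʳ-+ M₁ (suc κ) (suc t)) ⟩
    (suc κ + suc t) * M₁ ≡⟨ cong (_* M₁) (+-suc (suc κ) t) ⟩
    (2 + κ + t) * M₁ ∎)
    where
    t = suc ℓ ∸ (2 + κ)
    weak : 2 + κ + t ≤ suc t * k
    weak = +-mono-≤ (n≤1+n (2 + κ)) (m≤m*n t k)

-- The choice of constants and the final comparison

module Proof (κ s n : ℕ) (k≤ : (3 + κ) * s + (3 + κ) ≤ n)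
  (F : List (Subset n)) (uniq : Unique F) (uniform : ∀ {A} → A LM.∈ F → ∣ A ∣ ≡ 3 + κ)
  (nontrivial : NonTrivial F) (ν≤s : MatchingNumberAtMost F s) where

  private
    k D : ℕ
    k = 3 + κ
    D = 7 * (k * (k * k)) * (3 * k) ^ suc κ

  open Extremal n (2 + κ) s (s≤s z≤n) k≤ using (m; m-eq; 2+m≤n; module E₀; module E₁)

  module _ (y : ℕ) (k≤y : k ≤ y) (Dy≤s : D * y ≤ s) (s≤2Dy : s ≤ 2 * D * y)
    (close : ((3 * k) * (2 * D)) ^ k * (n ∸ m) + (n ∸ m) ≤ k * s) where
    open ≤-Reasoning

    1≤y : 1 ≤ y
    1≤y = ≤-trans (s≤s z≤n) k≤y

    instance
      y≢0 : NonZero y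
      y≢0 = >-nonZero 1≤y
      3k^≢0 : NonZero ((3 * k) ^ suc κ)
      3k^≢0 = m^n≢0 (3 * k) (suc κ)

    1≤s : 1 ≤ s
    1≤s = ≤-trans 1≤y (≤-trans (m≤n*m y D {{m*n≢0 (7 * (k * (k * k))) ((3 * k) ^ suc κ)}}) Dy≤s)

    -- The unit k³y bounds each of k, k y and k²y, so the size conditions are counted in multiples
    -- of it. The largest multiple that occurs is 7, in `n-huge`; this is the factor 7 of `D`.
    Z : ℕ
    Z = k * (k * (k * y))

    7Z≤s : 7 * Z ≤ s
    7Z≤s = begin
      7 * Z ≡⟨ shape k y ⟩
      7 * (k * (k * k)) * y ≤⟨ *-monoˡ-≤ y (m≤m*n (7 * (k * (k * k))) ((3 * k) ^ suc κ)) ⟩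
      D * y ≤⟨ Dy≤s ⟩
      s ∎
      where
      shape : ∀ a b → 7 * (a * (a * (a * b))) ≡ 7 * (a * (a * a)) * b
      shape = solve-∀

    s≤n : s ≤ n
    s≤n = ≤-trans (m≤n*m s k) (≤-trans (m≤m+n (k * s) k) k≤)

    ky≤ : k * y ≤ Z
    ky≤ = *-monoʳ-≤ k (≤-trans (m≤n*m y k) (m≤n*m (k * y) k))

    kky≤ : k * (k * y) ≤ Z
    kky≤ = *-monoʳ-≤ k (m≤n*m (k * y) k)

    k≤Z : k ≤ Z
    k≤Z = m≤m*n k (k * (k * y)) {{m*n≢0 k (k * y) {{_}} {{m*n≢0 k y}}}}

    τ : ℕ
    τ = k * y + k * (k * y) + k * (k * y)

    n-big : τ + k * y + k ≤ n
    n-big = begin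
      τ + k * y + k ≤⟨ +-mono-≤ (+-mono-≤ (+-mono-≤ (+-mono-≤ ky≤ kky≤) kky≤) ky≤) k≤Z ⟩
      Z + Z + Z + Z + Z ≤⟨ m≤m+n _ (Z + Z) ⟩
      Z + Z + Z + Z + Z + (Z + Z) ≡⟨ seven Z ⟩
      7 * Z ≤⟨ ≤-trans 7Z≤s s≤n ⟩
      n ∎
      where
      seven : ∀ z → z + z + z + z + z + (z + z) ≡ 7 * z
      seven = solve-∀

    n-huge : k * y + k * (k * y) + (k * (k * y) + (k * (k * (k * y) + k) + (k * y + k))) ≤ n
    n-huge = begin
      k * y + k * (k * y) + (k * (k * y) + (k * (k * (k * y) + k) + (k * y + k)))
        ≤⟨ +-mono-≤ (+-mono-≤ ky≤ kky≤) (+-mono-≤ kky≤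
            (+-mono-≤ (≤-reflexive (*-distribˡ-+ k (k * (k * y)) k)) (+-mono-≤ ky≤ k≤Z))) ⟩
      -- The term k² has no factor y; it is bounded by means of k ≤ y, which comes from s > k D.
      Z + Z + (Z + (Z + k * k + (Z + Z))) ≤⟨ +-monoʳ-≤ (Z + Z)
          (+-monoʳ-≤ Z (+-monoˡ-≤ (Z + Z) (+-monoʳ-≤ Z (≤-trans (*-monoʳ-≤ k k≤y) ky≤)))) ⟩
      Z + Z + (Z + (Z + Z + (Z + Z))) ≡⟨ seven Z ⟩
      7 * Z ≤⟨ ≤-trans 7Z≤s s≤n ⟩
      n ∎
      where
      seven : ∀ z → z + z + (z + (z + z + (z + z))) ≡ 7 * z
      seven = solve-∀

    m≤n : m ≤ n
    m≤n = ≤-trans (m≤n+m m 2) 2+m≤n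

    n≤3ks : n ≤ 3 * k * s
    n≤3ks = begin
      n ≡⟨ sym (m+[n∸m]≡n m≤n) ⟩
      m + (n ∸ m) ≤⟨ +-mono-≤ (≤-trans (m≤n+m m 2) (≤-reflexive m-eq)) (≤-trans (m≤n+m (n ∸ m) _) close) ⟩
      k * s + k + k * s ≤⟨ +-monoˡ-≤ (k * s) (+-monoʳ-≤ (k * s) (m≤m*n k s {{>-nonZero 1≤s}})) ⟩
      k * s + k * s + k * s ≡⟨ triple k s ⟩
      3 * k * s ∎
      where
      triple : ∀ a b → a * b + a * b + a * b ≡ 3 * a * b
      triple = solve-∀

    μ u ℓ : ℕ
    μ = m ∸ 2
    u = m ∸ (2 + κ)
    ℓ = n ∸ suc m

    k₁≤m : 2 + κ ≤ m
    k₁≤m = s≤s⁻¹ (s≤s⁻¹ (begin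
      4 + κ ≤⟨ +-monoˡ-≤ k 1≤s ⟩
      s + k ≤⟨ +-monoˡ-≤ k (m≤n*m s k) ⟩
      k * s + k ≡⟨ sym m-eq ⟩
      2 + m ∎))

    m≡2+μ : 2 + μ ≡ m
    m≡2+μ = m+[n∸m]≡n (≤-trans (s≤s (s≤s z≤n)) k₁≤m)

    m≡k₁+u : 2 + κ + u ≡ m
    m≡k₁+u = m+[n∸m]≡n k₁≤m

    sucℓ : suc ℓ ≡ n ∸ m
    sucℓ = sym (+-∸-assoc 1 (≤-trans (n≤1+n (suc m)) 2+m≤n))

    1≤ℓ : 1 ≤ ℓ
    1≤ℓ = m<n⇒0<n∸m 2+m≤n

    μ-big : suc κ * (2 * (k * (k * k))) ≤ suc μ
    μ-big = s≤s⁻¹ (begin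
      suc (suc κ * (2 * (k * (k * k)))) ≤⟨ s≤s (*-mono-≤ {suc κ} {k} (m≤n+m (suc κ) 2)
          (≤-trans (*-monoˡ-≤ (k * (k * k)) (m≤m+n 2 5)) 7k³≤s)) ⟩
      suc (k * s) ≤⟨ s≤s⁻¹ (s≤s⁻¹ ks≤) ⟩
      m ≡⟨ sym m≡2+μ ⟩
      2 + μ ∎)
      where
      7k³≤s : 7 * (k * (k * k)) ≤ s
      7k³≤s = ≤-trans (≤-trans (m≤m*n (7 * (k * (k * k))) y)
          (*-monoˡ-≤ y (m≤m*n (7 * (k * (k * k))) ((3 * k) ^ suc κ)))) Dy≤s
      ks≤ : 3 + k * s ≤ 2 + m
      ks≤ = begin
        3 + k * s ≤⟨ +-monoˡ-≤ (k * s) (m≤m+n 3 κ) ⟩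
        k + k * s ≡⟨ +-comm k (k * s) ⟩
        k * s + k ≡⟨ sym m-eq ⟩
        2 + m ∎

    open Matchings (2 + κ) y F uniform using (Good; good?; not-good⇒missing; #missing; missing?)

    module _ (F-large : m C k < length F) where

      -- More than C(m, k) of the C(n, k) sets are present, and C(n, k) - C(m, k) is at most (n - m)
      -- C(n, k - 1).
      #missing-bound : #missing Sub.⊥ ≤ (n ∸ m) * n ^ (2 + κ)
      #missing-bound = +-cancelʳ-≤ (m C k) _ _ (begin
        #missing Sub.⊥ + m C k ≤⟨ +-monoʳ-≤ (#missing Sub.⊥) (≤-trans (<⇒≤ F-large) (length≤Σₛ uniq)) ⟩
        #missing Sub.⊥ + Σₛ (λ A → ind (A ∈ₗ? F)) ≡⟨ sym (Σₛ-+ (λ A → ind (missing? Sub.⊥ A)) (λ A → ind (A ∈ₗ? F))) ⟩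
        Σₛ (λ A → ind (missing? Sub.⊥ A) + ind (A ∈ₗ? F))
          ≤⟨ Σₛ-mono (λ A → ind-disjoint (missing? Sub.⊥ A) (A ∈ₗ? F) (between? (Sub.⊥ {n}) ⊤ (∣ Sub.⊥ {n} ∣ + k) A)
               (λ (eq , _) → (⊥-elim ∘ ∉⊥) , (λ _ → ∈⊤) , trans eq (cong (_+ k) (sym (∣⊥∣≡0 n))))
               (λ A∈ → (⊥-elim ∘ ∉⊥) , (λ _ → ∈⊤) , trans (uniform A∈) (cong (_+ k) (sym (∣⊥∣≡0 n))))
               (λ (_ , A∉ , _) → A∉)) ⟩
        Σₛ (λ A → ind (between? (Sub.⊥ {n}) ⊤ (∣ Sub.⊥ {n} ∣ + k) A))
          ≡⟨ count-between (Sub.⊥ {n}) ⊤ n k (λ _ → ∈⊤) (trans (∣⊤∣≡n n) (cong (_+ n) (sym (∣⊥∣≡0 n)))) ⟩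
        n C k ≡⟨ cong (_C k) (sym (m+[n∸m]≡n m≤n)) ⟩
        (m + (n ∸ m)) C k ≤⟨ C-upper m (n ∸ m) (2 + κ) (≤-trans (≤-reflexive (m+[n∸m]≡n m≤n)) (n≤1+n n)) ⟩
        m C k + (n ∸ m) * (n C (2 + κ)) ≤⟨ +-monoʳ-≤ (m C k) (*-monoʳ-≤ (n ∸ m) (C≤^ n (2 + κ))) ⟩
        m C k + (n ∸ m) * n ^ (2 + κ) ≡⟨ +-comm (m C k) _ ⟩
        (n ∸ m) * n ^ (2 + κ) + m C k ∎)

      -- Otherwise at least y^k sets are missing. Since (Q + 1)(n - m) ≤ ks and n ≤ 3ks, this would
      -- give (Q + 1) y^k ≤ (3ks)^k, while s ≤ 2Dy makes the right side at most Q y^k.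
      ∅-good : Good k Sub.⊥
      ∅-good = decidable-stable (good? k Sub.⊥) λ ¬g → 1+n≰n {Q} (*-cancelʳ-≤ (suc Q) Q (y ^ k) {{m^n≢0 y k}} (begin
        suc Q * y ^ k ≤⟨ *-monoʳ-≤ (suc Q) (≤-trans (not-good⇒missing k Sub.⊥ (cong (_+ k) (∣⊥∣≡0 n)) ¬g)
            #missing-bound) ⟩
        suc Q * ((n ∸ m) * n ^ (2 + κ)) ≡⟨ sym (*-assoc (suc Q) (n ∸ m) (n ^ (2 + κ))) ⟩
        suc Q * (n ∸ m) * n ^ (2 + κ) ≤⟨ *-mono-≤ (≤-trans (≤-reflexive (+-comm (n ∸ m) _)) close)
            (^-monoˡ-≤ (2 + κ) n≤3ks) ⟩
        k * s * (3 * k * s) ^ (2 + κ) ≤⟨ *-monoˡ-≤ ((3 * k * s) ^ (2 + κ)) (*-monoˡ-≤ s (m≤n*m k 3)) ⟩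
        (3 * k * s) ^ k ≤⟨ ^-monoˡ-≤ k (*-monoʳ-≤ (3 * k) s≤2Dy) ⟩
        (3 * k * (2 * D * y)) ^ k ≡⟨ cong (_^ k) (sym (*-assoc (3 * k) (2 * D) y)) ⟩
        (3 * k * (2 * D) * y) ^ k ≡⟨ ^-distribʳ-* k (3 * k * (2 * D)) y ⟩
        Q * y ^ k ∎))
        where
        Q = ((3 * k) * (2 * D)) ^ k

      module S = Structure κ y τ s m F uniform uniq nontrivial ν≤s ∅-good m-eq 2+m≤n ≤-refl n-big n-huge
      open Matchings.Pack (2 + κ) y F uniform τ using (L)

      h : ℕ
      h = ∣ S.H ∣

      h-big : (2 + κ) * s ≤ h
      h-big = +-cancelˡ-≤ s _ _ (begin
        s + (2 + κ) * s ≤⟨ m≤m+n _ k ⟩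
        k * s + k ≤⟨ k≤ ⟩
        n ≡⟨ sym (∣∁∣ L) ⟩
        ∣ L ∣ + h ≤⟨ +-monoˡ-≤ h (≤-trans (<⇒≤ S.∣L∣<) (≤-trans ky≤ (≤-trans (m≤n*m Z 7) 7Z≤s))) ⟩
        s + h ∎)

      τ≤ : τ ≤ 3 * (k * (k * y))
      τ≤ = begin
        τ ≤⟨ +-monoˡ-≤ (k * (k * y)) (+-monoˡ-≤ (k * (k * y)) (m≤n*m (k * y) k)) ⟩
        k * (k * y) + k * (k * y) + k * (k * y) ≡⟨ triple (k * (k * y)) ⟩
        3 * (k * (k * y)) ∎
        where
        triple : ∀ a → a + a + a ≡ 3 * a
        triple = solve-∀

      -- The left side is at most 6k³(3k)^(k - 2) y s^(k - 2), which D y ≤ s brings below s^(k - 1);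
      -- the right side is at least s^(k - 1) because |H| ≥ (k - 1)s.
      link-bound : 2 * k * (τ * ((n ∸ 2) C suc κ)) ≤ h C (2 + κ)
      link-bound = begin
        2 * k * (τ * ((n ∸ 2) C suc κ))
          ≤⟨ *-monoʳ-≤ (2 * k) (*-mono-≤ τ≤ (≤-trans (C-mono (suc κ) (m∸n≤m n 2))
              (≤-trans (C≤^ n (suc κ)) (^-monoˡ-≤ (suc κ) n≤3ks)))) ⟩
        2 * k * (3 * (k * (k * y)) * (3 * k * s) ^ suc κ)
          ≡⟨ cong (λ z → 2 * k * (3 * (k * (k * y)) * z)) (^-distribʳ-* (suc κ) (3 * k) s) ⟩
        2 * k * (3 * (k * (k * y)) * ((3 * k) ^ suc κ * s ^ suc κ)) ≡⟨ shape k y ((3 * k) ^ suc κ) (s ^ suc κ) ⟩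
        6 * (k * (k * k)) * (3 * k) ^ suc κ * y * s ^ suc κ
          ≤⟨ *-monoˡ-≤ (s ^ suc κ) (≤-trans (*-monoˡ-≤ y
              (*-monoˡ-≤ ((3 * k) ^ suc κ) (*-monoˡ-≤ (k * (k * k)) (n≤1+n 6)))) Dy≤s) ⟩
        s * s ^ suc κ ≤⟨ ^≤C s (2 + κ) ⟩
        ((2 + κ) * s) C (2 + κ) ≤⟨ C-mono (2 + κ) h-big ⟩
        h C (2 + κ) ∎
        where
        shape : ∀ a b p q → 2 * a * (3 * (a * (a * b)) * (p * q)) ≡ 6 * (a * (a * a)) * p * b * q
        shape = solve-∀

      -- With h = m - b the matching meeting L has r ≤ b + 1 ≤ 2b edges, which is the origin of the
      -- factor 2 in `link-bound`. Its contribution is at most b C(h, k - 1), no more than the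
      -- passage from h to h + b vertices adds to C(h, k).
      few-high : h < m → length F ≤ m C k
      few-high h<m = conclude S.crude-bound
        where
        b = m ∸ h
        h+b : h + b ≡ m
        h+b = m+[n∸m]≡n (<⇒≤ h<m)
        1≤b : 1 ≤ b
        1≤b = m<n⇒0<n∸m h<m
        conclude : (∃ λ r → h + r < 2 + m × length F ≤ h C k + k * r * (τ * ((n ∸ 2) C suc κ))) → length F ≤ m C k
        conclude (r , h+r< , F≤) = begin
          length F ≤⟨ F≤ ⟩
          h C k + k * r * c ≤⟨ +-monoʳ-≤ (h C k) (*-monoˡ-≤ c (*-monoʳ-≤ k r≤)) ⟩
          h C k + k * (b + b) * c ≡⟨ cong (h C k +_) (shape k b c) ⟩
          h C k + b * (2 * k * c) ≤⟨ +-monoʳ-≤ (h C k) (*-monoʳ-≤ b link-bound) ⟩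
          h C k + b * (h C (2 + κ)) ≤⟨ C-lower h b (2 + κ) ⟩
          (h + b) C k ≡⟨ cong (_C k) h+b ⟩
          m C k ∎
          where
          c = τ * ((n ∸ 2) C suc κ)
          shape : ∀ a b c → a * (b + b) * c ≡ b * (2 * a * c)
          shape = solve-∀
          r≤ : r ≤ b + b
          r≤ = +-cancelˡ-≤ h r (b + b) (begin
            h + r ≤⟨ s≤s⁻¹ h+r< ⟩
            suc m ≡⟨ cong suc (sym h+b) ⟩
            suc (h + b) ≡⟨ sym (+-suc h b) ⟩
            h + suc b ≤⟨ +-monoʳ-≤ h (+-monoˡ-≤ b 1≤b) ⟩
            h + (b + b) ∎)

      many-high : h ≡ m → length F ≤ E0size n k s ⊔ E1size n k s
      many-high h≡m = finish X.trichotomy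
        where
        ∣L∣ : ∣ L ∣ ≡ suc ℓ
        ∣L∣ = trans (+-cancelʳ-≡ m ∣ L ∣ (n ∸ m) (trans (trans (cong (∣ L ∣ +_) (sym h≡m)) (∣∁∣ L))
            (sym (m∸n+n≡m m≤n)))) (sym sucℓ)
        module X = CrossIntersecting κ μ u ℓ F L uniform (trans h≡m (sym m≡2+μ)) (trans m≡2+μ (sym m≡k₁+u)) ∣L∣ 1≤ℓ
          nontrivial (S.one-in-L h≡m) (S.intersecting h≡m)
        module Cmp = Comparison κ μ u ℓ (trans m≡2+μ (sym m≡k₁+u)) μ-big
        F≤ : length F ≤ m C k + X.total
        F≤ = subst (λ z → length F ≤ z C k + X.total) m≡2+μ (X.count-F uniq)
        by-E₁ : X.total ≤ suc ℓ * X.M₁ → length F ≤ E0size n k s ⊔ E1size n k s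
        by-E₁ t≤ = begin
          length F ≤⟨ F≤ ⟩
          m C k + X.total ≤⟨ +-monoʳ-≤ (m C k) (≤-trans t≤ (≤-reflexive (cong (_* X.M₁) sucℓ))) ⟩
          m C k + (n ∸ m) * X.M₁ ≤⟨ E₁.lower refl (sym m≡2+μ) ⟩
          E1size n k s ≤⟨ m≤n⊔m (E0size n k s) _ ⟩
          E0size n k s ⊔ E1size n k s ∎
        by-E₀ : X.total + u C (2 + κ) ≤ (2 + μ) C (2 + κ) + ℓ → length F ≤ E0size n k s ⊔ E1size n k s
        by-E₀ t≤ = ≤-trans (+-cancelʳ-≤ (u C (2 + κ)) _ _ (begin
          length F + u C (2 + κ) ≤⟨ +-monoˡ-≤ (u C (2 + κ)) F≤ ⟩
          m C k + X.total + u C (2 + κ) ≡⟨ +-assoc (m C k) X.total _ ⟩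
          m C k + (X.total + u C (2 + κ)) ≤⟨ +-monoʳ-≤ (m C k) t≤ ⟩
          m C k + ((2 + μ) C (2 + κ) + ℓ) ≡⟨ cong (λ z → m C k + (z C (2 + κ) + ℓ)) m≡2+μ ⟩
          m C k + (m C (2 + κ) + ℓ) ≡⟨ sym (+-assoc (m C k) _ ℓ) ⟩
          m C k + m C (2 + κ) + ℓ ≤⟨ E₀.lower (sym m≡k₁+u) ⟩
          E0size n k s + u C (2 + κ) ∎)) (m≤m⊔n _ (E1size n k s))
        finish : _ ⊎ _ ⊎ _ → length F ≤ E0size n k s ⊔ E1size n k s
        finish (inj₁ t≤) = by-E₁ t≤
        finish (inj₂ (inj₁ t≤)) = by-E₀ t≤
        -- The bound of the third case is compared with the E₁ bound if |L| ≥ k - 1 and with the E₀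
        -- bound if |L| is smaller.
        finish (inj₂ (inj₂ t≤)) with 2 + κ ≤? suc ℓ
        ... | yes ℓ≥ = by-E₁ (≤-trans t≤ (Cmp.few-large-L ℓ≥))
        ... | no ℓ< = by-E₀ (≤-trans (+-monoˡ-≤ (u C (2 + κ)) t≤)
            (≤-trans (Cmp.few-small-L (<⇒≤ (≰⇒> ℓ<))) (m≤m+n _ ℓ)))

      large-case : length F ≤ E0size n k s ⊔ E1size n k s
      large-case with h <? m
      ... | yes h<m = ⊥-elim (<⇒≱ F-large (few-high h<m))
      ... | no h≮m = many-high (≤-antisym S.H≤m (≮⇒≥ h≮m))

    bound : length F ≤ E0size n k s ⊔ E1size n k s
    bound with m C k <? length F
    ... | yes F-large = large-case F-large
    ... | no small = begin
      length F ≤⟨ ≮⇒≥ small ⟩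
      m C k ≤⟨ m≤m+n (m C k) _ ⟩
      m C k + (n ∸ m) * (suc μ C suc κ) ≤⟨ E₁.lower refl (sym m≡2+μ) ⟩
      E1size n k s ≤⟨ m≤n⊔m (E0size n k s) _ ⟩
      E0size n k s ⊔ E1size n k s ∎

-- The number β is the rational p/q. The upper bound on n is multiplied by q and its -2 is moved to
-- the left, so that it can be stated in ℕ without subtraction.
theorem1p6 : (k : ℕ) → 3 ≤ k →
    Σ ℕ λ p → Σ ℕ λ q → Σ ℕ λ s₀ → 1 ≤ p × 1 ≤ q × 1 ≤ s₀ ×
    ((n s : ℕ) → s₀ < s → k * s + k ≤ n →
    q * (n + 2) ≤ (q + p) * k * s + q * k →
    (F : List (Subset n)) → Unique F → All (λ A → ∣ A ∣ ≡ k) F →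
    NonTrivial F → MatchingNumberAtMost F s →
    length F ≤ E0size n k s ⊔ E1size n k s)
theorem1p6 k@(suc (suc (suc κ))) (s≤s (s≤s (s≤s z≤n))) =
  1 , suc Q , k * D , s≤s z≤n , s≤s z≤n , ≤-trans (s≤s z≤n) (m≤m*n k D) , main
  where
  -- With y = ⌊s / D⌋, all exceptional sets have size O(k³y), which D keeps below s even after
  -- multiplication by (n / s)^(k − 2) ≤ (3k)^(k − 2); and β = 1 / (1 + Q) makes the number of missing
  -- k-sets, at most (n − m)n^(k − 1), smaller than y^k.
  D = 7 * (k * (k * k)) * (3 * k) ^ suc κ
  Q = ((3 * k) * (2 * D)) ^ k
  instance
    D≢0 : NonZero D
    D≢0 = m*n≢0 (7 * (k * (k * k))) ((3 * k) ^ suc κ) {{_}} {{m^n≢0 (3 * k) (suc κ)}}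
  main : (n s : ℕ) → k * D < s → k * s + k ≤ n → suc Q * (n + 2) ≤ (suc Q + 1) * k * s + suc Q * k →
    (F : List (Subset n)) → Unique F → All (λ A → ∣ A ∣ ≡ k) F → NonTrivial F → MatchingNumberAtMost F s →
    length F ≤ E0size n k s ⊔ E1size n k s
  main n s s> k≤ n≤ F uniq sizes nontrivial ν≤s =
    Proof.bound κ s n k≤ F uniq (All.lookup sizes) nontrivial ν≤s y k≤y
      (≤-trans (≤-reflexive (*-comm D y)) (m/n*n≤m s D)) s≤2Dy close
    where
    open ≤-Reasoning
    open Extremal n (2 + κ) s (s≤s z≤n) k≤ using (m; m-eq; 2+m≤n)
    y = s / D
    k≤y : k ≤ y
    k≤y = ≤-trans (≤-reflexive (sym (m*n/n≡m k D))) (/-monoˡ-≤ D (<⇒≤ s>))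
    s≤2Dy : s ≤ 2 * D * y
    s≤2Dy = begin
      s ≡⟨ m≡m%n+[m/n]*n s D ⟩
      s % D + y * D ≤⟨ +-monoˡ-≤ (y * D) (<⇒≤ (m%n<n s D)) ⟩
      D + y * D ≤⟨ +-monoˡ-≤ (y * D) (m≤n*m D y {{>-nonZero (≤-trans (s≤s z≤n) k≤y)}}) ⟩
      y * D + y * D ≡⟨ double y D ⟩
      2 * D * y ∎
      where
      double : ∀ a b → a * b + a * b ≡ 2 * b * a
      double = solve-∀
    -- Cancelling (1 + Q)(m + 2) = (1 + Q)(ks + k) from the hypothesis leaves (1 + Q)(n - m) ≤ ks,
    -- that is, n - m ≤ βks.
    close : Q * (n ∸ m) + (n ∸ m) ≤ k * s
    close = +-cancelʳ-≤ (suc Q * (2 + m)) _ _ (begin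
      Q * (n ∸ m) + (n ∸ m) + suc Q * (2 + m) ≡⟨ cong (_+ suc Q * (2 + m)) (+-comm (Q * (n ∸ m)) (n ∸ m)) ⟩
      suc Q * (n ∸ m) + suc Q * (2 + m) ≡⟨ sym (*-distribˡ-+ (suc Q) (n ∸ m) (2 + m)) ⟩
      suc Q * (n ∸ m + (2 + m)) ≡⟨ cong (suc Q *_) (trans (swap-+ (n ∸ m) m)
          (cong (_+ 2) (m∸n+n≡m (≤-trans (m≤n+m m 2) 2+m≤n)))) ⟩
      suc Q * (n + 2) ≤⟨ n≤ ⟩
      (suc Q + 1) * k * s + suc Q * k ≡⟨ expand (suc Q) k s ⟩
      k * s + suc Q * (k * s + k) ≡⟨ cong (λ z → k * s + suc Q * z) (sym m-eq) ⟩
      k * s + suc Q * (2 + m) ∎)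
      where
      swap-+ : ∀ a b → a + (2 + b) ≡ a + b + 2
      swap-+ = solve-∀
      expand : ∀ q a b → (q + 1) * a * b + q * a ≡ a * b + q * (a * b + a)
      expand = solve-∀
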